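{- Let $s,t\ge 3$ be integers, let $d\in\{1,2,\dots,t\}$, let $\varphi$ be the cyclic $d$-shift of $C_t$, and let $G=C_s\Box^{\varphi}C_t$. Then $mbt(G)=4$ if $G$ is bipartite, and $mbt(G)=5$ otherwise.
   Context: The cycle $C_t$ has vertex set $\{1,\dots,t\}$ with $j$ adjacent to $j\pm 1$ (mod $t$). The cyclic $d$-shift of $C_t$ is the automorphism $j\mapsto j+d \pmod t$ (it is nontrivial if $d\not\equiv 0\pmod t$). For an automorphism $\varphi$ of $C_t$, the Cartesian graph bundle $C_s\Box^{\varphi}C_t$ (fiber $C_t$ over base $C_s$, with $\varphi$ assigned to the base edge $\{s,1\}$ and the identity to all other base edges) is the graph with vertex set $\{(i,j):1\le i\le s,\ 1\le j\le t\}$ and edges: $(i,j)\sim(i,j+1)$ (second coordinate mod $t$) for all $i,j$; $(i,j)\sim(i+1,j)$ for $1\le i\le s-1$ and all $j$; and $(s,j)\sim(1,\varphi(j))$ for all $j$. A matching book embedding of a graph $G$ with $m$ pages consists of an arrangement of the vertices of $G$ in some cyclic order on a circle, with edges drawn as chords, together with a proper edge coloring with $m$ colors such that any two edges whose chords cross receive different colors. The matching book thickness $mbt(G)$ is the minimum $m$ for which such an embedding exists. $G$ is called dispersable if $mbt(G)=\Delta(G)$ and nearly dispersable if $mbt(G)=\Delta(G)+1$. -}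

module Defs where

open import Data.Nat using (ℕ; zero; suc; _+_; _*_; _∸_; _≤_; _<_)
open import Data.Nat.DivMod using (_%_)
open import Data.Fin using (Fin; toℕ)
open import Data.Bool using (Bool)
open import Data.Product using (_×_; _,_; Σ; ∃)
open import Data.Sum using (_⊎_)
open import Relation.Binary.PropositionalEquality using (_≡_; _≢_)
open import Function.Definitions using (Injective)

-- m mod n (for n ≥ 1 this is the usual remainder; only used with n = t ≥ 3)
_%'_ : ℕ → ℕ → ℕ
m %' zero    = m
m %' suc n   = m % suc n

-- Vertices of C_s □^φ C_t, 0-indexed: (i , j) stands for the paper's (i+1 , j+1).
V : ℕ → ℕ → Set
V s t = Fin s × Fin t

-- Adjacency in the Cartesian graph bundle C_s □^φ C_t where φ is the cyclic
-- d-shift j ↦ j + d (mod t).  In 0-indexed form φ(j) = (j + d) mod t.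
data BundleAdj (s t d : ℕ) : V s t → V s t → Set where
  fiber     : ∀ i j j' → toℕ j' ≡ (toℕ j + 1) %' t → BundleAdj s t d (i , j) (i , j')
  fiberᵒ    : ∀ i j j' → toℕ j' ≡ (toℕ j + 1) %' t → BundleAdj s t d (i , j') (i , j)
  base      : ∀ i i' j → toℕ i' ≡ suc (toℕ i) → BundleAdj s t d (i , j) (i' , j)
  baseᵒ     : ∀ i i' j → toℕ i' ≡ suc (toℕ i) → BundleAdj s t d (i' , j) (i , j)
  twist     : ∀ i i' j j' → toℕ i ≡ s ∸ 1 → toℕ i' ≡ 0 → toℕ j' ≡ (toℕ j + d) %' t →
              BundleAdj s t d (i , j) (i' , j')
  twistᵒ    : ∀ i i' j j' → toℕ i ≡ s ∸ 1 → toℕ i' ≡ 0 → toℕ j' ≡ (toℕ j + d) %' t →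
              BundleAdj s t d (i' , j') (i , j)

module _ {V : Set} (Adj : V → V → Set) where

  Bipartite : Set
  Bipartite = Σ (V → Bool) λ f → ∀ u v → Adj u v → f u ≢ f v

  Btw : ℕ → ℕ → ℕ → Set
  Btw p q r = (p < r × r < q) ⊎ (q < r × r < p)

  Out : ℕ → ℕ → ℕ → Set
  Out p q r = (r < p × r < q) ⊎ (p < r × q < r)

  -- chords {p,q} and {r,w} cross (vertices placed on a circle in the order of
  -- their positions): exactly one of r, w lies strictly inside the arc p..q,
  -- the other strictly outside.
  Cross : ℕ → ℕ → ℕ → ℕ → Set
  Cross p q r w = (Btw p q r × Out p q w) ⊎ (Out p q r × Btw p q w)

  -- A matching book embedding with m pages: an injective placement of the
  -- vertices (read cyclically) and an edge colouring with m colours which is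
  -- proper and gives crossing chords distinct colours.
  record MatchingBookEmbedding (m : ℕ) : Set where
    field
      pos       : V → ℕ
      pos-inj   : Injective _≡_ _≡_ pos
      col       : (u v : V) → Adj u v → Fin m
      col-sym   : ∀ u v (p : Adj u v) (q : Adj v u) → col u v p ≡ col v u q
      proper    : ∀ u v w (p : Adj u v) (q : Adj u w) → v ≢ w → col u v p ≢ col u w q
      noCross   : ∀ u v x y (p : Adj u v) (q : Adj x y) →
                  Cross (pos u) (pos v) (pos x) (pos y) → col u v p ≢ col x y q

  MBT≡ : ℕ → Set
  MBT≡ m = MatchingBookEmbedding m × (∀ k → MatchingBookEmbedding k → m ≤ k)

-- Lower bounds.  The graph is 4-regular, so at least four pages are needed.  With exactly four, every page is a perfect
-- matching without crossings, so an even number of vertices lies between the ends of every edge and the parity of the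
-- rank in the circular order is a bipartition.
--
-- Upper bounds.  The graph is a quotient of the square grid by a lattice, and it can be bipartite only if t and s + d
-- are even.  For even s the fibres are laid out one after the other in alternating directions: edges between
-- consecutive fibres are then nested, the twisted edges form two nested bundles, and most edges of a fibre join
-- neighbours.  For odd s and bipartite graphs the same is done with the cosets of the cycles transversal to the
-- fibres, folded in two.  For odd s and non-bipartite graphs the last two fibres are interleaved like a ladder, whose
-- rungs and half of whose rail edges join neighbours, except when t = 3.
module Submission where

open import Defs
open import Data.Bool using (Bool; true; false; T; not; _∧_; _∨_; _xor_; if_then_else_)
open import Data.Bool.Properties using (T?; T-∧; T-≡; not-¬; ¬-not; not-involutive)
open import Data.Empty using (⊥; ⊥-elim)
open import Data.Fin as Fin using (Fin; toℕ; fromℕ<)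
open import Data.Fin.Patterns using (0F; 1F; 2F; 3F; 4F)
open import Data.Fin.Properties as Fin using (toℕ<n; toℕ-injective; toℕ-fromℕ<; injective⇒≤)
open import Data.Nat
open import Data.Nat.DivMod
open import Data.Nat.Properties
open import Data.Product using (_×_; _,_; ∃; ∃₂; proj₁; proj₂)
open import Data.Sum using (_⊎_; inj₁; inj₂)
open import Function.Bundles using (Equivalence)
open import Relation.Binary.Definitions using (tri<; tri≈; tri>)
open import Relation.Binary.PropositionalEquality
open import Relation.Nullary using (Dec; ¬_; yes; no; contradiction)
open import Relation.Nullary.Decidable using (isNo; toWitness; toWitnessFalse; _×-dec_; _→-dec_; ¬?)
open import Data.List as List using (List; []; _∷_; length; filter; _++_; cartesianProduct; allFin)
open import Data.List.Properties using (filter-none; filter-accept; filter-reject)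
open import Data.List.Membership.Propositional using (_∈_)
open import Data.List.Membership.Propositional.Properties using (∈-∃++; ∈-filter⁺; ∈-filter⁻; ∈-cartesianProduct⁺; ∈-allFin)
open import Data.List.Relation.Unary.All as All using (All)
open import Data.List.Relation.Unary.AllPairs using ([]; _∷_)
open import Data.List.Relation.Unary.Any using (here; there)
open import Data.List.Relation.Unary.Unique.Propositional using (Unique)
open import Data.List.Relation.Unary.Unique.Propositional.Properties using (filter⁺; cartesianProduct⁺; allFin⁺)
open import Data.List.Relation.Binary.Permutation.Propositional using (_↭_; ↭-sym; ↭⇒↭ₛ)
open import Data.List.Relation.Binary.Permutation.Propositional.Properties using (↭-length; ∈-resp-↭; shift)
import Data.List.Relation.Binary.Permutation.Setoid.Properties as ↭ₛ
open import Relation.Unary using (Decidable)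
open import Data.Product.Properties using (≡-dec)
open import Function using (_∘_)
open import Data.Nat.Tactic.RingSolver using (solve; solve-∀)
open import Data.Nat.Divisibility using (divides)
open import Data.Nat.GCD using (gcd; gcd-GCD; gcd[m,n]∣m; gcd[m,n]∣n; module Bézout)


-- Two obstacles shape the layouts. The first is direction. With an even number of rows in
-- alternating directions the first and the last row run oppositely, which is just what nests the
-- twisted edges. With an odd number they run the same way and the twisted edges cross each other.
-- The ladder lets the last two rows run in one direction without their rungs crossing; the price is
-- that consecutive long rail edges cross, and for odd `t` so do the two edges that close the rails.
-- The spiral avoids the question: for even `t` and odd `d` the transversal cycles have even length,
-- and an even cycle can be folded so that its edges nest. The second obstacle is the column where
-- the twisted edges change page. The fibre edges of the rows they meet must change pages there as
-- well. In the layout with evenly many rows this is free when the column is even, and otherwise a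
-- fifth page absorbs the change. Throughout, an edge between neighbours on the circle crosses
-- nothing, so its page is limited only by the edges at its two ends.

-- Positions on the circle are pairs (block , offset) in lexicographic order, which keeps products out of the
-- crossing arguments.
Pos : Set
Pos = ℕ × ℕ

data _≺_ : Pos → Pos → Set where
  blk : ∀ {a b x y} → a < b → (a , x) ≺ (b , y)
  off : ∀ {a x y} → x < y → (a , x) ≺ (a , y)

≺-trans : ∀ {p q r} → p ≺ q → q ≺ r → p ≺ r
≺-trans (blk x) (blk y) = blk (<-trans x y)
≺-trans (blk x) (off y) = blk x
≺-trans (off x) (blk y) = blk y
≺-trans (off x) (off y) = off (<-trans x y)

≺-irrefl : ∀ {p} → ¬ (p ≺ p)
≺-irrefl (blk x) = n≮n _ x
≺-irrefl (off x) = n≮n _ x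

≺-asym : ∀ {p q} → p ≺ q → ¬ (q ≺ p)
≺-asym x y = ≺-irrefl (≺-trans x y)

module _ (W : ℕ) where
  enc : Pos → ℕ
  enc (b , o) = b * W + o

  -- Only the smaller position needs its offset below `W`: a large offset of the other one merely
  -- moves it further up.
  enc-mono : ∀ {p q} → proj₂ p < W → p ≺ q → enc p < enc q
  enc-mono {a , x} {b , y} x<W (blk a<b) = begin-strict
    a * W + x   <⟨ +-monoʳ-< (a * W) x<W ⟩
    a * W + W   ≡⟨ +-comm (a * W) W ⟩
    suc a * W   ≤⟨ *-monoˡ-≤ W a<b ⟩
    b * W       ≤⟨ m≤m+n (b * W) y ⟩
    b * W + y   ∎
    where open ≤-Reasoning
  enc-mono _ (off x<y) = +-monoʳ-< _ x<y

≺-cmp : ∀ p q → p ≺ q ⊎ p ≡ q ⊎ q ≺ p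
≺-cmp (a , x) (b , y) with <-cmp a b
... | tri< a<b _ _ = inj₁ (blk a<b)
... | tri> _ _ b<a = inj₂ (inj₂ (blk b<a))
... | tri≈ _ refl _ with <-cmp x y
...   | tri< x<y _ _ = inj₁ (off x<y)
...   | tri≈ _ refl _ = inj₂ (inj₁ refl)
...   | tri> _ _ y<x = inj₂ (inj₂ (off y<x))

enc-reflect : ∀ W {p q} → proj₂ p < W → proj₂ q < W → enc W p < enc W q → p ≺ q
enc-reflect W {p} {q} bp bq lt with ≺-cmp p q
... | inj₁ p≺q = p≺q
... | inj₂ (inj₁ refl) = contradiction lt (n≮n _)
... | inj₂ (inj₂ q≺p) = contradiction lt (<-asym (enc-mono W bq q≺p))

enc-injective : ∀ W {p q} → proj₂ p < W → proj₂ q < W → enc W p ≡ enc W q → p ≡ q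
enc-injective W {p} {q} bp bq eq with ≺-cmp p q
... | inj₁ p≺q = contradiction eq (<⇒≢ (enc-mono W bp p≺q))
... | inj₂ (inj₁ e) = e
... | inj₂ (inj₂ q≺p) = contradiction (sym eq) (<⇒≢ (enc-mono W bq q≺p))

-- Directed steps and the interface of a layout

data YStep (t : ℕ) : ℕ → ℕ → Set where
  next : ∀ {j} → suc j < t → YStep t j (suc j)
  last : ∀ {j} → suc j ≡ t → YStep t j 0

-- For `d < t` the shift passes the end of the fibre at most once, so two cases replace the
-- remainder. Writing the second one as a sum keeps truncated subtraction out of later proofs.
data XStep (s t d : ℕ) : ℕ → ℕ → ℕ → ℕ → Set where
  up   : ∀ {i j} → suc i < s → XStep s t d i j (suc i) j
  low  : ∀ {i j} → suc i ≡ s → j + d < t → XStep s t d i j 0 (j + d)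
  high : ∀ {i j j'} → suc i ≡ s → j' + t ≡ j + d → XStep s t d i j 0 j'

_≠_ : ∀ {m} → Fin m → Fin m → Bool
a ≠ b = isNo (a Fin.≟ b)

distinct₄ : ∀ {m} → Fin m → Fin m → Fin m → Fin m → Bool
distinct₄ a b c e = (a ≠ b) ∧ (a ≠ c) ∧ (a ≠ e) ∧ (b ≠ c) ∧ (b ≠ e) ∧ (c ≠ e)

-- The type `T (distinct₄ a b c e)` computes, so its four colours could not be recovered by
-- unification. The record keeps them visible, while eta still lets `_` prove every concrete
-- instance.
record Distinct {m : ℕ} (a b c e : Fin m) : Set where
  field isDistinct : T (distinct₄ a b c e)
open Distinct public

-- An edge is drawn either between neighbouring vertices, where no crossing is possible in any
-- colour, or as a listed chord in one of the two directions. Unoccupied positions may lie inside a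
-- `gap`.
data Drawn (Vx : Pos → Set) (Chord : Pos → Pos → Set) (p q : Pos) : Set where
  gap : (∀ r → Vx r → ¬ ((p ≺ r × r ≺ q) ⊎ (q ≺ r × r ≺ p))) → Drawn Vx Chord p q
  fwd : Chord p q → Drawn Vx Chord p q
  bwd : Chord q p → Drawn Vx Chord p q

-- `cX i j` and `cY i j` colour the edges that leave `(i , j)` along the base and along the fibre.
-- `Chord c` may contain more pairs than there are edges: it is a family described by arithmetic
-- whose members do not cross.
record Layout (s t d m : ℕ) : Set₁ where
  field
    width   : ℕ
    P       : ℕ → ℕ → Pos
    P-bound : ∀ {i j} → i < s → j < t → proj₂ (P i j) < width
    P-inj   : ∀ {i j i' j'} → i < s → j < t → i' < s → j' < t → P i j ≡ P i' j' → i ≡ i' × j ≡ j'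
    cX cY   : ℕ → ℕ → Fin m
    -- Since `(a , b)` and `(i , e)` precede `(i , j)`, these are the colours of all four edges at
    -- `(i , j)`.
    proper  : ∀ {a b i j e} → a < s → b < t → i < s → j < t → e < t → XStep s t d a b i j → YStep t e j →
              Distinct (cX a b) (cX i j) (cY i e) (cY i j)
    Chord   : Fin m → Pos → Pos → Set
    chord-≺ : ∀ {c p q} → Chord c p q → p ≺ q
    -- One order of the four ends suffices, because the other one arises by exchanging the chords.
    uncrossed : ∀ {c p q r w} → Chord c p q → Chord c r w → p ≺ r → r ≺ q → q ≺ w → ⊥
  Vertex : Pos → Set
  Vertex p = ∃₂ λ i j → i < s × j < t × p ≡ P i j
  field
    drawX : ∀ {i j i' j'} → i < s → j < t → j' < t → XStep s t d i j i' j' → Drawn Vertex (Chord (cX i j)) (P i j) (P i' j')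
    drawY : ∀ {i j j'} → i < s → j < t → YStep t j j' → Drawn Vertex (Chord (cY i j)) (P i j) (P i j')

even : ℕ → Bool
even zero    = true
even (suc n) = not (even n)

even-+ : ∀ m n → even (m + n) ≡ not (even m xor even n)
even-+ zero    n = sym (not-involutive (even n))
even-+ (suc m) n = trans (cong not (even-+ m n)) (lemma (even m) (even n))
  where
  lemma : ∀ a b → not (not (a xor b)) ≡ not (not a xor b)
  lemma true  true  = refl
  lemma true  false = refl
  lemma false true  = refl
  lemma false false = refl


-- Steps as partial bijections and the orientation of edges

%-next : ∀ {t j j'} → j < t → j' ≡ (j + 1) %' t → YStep t j j'
%-next {suc t} {j} j<t eq with suc j <? suc t
... | yes lt = subst (YStep _ j) (sym (trans eq (trans (cong (_% suc t) (+-comm j 1)) (m<n⇒m%n≡m lt)))) (next lt)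
... | no  ge = subst (YStep _ j) (sym (trans eq (trans (cong (_% suc t) (trans (+-comm j 1) e)) (n%n≡0 (suc t))))) (last e)
  where e = ≤-antisym j<t (≮⇒≥ ge)

%-shift : ∀ {s t d i j j'} → suc i ≡ s → j < t → d < t → j' ≡ (j + d) %' t → XStep s t d i j 0 j'
%-shift {t = suc t} {d} {j = j} si j<t d<t eq with j + d <? suc t
... | yes lt = subst (XStep _ _ _ _ _ 0) (sym (trans eq (m<n⇒m%n≡m lt))) (low si lt)
... | no  ge = high si (trans (cong (_+ suc t) j'≡) (m∸n+n≡m t≤))
  where
  t≤ = ≮⇒≥ ge
  j'≡ = trans eq (trans (sym (m≤n⇒[n∸m]%m≡n%m t≤))
          (m<n⇒m%n≡m (+-cancelʳ-< (suc t) _ _ (subst (_< suc t + suc t) (sym (m∸n+n≡m t≤)) (+-mono-< j<t d<t)))))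

y-pred : ∀ {t} j → j < t → ∃ λ e → e < t × YStep t e j
y-pred {suc t} zero    _  = t , n<1+n t , last refl
y-pred         (suc j) lt = j , <-trans (n<1+n j) lt , next lt

x-pred : ∀ {s t d} i j → d < t → i < s → j < t → ∃₂ λ a b → a < s × b < t × XStep s t d a b i j
x-pred (suc i) j d<t i<s j<t = i , j , <-trans (n<1+n i) i<s , j<t , up i<s
x-pred {suc s} {t} {d} zero j d<t i<s j<t with d ≤? j
... | yes d≤j = s , j ∸ d , n<1+n s , ≤-<-trans (m∸n≤m j d) j<t ,
      subst (XStep _ _ _ s (j ∸ d) 0) e (low refl (subst (_< t) (sym e) j<t))
  where e = m∸n+n≡m d≤j
... | no d≰j = s , j + t ∸ d , n<1+n s , +-cancelʳ-< d _ _ (subst₂ _<_ (sym e) (+-comm d t) (+-monoˡ-< t (≰⇒> d≰j))) , high refl (sym e)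
  where e = m∸n+n≡m (≤-trans (<⇒≤ d<t) (m≤n+m t j))

y-functional : ∀ {t j a b} → YStep t j a → YStep t j b → a ≡ b
y-functional (next _) (next _) = refl
y-functional (next lt) (last e) = contradiction e (<⇒≢ lt)
y-functional (last e) (next lt) = contradiction e (<⇒≢ lt)
y-functional (last _) (last _) = refl

y-cofunctional : ∀ {t j a b} → YStep t a j → YStep t b j → a ≡ b
y-cofunctional (next _) (next _) = refl
y-cofunctional (last e) (last f) = suc-injective (trans e (sym f))

x-functional : ∀ {s t d i j a b a' b'} → XStep s t d i j a b → XStep s t d i j a' b' → a ≡ a' × b ≡ b'
x-functional (up _) (up _) = refl , refl
x-functional (up lt) (low e _) = contradiction e (<⇒≢ lt)
x-functional (up lt) (high e _) = contradiction e (<⇒≢ lt)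
x-functional (low e _) (up lt) = contradiction e (<⇒≢ lt)
x-functional (low _ _) (low _ _) = refl , refl
x-functional {t = t} (low _ lt) (high {j' = k} _ e) = contradiction (subst (_< t) (sym e) lt) (m+n≮n k t)
x-functional (high e _) (up lt) = contradiction e (<⇒≢ lt)
x-functional {t = t} (high {j' = k} _ e) (low _ lt) = contradiction (subst (_< t) (sym e) lt) (m+n≮n k t)
x-functional (high _ e) (high _ f) = refl , +-cancelʳ-≡ _ _ _ (trans e (sym f))

-- The equations force `b'` to be `b + t`, which lies outside the fibre.
shift-clash : ∀ {t d b b' j} → b' < t → b + d ≡ j → j + t ≡ b' + d → ⊥
shift-clash {t} {d} {b} {b'} b'<t refl e = m+n≮n b t (subst (_< t) (+-cancelʳ-≡ d b' (b + t) (trans (sym e) swap)) b'<t)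
  where
  swap : b + d + t ≡ b + t + d
  swap = trans (+-assoc b d t) (trans (cong (b +_) (+-comm d t)) (sym (+-assoc b t d)))

-- The target column is generalised because unification cannot invert j + d.
x-cofunctional : ∀ {s t d i i' j j' a b a' b'} → b < t → b' < t → XStep s t d a b i j → XStep s t d a' b' i' j' →
                 i ≡ i' → j ≡ j' → a ≡ a' × b ≡ b'
x-cofunctional _ _ (up _) (up _) refl refl = refl , refl
x-cofunctional _ _ (low e _) (low f _) _ q = suc-injective (trans e (sym f)) , +-cancelʳ-≡ _ _ _ q
x-cofunctional {b = b} _ b'<t (low e _) (high f g) _ q = ⊥-elim (shift-clash {b = b} b'<t q g)
x-cofunctional {b' = b'} b<t _ (high f g) (low e _) _ q = ⊥-elim (shift-clash {b = b'} b<t (sym q) g)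
x-cofunctional _ _ (high e f) (high g h) _ refl = suc-injective (trans e (sym g)) , +-cancelʳ-≡ _ _ _ (trans (sym f) h)
x-cofunctional _ _ (up _) (low _ _) () _
x-cofunctional _ _ (up _) (high _ _) () _
x-cofunctional _ _ (low _ _) (up _) () _
x-cofunctional _ _ (high _ _) (up _) () _

data Edge (s t d : ℕ) : ℕ × ℕ → ℕ × ℕ → Set where
  x-edge : ∀ {i j i' j'} → XStep s t d i j i' j' → Edge s t d (i , j) (i' , j')
  y-edge : ∀ {i j j'} → YStep t j j' → Edge s t d (i , j) (i , j')

x-rows : ∀ {s t d i j i' j'} → XStep s t d i j i' j' → i' ≡ suc i ⊎ (suc i ≡ s × i' ≡ 0)
x-rows (up _) = inj₁ refl
x-rows (low e _) = inj₂ (e , refl)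
x-rows (high e _) = inj₂ (e , refl)

x-row-changes : ∀ {s t d i j j'} → 3 ≤ s → ¬ XStep s t d i j i j'
x-row-changes 3≤s e with x-rows e
x-row-changes (s≤s ()) e | inj₂ (refl , refl)

y-asym : ∀ {t j j'} → 3 ≤ t → YStep t j j' → ¬ YStep t j' j
y-asym (s≤s (s≤s ())) (next _) (last refl)
y-asym (s≤s (s≤s ())) (last refl) (next _)

x-asym : ∀ {s t d i j i' j'} → 3 ≤ s → XStep s t d i j i' j' → ¬ XStep s t d i' j' i j
x-asym 3≤s e f with x-rows e | x-rows f
x-asym _ e f | inj₁ refl | inj₁ ()
x-asym (s≤s (s≤s ())) e f | inj₁ refl | inj₂ (refl , refl)
x-asym (s≤s (s≤s ())) e f | inj₂ (refl , refl) | inj₁ refl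
x-asym (s≤s ()) e f | inj₂ (refl , refl) | inj₂ (refl , _)

-- The bounds exclude cycles of length two. Hence an undirected edge has only one direction, and a
-- colour indexed by its tail is well defined.
edge-asym : ∀ {s t d u v} → 3 ≤ s → 3 ≤ t → Edge s t d u v → ¬ Edge s t d v u
edge-asym 3≤s 3≤t (x-edge e) (x-edge f) = x-asym 3≤s e f
edge-asym 3≤s 3≤t (x-edge e) (y-edge f) = x-row-changes 3≤s e
edge-asym 3≤s 3≤t (y-edge e) (x-edge f) = x-row-changes 3≤s f
edge-asym 3≤s 3≤t (y-edge e) (y-edge f) = y-asym 3≤t e f

⌜_⌝ : ∀ {s t} → V s t → ℕ × ℕ
⌜ i , j ⌝ = toℕ i , toℕ j

⌜⌝-injective : ∀ {s t} {u v : V s t} → ⌜ u ⌝ ≡ ⌜ v ⌝ → u ≡ v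
⌜⌝-injective eq = cong₂ _,_ (toℕ-injective (cong proj₁ eq)) (toℕ-injective (cong proj₂ eq))

last-row : ∀ {s i} → i < s → i ≡ s ∸ 1 → suc i ≡ s
last-row {suc s} _ eq = cong suc eq

orient : ∀ {s t d u v} → d < t → BundleAdj s t d u v → Edge s t d ⌜ u ⌝ ⌜ v ⌝ ⊎ Edge s t d ⌜ v ⌝ ⌜ u ⌝
orient d<t (fiber i j j' e) = inj₁ (y-edge (%-next (toℕ<n j) e))
orient d<t (fiberᵒ i j j' e) = inj₂ (y-edge (%-next (toℕ<n j) e))
orient d<t (base i i' j e) = inj₁ (x-edge (subst (λ k → XStep _ _ _ (toℕ i) (toℕ j) k (toℕ j)) (sym e) (up (subst (_< _) e (toℕ<n i')))))
orient d<t (baseᵒ i i' j e) = inj₂ (x-edge (subst (λ k → XStep _ _ _ (toℕ i) (toℕ j) k (toℕ j)) (sym e) (up (subst (_< _) e (toℕ<n i')))))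
orient d<t (twist i i' j j' e e' f) = inj₁ (x-edge (subst (λ k → XStep _ _ _ (toℕ i) (toℕ j) k (toℕ j')) (sym e') (%-shift (last-row (toℕ<n i) e) (toℕ<n j) d<t f)))
orient d<t (twistᵒ i i' j j' e e' f) = inj₂ (x-edge (subst (λ k → XStep _ _ _ (toℕ i) (toℕ j) k (toℕ j')) (sym e') (%-shift (last-row (toℕ<n i) e) (toℕ<n j) d<t f)))

-- From a layout to a matching book embedding

T-∧⁻ : ∀ {a b} → T (a ∧ b) → T a × T b
T-∧⁻ = Equivalence.to T-∧

≠⇒≢ : ∀ {m} {a b : Fin m} → T (a ≠ b) → a ≢ b
≠⇒≢ {a = a} {b} = toWitnessFalse {a? = a Fin.≟ b}

-- The four edges at a vertex: `x` along the base, `y` along the fibre, `i` incoming, `o` outgoing.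
data Port : Set where
  xi xo yi yo : Port

distinct-ports : ∀ {m} (c : Port → Fin m) → Distinct (c xi) (c xo) (c yi) (c yo) → ∀ π ρ → π ≢ ρ → c π ≢ c ρ
distinct-ports c h = go
  where
  h₁ = T-∧⁻ (isDistinct h) ; h₂ = T-∧⁻ (proj₂ h₁) ; h₃ = T-∧⁻ (proj₂ h₂) ; h₄ = T-∧⁻ (proj₂ h₃) ; h₅ = T-∧⁻ (proj₂ h₄)
  go : ∀ π ρ → π ≢ ρ → c π ≢ c ρ
  go xi xi n = contradiction refl n
  go xi xo _ = ≠⇒≢ (proj₁ h₁)
  go xi yi _ = ≠⇒≢ (proj₁ h₂)
  go xi yo _ = ≠⇒≢ (proj₁ h₃)
  go xo xi _ = ≢-sym (≠⇒≢ (proj₁ h₁))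
  go xo xo n = contradiction refl n
  go xo yi _ = ≠⇒≢ (proj₁ h₄)
  go xo yo _ = ≠⇒≢ (proj₁ h₅)
  go yi xi _ = ≢-sym (≠⇒≢ (proj₁ h₂))
  go yi xo _ = ≢-sym (≠⇒≢ (proj₁ h₄))
  go yi yi n = contradiction refl n
  go yi yo _ = ≠⇒≢ (proj₂ h₅)
  go yo xi _ = ≢-sym (≠⇒≢ (proj₁ h₃))
  go yo xo _ = ≢-sym (≠⇒≢ (proj₁ h₅))
  go yo yi _ = ≢-sym (≠⇒≢ (proj₂ h₅))
  go yo yo n = contradiction refl n

_≟ᵖ_ : (π ρ : Port) → π ≡ ρ ⊎ π ≢ ρ
xi ≟ᵖ xi = inj₁ refl
xi ≟ᵖ xo = inj₂ λ ()
xi ≟ᵖ yi = inj₂ λ ()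
xi ≟ᵖ yo = inj₂ λ ()
xo ≟ᵖ xi = inj₂ λ ()
xo ≟ᵖ xo = inj₁ refl
xo ≟ᵖ yi = inj₂ λ ()
xo ≟ᵖ yo = inj₂ λ ()
yi ≟ᵖ xi = inj₂ λ ()
yi ≟ᵖ xo = inj₂ λ ()
yi ≟ᵖ yi = inj₁ refl
yi ≟ᵖ yo = inj₂ λ ()
yo ≟ᵖ xi = inj₂ λ ()
yo ≟ᵖ xo = inj₂ λ ()
yo ≟ᵖ yi = inj₂ λ ()
yo ≟ᵖ yo = inj₁ refl

module _ {s t d m : ℕ} (3≤s : 3 ≤ s) (3≤t : 3 ≤ t) (d<t : d < t) (L : Layout s t d m) where
  open Layout L

  edge-col : ∀ {u v} → Edge s t d u v → Fin m
  edge-col (x-edge {i} {j} _) = cX i j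
  edge-col (y-edge {i} {j} _) = cY i j

  edge-col-unique : ∀ {u v} (e f : Edge s t d u v) → edge-col e ≡ edge-col f
  edge-col-unique (x-edge e) (x-edge f) = refl
  edge-col-unique (x-edge e) (y-edge f) = ⊥-elim (x-row-changes 3≤s e)
  edge-col-unique (y-edge e) (x-edge f) = ⊥-elim (x-row-changes 3≤s f)
  edge-col-unique (y-edge e) (y-edge f) = refl

  or-col : ∀ {u v} → Edge s t d u v ⊎ Edge s t d v u → Fin m
  or-col (inj₁ e) = edge-col e
  or-col (inj₂ e) = edge-col e

  or-col-sym : ∀ {u v} (e : Edge s t d u v ⊎ Edge s t d v u) (f : Edge s t d v u ⊎ Edge s t d u v) → or-col e ≡ or-col f
  or-col-sym (inj₁ e) (inj₁ f) = ⊥-elim (edge-asym 3≤s 3≤t e f)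
  or-col-sym (inj₁ e) (inj₂ f) = edge-col-unique e f
  or-col-sym (inj₂ e) (inj₁ f) = edge-col-unique e f
  or-col-sym (inj₂ e) (inj₂ f) = ⊥-elim (edge-asym 3≤s 3≤t e f)

  module At (u : V s t) where
    i = toℕ (proj₁ u)
    j = toℕ (proj₂ u)
    px = x-pred i j d<t (toℕ<n (proj₁ u)) (toℕ<n (proj₂ u))
    py = y-pred j (toℕ<n (proj₂ u))
    a = proj₁ px
    b = proj₁ (proj₂ px)
    e = proj₁ py

    port-col : Port → Fin m
    port-col xi = cX a b
    port-col xo = cX i j
    port-col yi = cY i e
    port-col yo = cY i j

    b<t = proj₁ (proj₂ (proj₂ (proj₂ px)))
    x-in = proj₂ (proj₂ (proj₂ (proj₂ px)))

    ports-differ : ∀ π ρ → π ≢ ρ → port-col π ≢ port-col ρ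
    ports-differ = distinct-ports port-col
      (proper (proj₁ (proj₂ (proj₂ px))) b<t (toℕ<n (proj₁ u)) (toℕ<n (proj₂ u)) (proj₁ (proj₂ py)) x-in (proj₂ (proj₂ py)))

    data Through (v : ℕ × ℕ) : Port → Set where
      xi : XStep s t d (proj₁ v) (proj₂ v) i j → Through v xi
      xo : XStep s t d i j (proj₁ v) (proj₂ v) → Through v xo
      yi : proj₁ v ≡ i → YStep t (proj₂ v) j → Through v yi
      yo : proj₁ v ≡ i → YStep t j (proj₂ v) → Through v yo

    -- Two different neighbours therefore use different ports, and `ports-differ` separates their
    -- colours.
    through-unique : ∀ {v w π} → proj₂ v < t → proj₂ w < t → Through v π → Through w π → v ≡ w
    through-unique bv bw (xi p) (xi q) = cong₂ _,_ (proj₁ r) (proj₂ r) where r = x-cofunctional bv bw p q refl refl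
    through-unique bv bw (xo p) (xo q) = cong₂ _,_ (proj₁ r) (proj₂ r) where r = x-functional p q
    through-unique bv bw (yi refl p) (yi refl q) = cong (i ,_) (y-cofunctional p q)
    through-unique bv bw (yo refl p) (yo refl q) = cong (i ,_) (y-functional p q)

    port : ∀ {v} → proj₂ v < t → (f : Edge s t d (i , j) v ⊎ Edge s t d v (i , j)) → ∃ λ π → Through v π × or-col f ≡ port-col π
    port _  (inj₁ (x-edge f)) = xo , xo f , refl
    port _  (inj₁ (y-edge f)) = yo , yo refl f , refl
    port bv (inj₂ (x-edge f)) = xi , xi f , cong₂ cX (proj₁ r) (proj₂ r) where r = x-cofunctional bv b<t f x-in refl refl
    port _  (inj₂ (y-edge f)) = yi , yi refl f , cong (cY i) (y-cofunctional f (proj₂ (proj₂ py)))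

  place : V s t → Pos
  place u = P (toℕ (proj₁ u)) (toℕ (proj₂ u))

  place-bound : ∀ u → proj₂ (place u) < width
  place-bound u = P-bound (toℕ<n (proj₁ u)) (toℕ<n (proj₂ u))

  place-vertex : ∀ u → Vertex (place u)
  place-vertex u = _ , _ , toℕ<n (proj₁ u) , toℕ<n (proj₂ u) , refl

  draw : ∀ {u v} → proj₁ u < s → proj₂ u < t → proj₂ v < t → (e : Edge s t d u v) →
         Drawn Vertex (Chord (edge-col e)) (P (proj₁ u) (proj₂ u)) (P (proj₁ v) (proj₂ v))
  draw bi bj bj' (x-edge e) = drawX bi bj bj' e
  draw bi bj bj' (y-edge e) = drawY bi bj e

  drawn-sym : ∀ {c p q} → Drawn Vertex (Chord c) p q → Drawn Vertex (Chord c) q p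
  drawn-sym (gap g) = gap λ r vr → λ { (inj₁ h) → g r vr (inj₂ h) ; (inj₂ h) → g r vr (inj₁ h) }
  drawn-sym (fwd c) = bwd c
  drawn-sym (bwd c) = fwd c

  draw-or : ∀ {u v} (e : Edge s t d ⌜ u ⌝ ⌜ v ⌝ ⊎ Edge s t d ⌜ v ⌝ ⌜ u ⌝) → Drawn Vertex (Chord (or-col e)) (place u) (place v)
  draw-or {u} {v} (inj₁ e) = draw (toℕ<n (proj₁ u)) (toℕ<n (proj₂ u)) (toℕ<n (proj₂ v)) e
  draw-or {u} {v} (inj₂ e) = drawn-sym (draw (toℕ<n (proj₁ v)) (toℕ<n (proj₂ v)) (toℕ<n (proj₂ u)) e)

  Between Outside : Pos → Pos → Pos → Set
  Between p q r = (p ≺ r × r ≺ q) ⊎ (q ≺ r × r ≺ p)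
  Outside p q r = (r ≺ p × r ≺ q) ⊎ (p ≺ r × q ≺ r)

  -- Chords point forwards, so among the possible configurations only `p ≺ r ≺ q ≺ w` survives
  -- `chord-≺`.
  chord-chord : ∀ {c p q r w} → Chord c p q → Chord c r w → Between p q r → Outside p q w → ⊥
  chord-chord C D (inj₂ (q≺r , r≺p)) _ = ≺-asym (chord-≺ C) (≺-trans q≺r r≺p)
  chord-chord C D (inj₁ (p≺r , r≺q)) (inj₁ (w≺p , _)) = ≺-asym (chord-≺ D) (≺-trans w≺p p≺r)
  chord-chord C D (inj₁ (p≺r , r≺q)) (inj₂ (_ , q≺w)) = uncrossed C D p≺r r≺q q≺w

  chord-chordᵒ : ∀ {c p q r w} → Chord c p q → Chord c w r → Between p q r → Outside p q w → ⊥
  chord-chordᵒ C D (inj₂ (q≺r , r≺p)) _ = ≺-asym (chord-≺ C) (≺-trans q≺r r≺p)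
  chord-chordᵒ C D (inj₁ (p≺r , r≺q)) (inj₁ (w≺p , _)) = uncrossed D C w≺p p≺r r≺q
  chord-chordᵒ C D (inj₁ (p≺r , r≺q)) (inj₂ (_ , q≺w)) = ≺-asym (chord-≺ D) (≺-trans r≺q q≺w)

  swapᵇ : ∀ {p q r} → Between p q r → Between q p r
  swapᵇ (inj₁ h) = inj₂ h
  swapᵇ (inj₂ h) = inj₁ h
  swapᵒ : ∀ {p q r} → Outside p q r → Outside q p r
  swapᵒ (inj₁ (a , b)) = inj₁ (b , a)
  swapᵒ (inj₂ (a , b)) = inj₂ (b , a)

  -- If r is between and w outside, then p and q are on different sides of {r , w}.
  drawn-drawn : ∀ {c p q r w} → Vertex p → Vertex q → Vertex r → Drawn Vertex (Chord c) p q → Drawn Vertex (Chord c) r w →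
                Between p q r → Outside p q w → ⊥
  drawn-drawn vp vq vr (gap g) _ btw _ = g _ vr btw
  drawn-drawn vp vq vr _ (gap g) (inj₁ (p≺r , r≺q)) (inj₁ (w≺p , _)) = g _ vp (inj₂ (w≺p , p≺r))
  drawn-drawn vp vq vr _ (gap g) (inj₁ (p≺r , r≺q)) (inj₂ (_ , q≺w)) = g _ vq (inj₁ (r≺q , q≺w))
  drawn-drawn vp vq vr _ (gap g) (inj₂ (q≺r , r≺p)) (inj₁ (_ , w≺q)) = g _ vq (inj₂ (w≺q , q≺r))
  drawn-drawn vp vq vr _ (gap g) (inj₂ (q≺r , r≺p)) (inj₂ (p≺w , _)) = g _ vp (inj₁ (r≺p , p≺w))
  drawn-drawn vp vq vr (fwd C) (fwd D) btw out = chord-chord C D btw out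
  drawn-drawn vp vq vr (fwd C) (bwd D) btw out = chord-chordᵒ C D btw out
  drawn-drawn vp vq vr (bwd C) (fwd D) btw out = chord-chord C D (swapᵇ btw) (swapᵒ out)
  drawn-drawn vp vq vr (bwd C) (bwd D) btw out = chord-chordᵒ C D (swapᵇ btw) (swapᵒ out)


  number : V s t → ℕ
  number u = enc width (place u)

  reflect : ∀ u v → number u < number v → place u ≺ place v
  reflect u v = enc-reflect width (place-bound u) (place-bound v)

  btw-reflect : ∀ u v w → Btw (BundleAdj s t d) (number u) (number v) (number w) → Between (place u) (place v) (place w)
  btw-reflect u v w (inj₁ (a , b)) = inj₁ (reflect u w a , reflect w v b)
  btw-reflect u v w (inj₂ (a , b)) = inj₂ (reflect v w a , reflect w u b)

  out-reflect : ∀ u v w → Out (BundleAdj s t d) (number u) (number v) (number w) → Outside (place u) (place v) (place w)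
  out-reflect u v w (inj₁ (a , b)) = inj₁ (reflect w u a , reflect w v b)
  out-reflect u v w (inj₂ (a , b)) = inj₂ (reflect u w a , reflect v w b)

  embedding : MatchingBookEmbedding (BundleAdj s t d) m
  embedding = record
    { pos = number
    ; pos-inj = λ {u} {v} eq →
        let r = P-inj (toℕ<n (proj₁ u)) (toℕ<n (proj₂ u)) (toℕ<n (proj₁ v)) (toℕ<n (proj₂ v))
                  (enc-injective width (place-bound u) (place-bound v) eq)
        in ⌜⌝-injective (cong₂ _,_ (proj₁ r) (proj₂ r))
    ; col = λ u v p → or-col (orient d<t p)
    ; col-sym = λ u v p q → or-col-sym (orient d<t p) (orient d<t q)
    ; proper = λ u v w p q v≢w eq → proper' u v w p q v≢w eq
    ; noCross = noCross'
    }
    where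
    proper' : ∀ u v w (p : BundleAdj s t d u v) (q : BundleAdj s t d u w) → v ≢ w → or-col (orient d<t p) ≢ or-col (orient d<t q)
    proper' u v w p q v≢w eq with At.port u (toℕ<n (proj₂ v)) (orient d<t p) | At.port u (toℕ<n (proj₂ w)) (orient d<t q)
    ... | π , tv , cp | ρ , tw , cq with π ≟ᵖ ρ
    ...   | inj₁ refl = v≢w (⌜⌝-injective (At.through-unique u (toℕ<n (proj₂ v)) (toℕ<n (proj₂ w)) tv tw))
    ...   | inj₂ π≢ρ = At.ports-differ u π ρ π≢ρ (trans (sym cp) (trans eq cq))
    noCross' : ∀ u v a b (p : BundleAdj s t d u v) (q : BundleAdj s t d a b) →
               Cross (BundleAdj s t d) (number u) (number v) (number a) (number b) → or-col (orient d<t p) ≢ or-col (orient d<t q)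
    noCross' u v a b p q (inj₁ (btw , out)) eq =
      drawn-drawn (place-vertex u) (place-vertex v) (place-vertex a) (subst (λ c → Drawn Vertex (Chord c) (place u) (place v)) eq (draw-or {u} {v} (orient d<t p)))
        (draw-or {a} {b} (orient d<t q)) (btw-reflect u v a btw) (out-reflect u v b out)
    noCross' u v a b p q (inj₂ (out , btw)) eq =
      drawn-drawn (place-vertex u) (place-vertex v) (place-vertex b) (subst (λ c → Drawn Vertex (Chord c) (place u) (place v)) eq (draw-or {u} {v} (orient d<t p)))
        (drawn-sym (draw-or {a} {b} (orient d<t q))) (btw-reflect u v b btw) (out-reflect u v a out)

-- Lower bounds by counting and by parity of ranks

module _ {A : Set} {P Q R : A → Set} (P? : Decidable P) (Q? : Decidable Q) (R? : Decidable R)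
         (split : ∀ x → P x → Q x ⊎ R x) (Q⇒P : ∀ x → Q x → P x) (R⇒P : ∀ x → R x → P x) (disj : ∀ x → Q x → ¬ R x) where

  length-filter-⊎ : ∀ xs → length (filter P? xs) ≡ length (filter Q? xs) + length (filter R? xs)
  length-filter-⊎ [] = refl
  length-filter-⊎ (x ∷ xs) with P? x | Q? x | R? x | length-filter-⊎ xs
  ... | yes p | yes q | yes r | _  = contradiction r (disj x q)
  ... | yes p | yes q | no ¬r | ih = cong suc ih
  ... | yes p | no ¬q | yes r | ih = trans (cong suc ih) (sym (+-suc _ _))
  ... | yes p | no ¬q | no ¬r | _  with split x p
  ...   | inj₁ q = contradiction q ¬q
  ...   | inj₂ r = contradiction r ¬r
  length-filter-⊎ (x ∷ xs) | no ¬p | yes q | _ | _ = contradiction (Q⇒P x q) ¬p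
  length-filter-⊎ (x ∷ xs) | no ¬p | no ¬q | yes r | _ = contradiction (R⇒P x r) ¬p
  length-filter-⊎ (x ∷ xs) | no ¬p | no ¬q | no ¬r | ih = ih

module _ {A : Set} (_≟_ : (x y : A) → Dec (x ≡ y)) where

  length-filter-≡ : ∀ {x xs} → x ∈ xs → Unique xs → length (filter (_≟ x) xs) ≡ 1
  length-filter-≡ {x} {xs = y ∷ ys} (here refl) (x∉ ∷ _) =
    trans (cong length (filter-accept (_≟ x) refl)) (cong suc (cong length (filter-none (_≟ x) (All.map ≢-sym x∉))))
  length-filter-≡ {x} {xs = y ∷ ys} (there x∈) (y∉ ∷ u) =
    trans (cong length (filter-reject (_≟ x) (All.lookup y∉ x∈))) (length-filter-≡ x∈ u)

module _ {A : Set} (f : A → A) (f-inv : ∀ x → f (f x) ≡ x) (f-free : ∀ x → f x ≢ x) where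

  -- Removing `x` together with `f x` shortens the list by two. The bound `n` drives the recursion,
  -- since the remaining list is not a structural part of the given one.
  even-length : ∀ n xs → length xs ≤ n → Unique xs → (∀ {x} → x ∈ xs → f x ∈ xs) → even (length xs) ≡ true
  even-length _ [] _ _ _ = refl
  even-length (suc n) (x ∷ xs) (s≤s len≤) (x∉ ∷ u) closed with closed (here refl)
  ... | here fx≡x = contradiction fx≡x (f-free x)
  ... | there fx∈ with ∈-∃++ fx∈
  ...   | as , bs , refl = trans (cong (not ∘ even) (↭-length σ)) (trans (not-involutive _) ih)
    where
    σ : xs ↭ f x ∷ (as ++ bs)
    σ = shift (f x) as bs
    rest-unique : Unique (f x ∷ (as ++ bs))
    rest-unique = ↭ₛ.Unique-resp-↭ (setoid A) (↭⇒↭ₛ σ) u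
    rest-closed : ∀ {y} → y ∈ as ++ bs → f y ∈ as ++ bs
    rest-closed {y} y∈ with closed (there (∈-resp-↭ (↭-sym σ) (there y∈)))
    -- If `f y` were `x`, then `y` would be `f x`, which occurs only once and has just been taken
    -- out.
    ... | here fy≡x = contradiction (trans (sym (cong f fy≡x)) (f-inv y)) (All.lookup (heads rest-unique) y∈)
      where
      heads : Unique (f x ∷ (as ++ bs)) → All (f x ≢_) (as ++ bs)
      heads (p ∷ _) = p
    ... | there fy∈ with ∈-resp-↭ σ fy∈
    ...   | there h = h
    ...   | here fy≡fx = contradiction (subst (_∈ xs) (trans (sym (f-inv y)) (trans (cong f fy≡fx) (f-inv x))) (∈-resp-↭ (↭-sym σ) (there y∈))) (λ x∈ → All.lookup x∉ x∈ refl)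
    ih : even (length (as ++ bs)) ≡ true
    ih with rest-unique
    ... | _ ∷ u' = even-length n (as ++ bs) (≤-trans (n≤1+n _) (subst (_≤ n) (↭-length σ) len≤)) u' rest-closed

module Regular {V : Set} (Adj : V → V → Set) (adj-sym : ∀ {u v} → Adj u v → Adj v u) (adj-irrefl : ∀ {u} → ¬ Adj u u)
               (nb : V → Fin 4 → V) (nb-adj : ∀ u π → Adj u (nb u π)) (nb-inj : ∀ u {π ρ} → nb u π ≡ nb u ρ → π ≡ ρ) where

  module _ {k : ℕ} (M : MatchingBookEmbedding Adj k) where
    open MatchingBookEmbedding M

    port-colour : V → Fin 4 → Fin k
    port-colour u π = col u (nb u π) (nb-adj u π)

    port-colour-injective : ∀ u {π ρ} → port-colour u π ≡ port-colour u ρ → π ≡ ρ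
    port-colour-injective u {π} {ρ} eq with π Fin.≟ ρ
    ... | yes e = e
    ... | no π≢ρ = contradiction eq (proper u (nb u π) (nb u ρ) (nb-adj u π) (nb-adj u ρ) (π≢ρ ∘ nb-inj u))

    four≤pages : V → 4 ≤ k
    four≤pages u = injective⇒≤ (port-colour-injective u)

  -- With four pages every page is a perfect matching.  It pairs up the vertices strictly between the ends of one
  -- of its edges, so the ends have ranks of different parity in the circular order.
  module Four (_≟ⱽ_ : (u v : V) → Dec (u ≡ v)) (vs : List V) (complete : ∀ v → v ∈ vs) (unique : Unique vs)
              (M : MatchingBookEmbedding Adj 4) where
    open MatchingBookEmbedding M

    -- A colour missing at `u` would, together with the four colours present, give an injection from
    -- five elements into four.
    port-of : ∀ u c → ∃ λ π → port-colour M u π ≡ c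
    port-of u c with Fin.any? (λ π → port-colour M u π Fin.≟ c)
    ... | yes p = p
    ... | no ¬p = contradiction (injective⇒≤ {f = extended} extended-injective) (n≮n 4)
      where
      extended : Fin 5 → Fin 4
      extended Fin.zero    = c
      extended (Fin.suc π) = port-colour M u π
      extended-injective : ∀ {i j} → extended i ≡ extended j → i ≡ j
      extended-injective {Fin.zero}  {Fin.zero}  _  = refl
      extended-injective {Fin.zero}  {Fin.suc j} eq = contradiction (j , sym eq) ¬p
      extended-injective {Fin.suc i} {Fin.zero}  eq = contradiction (i , eq) ¬p
      extended-injective {Fin.suc i} {Fin.suc j} eq = cong Fin.suc (port-colour-injective M u eq)

    module Page (c : Fin 4) where
      mate : V → V
      mate u = nb u (proj₁ (port-of u c))

      mate-adj : ∀ u → Adj u (mate u)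
      mate-adj u = nb-adj u _

      mate-col : ∀ u (p : Adj u (mate u)) → col u (mate u) p ≡ c
      mate-col u p = trans (col-sym u (mate u) p (adj-sym p))
        (trans (sym (col-sym u (mate u) (mate-adj u) (adj-sym p))) (proj₂ (port-of u c)))

      mate-unique : ∀ {u v} (p : Adj u v) → col u v p ≡ c → mate u ≡ v
      mate-unique {u} {v} p eq with mate u ≟ⱽ v
      ... | yes e = e
      ... | no ne = contradiction (trans (mate-col u (mate-adj u)) (sym eq)) (proper u (mate u) v (mate-adj u) p ne)

      mate-involutive : ∀ u → mate (mate u) ≡ u
      mate-involutive u = mate-unique (adj-sym (mate-adj u))
        (trans (sym (col-sym u (mate u) (mate-adj u) (adj-sym (mate-adj u)))) (mate-col u (mate-adj u)))

      mate-free : ∀ u → mate u ≢ u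
      mate-free u eq = adj-irrefl (subst (Adj u) eq (mate-adj u))

    Below : V → V → Set
    Below u w = pos w < pos u

    Inside : V → V → V → Set
    Inside u v w = pos u < pos w × pos w < pos v

    below? : ∀ u → Decidable (Below u)
    below? u w = pos w <? pos u

    inside? : ∀ u v → Decidable (Inside u v)
    inside? u v w = (pos u <? pos w) ×-dec (pos w <? pos v)

    rank : V → ℕ
    rank u = length (filter (below? u) vs)

    -- Below `v` lie the vertices below `u`, then `u` itself, which is the summand 1, then those
    -- strictly between.
    rank-suc : ∀ u v → pos u < pos v → rank v ≡ rank u + (1 + length (filter (inside? u v) vs))
    rank-suc u v lt = trans
      (length-filter-⊎ (below? v) (below? u) (λ w → (pos u ≤? pos w) ×-dec (pos w <? pos v))
        (λ w wv → case₁ w wv) (λ w wu → <-trans wu lt) (λ w → proj₂) (λ w wu uw → <⇒≱ wu (proj₁ uw)) vs)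
      (cong (rank u +_) (trans
        (length-filter-⊎ (λ w → (pos u ≤? pos w) ×-dec (pos w <? pos v)) (_≟ⱽ u) (inside? u v)
          case₂ (λ { w refl → ≤-refl , lt }) (λ w (a , b) → <⇒≤ a , b) (λ { w refl (a , b) → n≮n _ a }) vs)
        (cong (_+ length (filter (inside? u v) vs)) (length-filter-≡ _≟ⱽ_ (complete u) unique))))
      where
      case₁ : ∀ w → pos w < pos v → pos w < pos u ⊎ (pos u ≤ pos w × pos w < pos v)
      case₁ w wv with pos w <? pos u
      ... | yes wu = inj₁ wu
      ... | no ¬wu = inj₂ (≮⇒≥ ¬wu , wv)
      case₂ : ∀ w → pos u ≤ pos w × pos w < pos v → w ≡ u ⊎ (pos u < pos w × pos w < pos v)
      case₂ w (uw , wv) with m≤n⇒m<n∨m≡n uw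
      ... | inj₁ lt = inj₂ (lt , wv)
      ... | inj₂ eq = inj₁ (sym (pos-inj eq))

    -- The page of the edge restricts to a fixed-point-free involution of the vertices inside: a
    -- mate beyond the ends would cross the edge on its own page, and a mate at an end would give
    -- that end two partners.
    even-between : ∀ u v (p : Adj u v) → pos u < pos v → even (length (filter (inside? u v) vs)) ≡ true
    even-between u v p lt = even-length mate mate-involutive mate-free _ (filter (inside? u v) vs) ≤-refl
        (filter⁺ (inside? u v) unique) closed
      where
      open Page (col u v p)
      mu : mate u ≡ v
      mu = mate-unique p refl
      closed : ∀ {w} → w ∈ filter (inside? u v) vs → mate w ∈ filter (inside? u v) vs
      closed {w} w∈ with ∈-filter⁻ (inside? u v) {xs = vs} w∈
      ... | _ , uw , wv with <-cmp (pos u) (pos (mate w)) | <-cmp (pos (mate w)) (pos v)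
      ...   | tri< a _ _ | tri< b _ _ = ∈-filter⁺ (inside? u v) (complete (mate w)) (a , b)
      ...   | tri≈ _ e _ | _ = contradiction (trans (sym mu) (trans (cong mate (pos-inj e)) (mate-involutive w))) (λ v≡w → n≮n (pos w) (subst (λ z → pos w < pos z) v≡w wv))
      ...   | tri> _ _ a | _ = contradiction (sym (mate-col w (mate-adj w))) (noCross u v w (mate w) p (mate-adj w) (inj₁ (inj₁ (uw , wv) , inj₁ (a , <-trans a lt))))
      ...   | tri< _ _ _ | tri≈ _ e _ = contradiction (trans (sym (mate-involutive w)) (cong mate (trans (pos-inj e) (sym mu)))) (λ w≡ → n≮n (pos w) (subst (λ z → pos z < pos w) (trans (sym (mate-involutive u)) (sym w≡)) uw))
      ...   | tri< _ _ _ | tri> _ _ b = contradiction (sym (mate-col w (mate-adj w))) (noCross u v w (mate w) p (mate-adj w) (inj₁ (inj₁ (uw , wv) , inj₂ (<-trans lt b , b))))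

    rank-parity : ∀ u v → Adj u v → pos u < pos v → even (rank u) ≢ even (rank v)
    rank-parity u v p lt eq = not-¬ {x = even (rank u)} refl
      (trans eq (trans (cong even (rank-suc u v lt)) (trans (even-+ (rank u) _) step)))
      where
      step : not (even (rank u) xor not (even (length (filter (inside? u v) vs)))) ≡ not (even (rank u))
      step rewrite even-between u v p lt with even (rank u)
      ... | true  = refl
      ... | false = refl

    bipartite : Bipartite Adj
    bipartite = even ∘ rank , proper-rank
      where
      proper-rank : ∀ u v → Adj u v → even (rank u) ≢ even (rank v)
      proper-rank u v p with <-cmp (pos u) (pos v)
      ... | tri< lt _ _ = rank-parity u v p lt
      ... | tri> _ _ gt = ≢-sym (rank-parity v u (adj-sym p) gt)
      ... | tri≈ _ e _ = contradiction (subst (Adj u) (sym (pos-inj e)) p) adj-irrefl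

-- The bundle as a four-regular graph and the parities forced by a bipartition

adj-sym : ∀ {s t d u v} → BundleAdj s t d u v → BundleAdj s t d v u
adj-sym (fiber i j j' e) = fiberᵒ i j j' e
adj-sym (fiberᵒ i j j' e) = fiber i j j' e
adj-sym (base i i' j e) = baseᵒ i i' j e
adj-sym (baseᵒ i i' j e) = base i i' j e
adj-sym (twist i i' j j' e e' f) = twistᵒ i i' j j' e e' f
adj-sym (twistᵒ i i' j j' e e' f) = twist i i' j j' e e' f

y-adj : ∀ {s t d} (i : Fin s) {j j' : Fin t} → YStep t (toℕ j) (toℕ j') → BundleAdj s t d (i , j) (i , j')
y-adj {t = suc t} i {j} {j'} p = fiber i j j' (lemma p)
  where
  lemma : ∀ {k l} → YStep (suc t) k l → l ≡ (k + 1) % suc t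
  lemma {k} (next lt) = sym (trans (cong (_% suc t) (+-comm k 1)) (m<n⇒m%n≡m lt))
  lemma {k} (last e)  = sym (trans (cong (_% suc t) (trans (+-comm k 1) e)) (n%n≡0 (suc t)))

x-adj : ∀ {s t d} {i i' : Fin s} {j j' : Fin t} → XStep s t d (toℕ i) (toℕ j) (toℕ i') (toℕ j') →
        BundleAdj s t d (i , j) (i' , j')
x-adj {t = suc t} {d} {i} {i'} {j} {j'} p = lemma (toℕ<n j') p refl refl
  where
  lemma : ∀ {i₁ j₁} → j₁ < suc t → XStep _ (suc t) d (toℕ i) (toℕ j) i₁ j₁ → toℕ i' ≡ i₁ → toℕ j' ≡ j₁ → BundleAdj _ (suc t) d (i , j) (i' , j')
  lemma _ (up lt) e f = subst (λ k → BundleAdj _ _ d (i , j) (i' , k)) (sym (toℕ-injective f)) (base i i' j e)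
  lemma _ (low q lt) e f = twist i i' j j' (cong (_∸ 1) q) e (trans f (sym (m<n⇒m%n≡m lt)))
  lemma {j₁ = j₁} lt (high q g) e f = twist i i' j j' (cong (_∸ 1) q) e
    (trans f (sym (trans (cong (_% suc t) (sym g)) (trans ([m+n]%n≡m%n j₁ (suc t)) (m<n⇒m%n≡m lt)))))

edge-adj : ∀ {s t d u v} → Edge s t d ⌜ u ⌝ ⌜ v ⌝ → BundleAdj s t d u v
edge-adj {u = u} {v} e = lemma e refl refl
  where
  lemma : ∀ {a b} → Edge _ _ _ a b → ⌜ u ⌝ ≡ a → ⌜ v ⌝ ≡ b → BundleAdj _ _ _ u v
  lemma (x-edge p) refl refl = x-adj p
  lemma (y-edge p) refl e' = subst (λ k → BundleAdj _ _ _ u (k , proj₂ v)) (toℕ-injective (sym (cong proj₁ e')))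
    (y-adj (proj₁ u) (subst (YStep _ _) (sym (cong proj₂ e')) p))

y-succ : ∀ {t} j → j < t → ∃ λ e → e < t × YStep t j e
y-succ {t} j lt with suc j <? t
... | yes lt' = suc j , lt' , next lt'
... | no ¬lt' = 0 , ≤-<-trans z≤n lt , last (≤-antisym lt (≮⇒≥ ¬lt'))

x-succ : ∀ {s t d} i j → d < t → i < s → j < t → ∃₂ λ a b → a < s × b < t × XStep s t d i j a b
x-succ {s} {t} {d} i j d<t i<s j<t with suc i <? s
... | yes lt = suc i , j , lt , j<t , up lt
... | no ¬lt with ≤-antisym i<s (≮⇒≥ ¬lt)
...   | si with j + d <? t
...     | yes lt' = 0 , j + d , ≤-<-trans z≤n i<s , lt' , low si lt'
...     | no ¬lt' = 0 , j + d ∸ t , ≤-<-trans z≤n i<s ,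
          +-cancelʳ-< t _ _ (subst (_< t + t) (sym (m∸n+n≡m (≮⇒≥ ¬lt'))) (+-mono-< j<t d<t)) , high si (m∸n+n≡m (≮⇒≥ ¬lt'))

module Bundle {s t d : ℕ} (3≤s : 3 ≤ s) (3≤t : 3 ≤ t) (d<t : d < t) where

  adj-irrefl : ∀ {u} → ¬ BundleAdj s t d u u
  adj-irrefl p with orient d<t p
  ... | inj₁ e = edge-asym 3≤s 3≤t e e
  ... | inj₂ e = edge-asym 3≤s 3≤t e e

  -- Irrelevant bounds make vertices, and later their sides in a bipartition, independent of the
  -- proofs supplied.
  vertex : ∀ {i j} → .(i < s) → .(j < t) → V s t
  vertex p q = fromℕ< p , fromℕ< q

  ⌜vertex⌝ : ∀ {i j} (p : i < s) (q : j < t) → ⌜ vertex p q ⌝ ≡ (i , j)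
  ⌜vertex⌝ p q = cong₂ _,_ (toℕ-fromℕ< p) (toℕ-fromℕ< q)

  -- The Boolean selects the base or the fibre direction, so that successors and predecessors need
  -- one argument each instead of one for every pair of neighbours.
  Out-edge : (u v : V s t) → Bool → Set
  Out-edge u v true  = XStep s t d (toℕ (proj₁ u)) (toℕ (proj₂ u)) (toℕ (proj₁ v)) (toℕ (proj₂ v))
  Out-edge u v false = proj₁ u ≡ proj₁ v × YStep t (toℕ (proj₂ u)) (toℕ (proj₂ v))

  out-adj : ∀ {u v} b → Out-edge u v b → BundleAdj s t d u v
  out-adj true p = x-adj p
  out-adj false (refl , p) = y-adj _ p

  out-edge : ∀ {u v} b → Out-edge u v b → Edge s t d ⌜ u ⌝ ⌜ v ⌝
  out-edge true p = x-edge p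
  out-edge false (refl , p) = y-edge p

  out-kind : ∀ {u v} b c → Out-edge u v b → Out-edge u v c ⊎ Out-edge v u c → b ≡ c
  out-kind true true _ _ = refl
  out-kind false false _ _ = refl
  out-kind true false p (inj₁ (refl , _)) = ⊥-elim (x-row-changes 3≤s p)
  out-kind true false p (inj₂ (refl , _)) = ⊥-elim (x-row-changes 3≤s p)
  out-kind false true (refl , _) (inj₁ p) = ⊥-elim (x-row-changes 3≤s p)
  out-kind false true (refl , _) (inj₂ p) = ⊥-elim (x-row-changes 3≤s p)

  post : ∀ u b → ∃ λ v → Out-edge u v b
  post (i , j) true with x-succ {s} {t} {d} (toℕ i) (toℕ j) d<t (toℕ<n i) (toℕ<n j)
  ... | a , b , a<s , b<t , p = vertex a<s b<t , subst₂ (XStep s t d (toℕ i) (toℕ j)) (sym (toℕ-fromℕ< a<s)) (sym (toℕ-fromℕ< b<t)) p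
  post (i , j) false with y-succ (toℕ j) (toℕ<n j)
  ... | b , b<t , p = (i , fromℕ< b<t) , refl , subst (YStep t (toℕ j)) (sym (toℕ-fromℕ< b<t)) p

  pre : ∀ u b → ∃ λ v → Out-edge v u b
  pre (i , j) true with x-pred {s} {t} {d} (toℕ i) (toℕ j) d<t (toℕ<n i) (toℕ<n j)
  ... | a , b , a<s , b<t , p = vertex a<s b<t , subst₂ (λ a b → XStep s t d a b (toℕ i) (toℕ j)) (sym (toℕ-fromℕ< a<s)) (sym (toℕ-fromℕ< b<t)) p
  pre (i , j) false with y-pred (toℕ j) (toℕ<n j)
  ... | b , b<t , p = (i , fromℕ< b<t) , refl , subst (λ b → YStep t b (toℕ j)) (sym (toℕ-fromℕ< b<t)) p

  nb : V s t → Fin 4 → V s t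
  nb u 0F = proj₁ (post u true)
  nb u 1F = proj₁ (post u false)
  nb u 2F = proj₁ (pre u true)
  nb u 3F = proj₁ (pre u false)

  nb-adj : ∀ u π → BundleAdj s t d u (nb u π)
  nb-adj u 0F = out-adj true (proj₂ (post u true))
  nb-adj u 1F = out-adj false (proj₂ (post u false))
  nb-adj u 2F = adj-sym (out-adj true (proj₂ (pre u true)))
  nb-adj u 3F = adj-sym (out-adj false (proj₂ (pre u false)))

  out≢in : ∀ u b c → proj₁ (post u b) ≢ proj₁ (pre u c)
  out≢in u b c eq = edge-asym 3≤s 3≤t (out-edge b (proj₂ (post u b)))
    (out-edge c (subst (λ v → Out-edge v u c) (sym eq) (proj₂ (pre u c))))

  post-inj : ∀ u b c → proj₁ (post u b) ≡ proj₁ (post u c) → b ≡ c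
  post-inj u b c eq = out-kind b c (proj₂ (post u b)) (inj₁ (subst (λ v → Out-edge u v c) (sym eq) (proj₂ (post u c))))

  pre-inj : ∀ u b c → proj₁ (pre u b) ≡ proj₁ (pre u c) → b ≡ c
  pre-inj u b c eq = out-kind b c (proj₂ (pre u b)) (inj₁ (subst (λ v → Out-edge v u c) (sym eq) (proj₂ (pre u c))))

  nb-inj : ∀ u {π ρ} → nb u π ≡ nb u ρ → π ≡ ρ
  nb-inj u {0F} {0F} _ = refl
  nb-inj u {0F} {1F} e with () ← post-inj u true false e
  nb-inj u {0F} {2F} e = ⊥-elim (out≢in u true true e)
  nb-inj u {0F} {3F} e = ⊥-elim (out≢in u true false e)
  nb-inj u {1F} {0F} e with () ← post-inj u false true e
  nb-inj u {1F} {1F} _ = refl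
  nb-inj u {1F} {2F} e = ⊥-elim (out≢in u false true e)
  nb-inj u {1F} {3F} e = ⊥-elim (out≢in u false false e)
  nb-inj u {2F} {0F} e = ⊥-elim (out≢in u true true (sym e))
  nb-inj u {2F} {1F} e = ⊥-elim (out≢in u false true (sym e))
  nb-inj u {2F} {2F} _ = refl
  nb-inj u {2F} {3F} e with () ← pre-inj u true false e
  nb-inj u {3F} {0F} e = ⊥-elim (out≢in u true false (sym e))
  nb-inj u {3F} {1F} e = ⊥-elim (out≢in u false false (sym e))
  nb-inj u {3F} {2F} e with () ← pre-inj u false true e
  nb-inj u {3F} {3F} _ = refl

  open Regular (BundleAdj s t d) adj-sym adj-irrefl nb nb-adj nb-inj

  origin : V s t
  origin = vertex {0} {0} (≤-trans (s≤s z≤n) 3≤s) (≤-trans (s≤s z≤n) 3≤t)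

  pages≥4 : ∀ k → MatchingBookEmbedding (BundleAdj s t d) k → 4 ≤ k
  pages≥4 k M = four≤pages M origin

  four-pages⇒bipartite : MatchingBookEmbedding (BundleAdj s t d) 4 → Bipartite (BundleAdj s t d)
  four-pages⇒bipartite = Four.bipartite (≡-dec Fin._≟_ Fin._≟_) (cartesianProduct (allFin s) (allFin t))
    (λ (i , j) → ∈-cartesianProduct⁺ (∈-allFin i) (∈-allFin j)) (cartesianProduct⁺ (allFin⁺ s) (allFin⁺ t))

  pages≥5 : ¬ Bipartite (BundleAdj s t d) → ∀ k → MatchingBookEmbedding (BundleAdj s t d) k → 5 ≤ k
  pages≥5 ¬bip k M with m≤n⇒m<n∨m≡n (pages≥4 k M)
  ... | inj₁ lt = lt
  ... | inj₂ refl = ⊥-elim (¬bip (four-pages⇒bipartite M))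

  module _ (bip : Bipartite (BundleAdj s t d)) where
    side : ∀ {i j} → .(i < s) → .(j < t) → Bool
    side p q = proj₁ bip (vertex p q)

    side-edge : ∀ {i j i' j'} (p : i < s) (q : j < t) (p' : i' < s) (q' : j' < t) → Edge s t d (i , j) (i' , j') →
                side p' q' ≡ not (side p q)
    side-edge p q p' q' e = ¬-not (≢-sym (proj₂ bip (vertex p q) (vertex p' q')
      (edge-adj (subst₂ (Edge s t d) (sym (⌜vertex⌝ p q)) (sym (⌜vertex⌝ p' q')) e))))

    not-xor : ∀ a b c → a ≡ not b xor c → not a ≡ not (not b) xor c
    not-xor a true  c refl = refl
    not-xor a false c refl = not-involutive c

    s>0 = ≤-trans (s≤s z≤n) 3≤s
    t>0 = ≤-trans (s≤s z≤n) 3≤t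

    side-fibre : ∀ j (q : j < t) → side s>0 q ≡ not (even j) xor side s>0 t>0
    side-fibre zero    q = refl
    side-fibre (suc j) q = trans (side-edge s>0 q' s>0 q (y-edge (next q))) (not-xor _ (even j) _ (side-fibre j q'))
      where q' = <-trans (n<1+n j) q

    side-base : ∀ i (p : i < s) → side p t>0 ≡ not (even i) xor side s>0 t>0
    side-base zero    p = refl
    side-base (suc i) p = trans (side-edge p' t>0 p t>0 (x-edge (up p))) (not-xor _ (even i) _ (side-base i p'))
      where p' = <-trans (n<1+n i) p

    -- Walking once around a fibre changes sides `t` times and returns to the start.
    t-even : even t ≡ true
    t-even with y-pred 0 t>0
    ... | e , e<t , p@(last eq) = trans (cong even (sym eq))
      (lemma (even e) _ (trans (side-edge s>0 e<t s>0 t>0 (y-edge p)) (cong not (side-fibre e e<t))))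
      where
      lemma : ∀ a b → b ≡ not (not a xor b) → not a ≡ true
      lemma false _ _ = refl
      lemma true true ()
      lemma true false ()

    -- Two walks lead from column 0 to column `d` of row 0: `d` steps along the fibre, or `s` steps
    -- along the base, the last of them twisted.
    s-d-parity : even s ≡ even d
    s-d-parity = lemma (s ∸ 1) (m+[n∸m]≡n s>0)
      where
      clash : ∀ a b c → not a xor c ≡ not (not b xor c) → not b ≡ a
      clash true  true  true ()
      clash true  true  false ()
      clash true  false _ _ = refl
      clash false true  _ _ = refl
      clash false false true ()
      clash false false false ()
      lemma : ∀ r → suc r ≡ s → even s ≡ even d
      lemma r eq = trans (cong even (sym eq)) (clash (even d) (even r) _ (trans (sym (side-fibre d d<t))
        (trans (side-edge r<s t>0 s>0 d<t (x-edge (low eq d<t))) (cong not (side-base r r<s)))))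
        where r<s = subst (r <_) eq (n<1+n r)

-- Changing the twist: reduction modulo t and reflection

pullback : ∀ {V W : Set} {A : V → V → Set} {B : W → W → Set} {m} (f : V → W) → (∀ {u v} → f u ≡ f v → u ≡ v) →
           (∀ {u v} → A u v → B (f u) (f v)) → MatchingBookEmbedding B m → MatchingBookEmbedding A m
pullback f f-inj f-hom M = record
  { pos     = pos ∘ f
  ; pos-inj = f-inj ∘ pos-inj
  ; col     = λ u v p → col (f u) (f v) (f-hom p)
  ; col-sym = λ u v p q → col-sym (f u) (f v) (f-hom p) (f-hom q)
  ; proper  = λ u v w p q v≢w → proper (f u) (f v) (f w) (f-hom p) (f-hom q) (v≢w ∘ f-inj)
  ; noCross = λ u v x y p q → noCross (f u) (f v) (f x) (f y) (f-hom p) (f-hom q)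
  }
  where open MatchingBookEmbedding M

retwist : ∀ {s t d d'} → (∀ j → (j + d) %' t ≡ (j + d') %' t) → ∀ {u v} → BundleAdj s t d u v → BundleAdj s t d' u v
retwist e (fiber i j j' p) = fiber i j j' p
retwist e (fiberᵒ i j j' p) = fiberᵒ i j j' p
retwist e (base i i' j p) = base i i' j p
retwist e (baseᵒ i i' j p) = baseᵒ i i' j p
retwist e (twist i i' j j' p q r) = twist i i' j j' p q (trans r (e (toℕ j)))
retwist e (twistᵒ i i' j j' p q r) = twistᵒ i i' j j' p q (trans r (e (toℕ j)))

%-reduce : ∀ t d j → (j + d) %' suc t ≡ (j + d % suc t) %' suc t
%-reduce t d j = trans (%-distribˡ-+ j d (suc t)) (trans (cong (λ k → (j % suc t + k) % suc t) (sym (m%n%n≡m%n d (suc t)))) (sym (%-distribˡ-+ j (d % suc t) (suc t))))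

-- Reversing every fibre turns the shift by `d` into the shift by `t - d`. For odd `t` this
-- exchanges even and odd twists, so the odd ladder has to be coloured only for odd `d` and for
-- `d ≡ 0`.
module Reflect {s t d : ℕ} (d≤t : d ≤ t) where
  mirror : V s t → V s t
  mirror (i , j) = i , Fin.opposite j

  mirror-injective : ∀ {u v} → mirror u ≡ mirror v → u ≡ v
  mirror-injective {_ , j} {_ , j'} eq = cong₂ _,_ (cong proj₁ eq)
    (trans (sym (Fin.opposite-involutive j)) (trans (cong Fin.opposite (cong proj₂ eq)) (Fin.opposite-involutive j')))

  opposite-sum : ∀ (j : Fin t) → toℕ j + suc (toℕ (Fin.opposite j)) ≡ t
  opposite-sum j = trans (+-suc (toℕ j) _) (trans (cong (suc ∘ (toℕ j +_)) (Fin.opposite-prop j))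
    (m+[n∸m]≡n (toℕ<n j)))

  Mirror : ℕ → ℕ → Set
  Mirror j k = j + suc k ≡ t

  y-mirror : ∀ {j j' k k'} → Mirror j k → Mirror j' k' → k < t → YStep t j j' → YStep t k' k
  y-mirror {j} {_} {k} {k'} m m' k<t (next lt) = subst (YStep t k') e (next (subst (_< t) (sym e) k<t))
    where
    e : suc k' ≡ k
    e = suc-injective (+-cancelˡ-≡ j _ _ (trans (+-suc j (suc k')) (trans m' (sym m))))
  y-mirror {j} {_} {k} {k'} m m' _ (last e) = subst (YStep t k') (sym k≡0) (last m')
    where
    k≡0 : k ≡ 0
    k≡0 = +-cancelˡ-≡ (suc j) _ _ (trans (sym (+-suc j k)) (trans m (trans (sym e) (sym (+-identityʳ (suc j))))))

  x-mirror : ∀ {i i' j j' k k'} → Mirror j k → Mirror j' k' → k' < t → XStep s t d i j i' j' → XStep s t (t ∸ d) i k i' k'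
  x-mirror {j = j} {k = k} {k'} m m' _ (up lt) = subst (XStep _ _ _ _ k _) (suc-injective (+-cancelˡ-≡ j _ _ (trans m (sym m')))) (up lt)
  -- A shift that stays inside the fibre becomes one that wraps, and conversely. The common summand
  -- `j + d + 1` completes the truncated difference `t ∸ d` to `t`.
  x-mirror {j = j} {k = k} {k'} m m' _ (low e lt) = high e (+-cancelʳ-≡ (j + d + 1) _ _ eq)
    where
    open ≡-Reasoning
    eq : k' + t + (j + d + 1) ≡ k + (t ∸ d) + (j + d + 1)
    eq = begin
      k' + t + (j + d + 1)             ≡⟨ solve (k' ∷ t ∷ j ∷ d ∷ []) ⟩
      (j + d + suc k') + t             ≡⟨ cong (_+ t) m' ⟩
      t + t                            ≡⟨ cong₂ _+_ (sym m) (sym (m∸n+n≡m d≤t)) ⟩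
      (j + suc k) + ((t ∸ d) + d)      ≡⟨ rearrange j k (t ∸ d) d ⟩
      k + (t ∸ d) + (j + d + 1)        ∎
      where
      rearrange : ∀ j k a d → (j + suc k) + (a + d) ≡ k + a + (j + d + 1)
      rearrange = solve-∀
  x-mirror {j = j} {j'} {k} {k'} m m' k'<t (high e eq) = subst (XStep _ _ _ _ k 0) k+ (low e (subst (_< t) (sym k+) k'<t))
    where
    open ≡-Reasoning
    k+ : k + (t ∸ d) ≡ k'
    k+ = +-cancelʳ-≡ (j + d + 1) _ _ (begin
      k + (t ∸ d) + (j + d + 1)        ≡⟨ rearrange j k (t ∸ d) d ⟩
      (j + suc k) + ((t ∸ d) + d)      ≡⟨ cong₂ _+_ m (m∸n+n≡m d≤t) ⟩
      t + t                            ≡⟨ cong (_+ t) (sym m') ⟩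
      (j' + suc k') + t                ≡⟨ swap j' k' t ⟩
      k' + ((j' + t) + 1)              ≡⟨ cong (λ z → k' + (z + 1)) eq ⟩
      k' + (j + d + 1)                 ∎)
      where
      rearrange : ∀ j k a d → k + a + (j + d + 1) ≡ (j + suc k) + (a + d)
      rearrange = solve-∀
      swap : ∀ a b c → (a + suc b) + c ≡ b + ((a + c) + 1)
      swap = solve-∀

  edge-mirror : ∀ {u v} → d < t → Edge s t d ⌜ u ⌝ ⌜ v ⌝ → BundleAdj s t (t ∸ d) (mirror u) (mirror v)
  edge-mirror {u} {v} d<t e = go e refl refl
    where
    go : ∀ {a b} → Edge s t d a b → ⌜ u ⌝ ≡ a → ⌜ v ⌝ ≡ b → BundleAdj s t (t ∸ d) (mirror u) (mirror v)
    go (x-edge p) refl refl = x-adj (x-mirror (opposite-sum (proj₂ u)) (opposite-sum (proj₂ v)) (toℕ<n _) p)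
    go (y-edge p) refl e' = subst (λ k → BundleAdj _ _ _ (mirror u) (k , Fin.opposite (proj₂ v))) (toℕ-injective (sym (cong proj₁ e')))
      (adj-sym (y-adj (proj₁ u) (y-mirror (opposite-sum (proj₂ u)) (opposite-sum (proj₂ v)) (toℕ<n _) (subst (YStep t _) (sym (cong proj₂ e')) p))))

  mirror-hom : ∀ {u v} → d < t → BundleAdj s t d u v → BundleAdj s t (t ∸ d) (mirror u) (mirror v)
  mirror-hom d<t p with orient d<t p
  ... | inj₁ e = edge-mirror d<t e
  ... | inj₂ e = adj-sym (edge-mirror d<t e)

-- Boolean comparisons, neighbouring positions and alternating rows

<ᵇ-true : ∀ {m n} → m < n → (m <ᵇ n) ≡ true
<ᵇ-true lt = Equivalence.to T-≡ (<⇒<ᵇ lt)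

<ᵇ-false : ∀ {m n} → n ≤ m → (m <ᵇ n) ≡ false
<ᵇ-false {m} {n} le with m <ᵇ n in eq
... | false = refl
... | true = contradiction (<ᵇ⇒< m n (subst T (sym eq) _)) (≤⇒≯ le)

true≢false : true ≢ false
true≢false ()

not-injective : ∀ {a b} → not a ≡ not b → a ≡ b
not-injective {true}  {true}  _ = refl
not-injective {false} {false} _ = refl

-- This is the arithmetic of nesting: if the offsets of the two ends have a fixed sum, one end moves
-- down when the other moves up.
sum-clash : ∀ {a b c e n} → a < c → b < e → a + b ≡ n → c + e ≡ n → ⊥
sum-clash p q eq eq' = <⇒≢ (+-mono-< p q) (trans eq (sym eq'))

adjacent-gap : ∀ {b x r} → ¬ (((b , x) ≺ r × r ≺ (b , suc x)) ⊎ ((b , suc x) ≺ r × r ≺ (b , x)))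
adjacent-gap (inj₁ (blk p , blk q)) = n≮n _ (<-trans p q)
adjacent-gap (inj₁ (blk p , off _)) = n≮n _ p
adjacent-gap (inj₁ (off _ , blk q)) = n≮n _ q
adjacent-gap (inj₁ (off p , off q)) = <⇒≱ p (s≤s⁻¹ q)
adjacent-gap (inj₂ (p , q)) = ≺-asym (off (n<1+n _)) (≺-trans p q)

adjacent : ∀ {Vx Ch b x} → Drawn Vx Ch (b , x) (b , suc x)
adjacent = gap λ _ _ → adjacent-gap

adjacentᵒ : ∀ {Vx Ch b x} → Drawn Vx Ch (b , suc x) (b , x)
adjacentᵒ = gap λ _ _ → λ { (inj₁ h) → adjacent-gap (inj₂ h) ; (inj₂ h) → adjacent-gap (inj₁ h) }

zigzag : ℕ → Bool → ℕ → ℕ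
zigzag t true  j = t ∸ suc j
zigzag t false j = j

∸-suc : ∀ {j t} → suc j < t → t ∸ suc j ≡ suc (t ∸ suc (suc j))
∸-suc {j} {suc t} (s≤s lt) = +-∸-assoc 1 lt

zigzag-bound : ∀ {t j} b → j < t → zigzag t b j < t
zigzag-bound {suc t} {j} true _ = s≤s (m∸n≤m t j)
zigzag-bound false lt = lt

zigzag-injective : ∀ {t j j'} b → j < t → j' < t → zigzag t b j ≡ zigzag t b j' → j ≡ j'
zigzag-injective true p q eq = suc-injective (∸-cancelˡ-≡ p q eq)
zigzag-injective false _ _ eq = eq

-- Consecutive rows have opposite flags, so this constant sum nests the edges between them.
zigzag-sum : ∀ {t j} b → j < t → suc (zigzag t b j + zigzag t (not b) j) ≡ t
zigzag-sum {t} {j} true lt = trans (sym (+-suc (t ∸ suc j) j)) (m∸n+n≡m lt)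
zigzag-sum {t} {j} false lt = m+[n∸m]≡n lt

zigzag-step : ∀ {t j Vx Ch i} b → suc j < t → Drawn Vx Ch (i , zigzag t b j) (i , zigzag t b (suc j))
zigzag-step {t} {j} {Vx} {Ch} {i} true lt = subst (λ k → Drawn Vx Ch (i , k) (i , t ∸ suc (suc j))) (sym (∸-suc lt)) adjacentᵒ
zigzag-step false _ = adjacent

pair-≡ : ∀ {a b x y : ℕ} → (a , x) ≡ (b , y) → a ≡ b × x ≡ y
pair-≡ refl = refl , refl

-- An even number of rows

-- An even number of rows, in boustrophedon order.  The edges between consecutive rows are nested, and so are the two
-- bundles into which the cut at column t - d divides the twisted edges.

distinct-swap : ∀ {m} {a b c e : Fin m} → Distinct a b c e → Distinct b a c e
distinct-swap {m} {a} {b} {c} {e} h .isDistinct = swapped (isDistinct h)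
  where
  swapped : T (distinct₄ a b c e) → T (distinct₄ b a c e)
  swapped h with a Fin.≟ b | b Fin.≟ a | a ≠ c | a ≠ e | b ≠ c | b ≠ e | c ≠ e
  ... | no p | no _ | true | true | true | true | true = _
  ... | no p | yes refl | _ | _ | _ | _ | _ = contradiction refl p

-- The map `ι` lets one family of chords serve both four and five pages. A fibre coloured by
-- `arc k p q` has to avoid `q` in the columns before `k` and `p` from `k` on, as the edges between
-- rows use these colours there: `k` is `d` in the first row, `t ∸ d` in the last and 0 in the
-- others.
module EvenRows {s t d m : ℕ} (s-even : even s ≡ true) (2≤t : 2 ≤ t) (d<t : d < t) (ι : Fin m → Fin 5) (A B C : Fin m)
  (ιA : ι A ≡ 0F) (ιB : ι B ≡ 1F) (ιC : ι C ≡ 2F)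
  (Admissible : ℕ → Set) (adm-0 : Admissible 0) (adm-d : Admissible d) (adm-last : Admissible (t ∸ d))
  (arc : ℕ → Fin m → Fin m → ℕ → Fin m)
  (arc-wrap : ∀ k p q {j} → Admissible k → suc j ≡ t → ι (arc k p q j) ≡ 3F ⊎ ι (arc k p q j) ≡ 4F)
  (arc-AC : ∀ k {e j} → Admissible k → j < t → YStep t e j → Distinct (if j <ᵇ k then C else A) B (arc k A C e) (arc k A C j))
  (arc-CA : ∀ k {e j} → Admissible k → j < t → YStep t e j → Distinct (if j <ᵇ k then A else C) B (arc k C A e) (arc k C A j))
  where

  data ZChord : Fin 5 → Pos → Pos → Set where
    bridge-B : ∀ {i o e} → even i ≡ true → suc (o + e) ≡ t → ZChord 1F (i , o) (suc i , e)
    bridge-A : ∀ {i o e} → even i ≡ false → suc i < s → suc (o + e) ≡ t → ZChord 0F (i , o) (suc i , e)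
    -- The first row is reversed and the last is not, so the offsets of columns `j + d` and `j` add
    -- up to `t - 1 - d`, or to `2t - 1 - d` when the shift wraps.
    outer-A  : ∀ {r o e} → suc r ≡ s → o + e ≡ t ∸ suc d → ZChord 0F (0 , o) (r , e)
    outer-C  : ∀ {r o e} → suc r ≡ s → o + e ≡ t + t ∸ suc d → ZChord 2F (0 , o) (r , e)
    wrap-D   : ∀ {i e} → ZChord 3F (i , 0) (i , suc e)
    wrap-E   : ∀ {i e} → ZChord 4F (i , 0) (i , suc e)

  recolour : ∀ {c c' p q} → c ≡ c' → ZChord c' p q → ZChord c p q
  recolour refl x = x

  last-odd : ∀ {r} → suc r ≡ s → even r ≡ false
  last-odd e = not-injective (trans (cong even e) s-even)

  last-pos : ∀ {r} → suc r ≡ s → 0 < r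
  last-pos {zero} e = contradiction (last-odd e) true≢false
  last-pos {suc r} _ = z<s

  zchord-≺ : ∀ {c p q} → ZChord c p q → p ≺ q
  zchord-≺ (bridge-B _ _) = blk (n<1+n _)
  zchord-≺ (bridge-A _ _ _) = blk (n<1+n _)
  zchord-≺ (outer-A e _) = blk (last-pos e)
  zchord-≺ (outer-C e _) = blk (last-pos e)
  zchord-≺ wrap-D = off z<s
  zchord-≺ wrap-E = off z<s

  -- Equal parity keeps bridges of one colour out of consecutive pairs of rows, and within one pair
  -- the constant sum nests them.
  bridges : ∀ {i i' o e o' e' b} → even i ≡ b → even i' ≡ b → suc (o + e) ≡ t → suc (o' + e') ≡ t →
            (i , o) ≺ (i' , o') → (i' , o') ≺ (suc i , e) → (suc i , e) ≺ (suc i' , e') → ⊥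
  bridges ei ei' _ _ (blk p) (blk q) _ = <⇒≱ p (s≤s⁻¹ q)
  bridges {b = b} ei ei' _ _ (blk p) (off q) _ = not-¬ refl (trans ei (sym ei'))
  bridges ei ei' S S' (off p) _ (blk q) = n≮n _ q
  bridges ei ei' S S' (off p) _ (off q) = sum-clash p q (suc-injective (trans S (sym S'))) refl

  outers : ∀ {r r' o e o' e' n} → suc r ≡ s → suc r' ≡ s → o + e ≡ n → o' + e' ≡ n → (0 , o) ≺ (0 , o') → (r , e) ≺ (r' , e') → ⊥
  outers _ _ S S' (off p) (off q) = sum-clash p q S S'
  outers refl refl S S' (off p) (blk q) = n≮n _ q

  zuncrossed : ∀ {c p q r w} → ZChord c p q → ZChord c r w → p ≺ r → r ≺ q → q ≺ w → ⊥
  zuncrossed (bridge-B e S) (bridge-B e' S') x y z = bridges e e' S S' x y z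
  zuncrossed (bridge-A e _ S) (bridge-A e' _ S') x y z = bridges e e' S S' x y z
  -- Bridges of colour A lead from odd to even rows, hence they touch neither the first row nor the
  -- last.
  zuncrossed (bridge-A e _ _) (outer-A _ _) (off _) _ _ = true≢false e
  zuncrossed (outer-A refl _) (bridge-A e lt _) _ _ (blk p) = <⇒≱ lt p
  zuncrossed (outer-A e' _) (bridge-A e lt _) _ _ (off p) = true≢false (trans (sym (cong not e)) (last-odd e'))
  zuncrossed (outer-A e S) (outer-A e' S') x _ z = outers e e' S S' x z
  zuncrossed (outer-C e S) (outer-C e' S') x _ z = outers e e' S S' x z
  zuncrossed wrap-D wrap-D (blk p) (blk q) _ = n≮n _ (<-trans p q)
  zuncrossed wrap-D wrap-D (blk p) (off q) _ = n≮n _ p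
  zuncrossed wrap-E wrap-E (blk p) (blk q) _ = n≮n _ (<-trans p q)
  zuncrossed wrap-E wrap-E (blk p) (off q) _ = n≮n _ p

  place-z : ℕ → ℕ → Pos
  place-z i j = i , zigzag t (even i) j

  colX colY : ℕ → ℕ → Fin m
  colX i j = if even i then B else if suc i <ᵇ s then A else if j <ᵇ t ∸ d then A else C
  colY i j = if i ≡ᵇ 0 then arc d A C j else if suc i <ᵇ s then arc 0 A C j else arc (t ∸ d) C A j

  colX-last : ∀ {r} j → suc r ≡ s → colX r j ≡ (if j <ᵇ t ∸ d then A else C)
  colX-last {r} j eq rewrite last-odd eq | <ᵇ-false (≤-reflexive (sym eq)) = refl

  low-side : ∀ {b} → b + d < t → (b <ᵇ t ∸ d) ≡ true
  low-side {b} lt = <ᵇ-true (m+n≤o⇒m≤o∸n (suc b) lt)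

  high-side : ∀ {b j} → j + t ≡ b + d → (b <ᵇ t ∸ d) ≡ false
  high-side {b} {j} eq = <ᵇ-false (m≤n+o⇒m∸n≤o t d (subst (t ≤_) (trans eq (+-comm b d)) (m≤n+m t j)))

  proper-z : ∀ {a b i j e} → a < s → b < t → i < s → j < t → e < t → XStep s t d a b i j → YStep t e j →
             Distinct (colX a b) (colX i j) (colY i e) (colY i j)
  proper-z {b = b} {j = j} _ b<t _ j<t _ (low eq lt) ys
    rewrite colX-last b eq | low-side {b} lt = subst (λ c → Distinct c B _ _) (cong (λ b → if b then C else A) (<ᵇ-false (m≤n+m d b))) (arc-AC d adm-d j<t ys)
  proper-z {b = b} {j = j} _ b<t _ j<t _ (high eq f) ys
    rewrite colX-last b eq | high-side {b} f = subst (λ c → Distinct c B _ _) (cong (λ b → if b then C else A) (<ᵇ-true j<d)) (arc-AC d adm-d j<t ys)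
    where
    j<d : j < d
    j<d = +-cancelʳ-< t j d (subst (_< d + t) (sym f) (subst (_< d + t) (+-comm d b) (+-monoʳ-< d b<t)))
  proper-z {a} {b} {j = j} {e} _ b<t i<s j<t _ (up lt) ys with suc (suc a) <? s
  proper-z {a} {b} {j = j} {e} _ b<t i<s j<t _ (up lt) ys | yes lt' rewrite <ᵇ-true lt | <ᵇ-true lt' with even a
  ... | true  = distinct-swap {a = A} {B} {arc 0 A C e} {arc 0 A C j} (arc-AC 0 adm-0 j<t ys)
  ... | false = arc-AC 0 adm-0 j<t ys
  proper-z {a} {b} {j = j} {e} _ b<t i<s j<t _ (up lt) ys | no ¬lt'
    rewrite colX-last b (≤-antisym lt (≮⇒≥ ¬lt')) | <ᵇ-false (≮⇒≥ ¬lt') | not-injective {even a} {true} (last-odd (≤-antisym lt (≮⇒≥ ¬lt')))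
    = distinct-swap {a = if j <ᵇ t ∸ d then A else C} {B} {arc (t ∸ d) C A e} {arc (t ∸ d) C A j} (arc-CA (t ∸ d) adm-last j<t ys)

  zigzag-layout : Layout s t d m
  zigzag-layout = record
    { width = t
    ; P = place-z
    ; P-bound = λ {i} _ j<t → zigzag-bound (even i) j<t
    ; P-inj = inj
    ; cX = colX
    ; cY = colY
    ; proper = proper-z
    ; Chord = λ c → ZChord (ι c)
    ; chord-≺ = zchord-≺
    ; uncrossed = zuncrossed
    ; drawX = dX
    ; drawY = dY
    }
    where
    inj : ∀ {i j i' j'} → i < s → j < t → i' < s → j' < t → place-z i j ≡ place-z i' j' → i ≡ i' × j ≡ j'
    inj {i} _ j<t _ j'<t eq with pair-≡ eq
    ... | refl , eq' = refl , zigzag-injective (even i) j<t j'<t eq'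
    dX : ∀ {Vx i j i' j'} → i < s → j < t → j' < t → XStep s t d i j i' j' → Drawn Vx (ZChord (ι (colX i j))) (place-z i j) (place-z i' j')
    dX {i = i} {j} _ j<t _ (up lt) with even i in eq | zigzag-sum {t} {j} (even i) j<t
    ... | true  | S = fwd (recolour ιB (bridge-B eq S))
    ... | false | S rewrite <ᵇ-true lt = fwd (recolour ιA (bridge-A eq lt S))
    dX {i = i} {j} _ j<t _ (low eq lt) rewrite colX-last j eq | low-side {j} lt | last-odd eq = bwd (recolour ιA (outer-A eq sum))
      where
      sum : t ∸ suc (j + d) + j ≡ t ∸ suc d
      sum = trans (cong (λ k → t ∸ suc k + j) (+-comm j d)) (trans (cong (_+ j) (sym (∸-+-assoc t (suc d) j))) (m∸n+n≡m (m+n≤o⇒m≤o∸n j (subst (_≤ t) (sym (+-suc j d)) lt))))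
    dX {i = i} {j} {j' = j'} _ j<t j'<t (high eq f) rewrite colX-last j eq | high-side {j} f | last-odd eq = bwd (recolour ιC (outer-C eq sum))
      where
      z = t ∸ suc j'
      z+ : z + suc j' ≡ t
      z+ = m∸n+n≡m j'<t
      rearrange : ∀ z j d → z + j + suc d ≡ z + suc (j + d)
      rearrange = solve-∀
      sum : z + j ≡ t + t ∸ suc d
      sum = trans (sym (m+n∸n≡m (z + j) (suc d))) (cong (_∸ suc d) (trans (rearrange z j d)
        (trans (cong (λ k → z + suc k) (sym f)) (trans (sym (+-assoc z (suc j') t)) (cong (_+ t) z+)))))
    wrapped : ∀ {Vx c i e b} → c ≡ 3F ⊎ c ≡ 4F → suc (suc e) ≡ t → Drawn Vx (ZChord c) (i , zigzag t b (suc e)) (i , zigzag t b 0)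
    wrapped {b = false} (inj₁ refl) refl = bwd wrap-D
    wrapped {b = false} (inj₂ refl) refl = bwd wrap-E
    wrapped {i = i} {e} {true} (inj₁ refl) refl rewrite n∸n≡0 e = fwd wrap-D
    wrapped {i = i} {e} {true} (inj₂ refl) refl rewrite n∸n≡0 e = fwd wrap-E
    wrap-colour : ∀ i {j} → suc j ≡ t → ι (colY i j) ≡ 3F ⊎ ι (colY i j) ≡ 4F
    wrap-colour zero eq = arc-wrap d A C adm-d eq
    wrap-colour (suc i) eq with suc (suc i) <ᵇ s
    ... | true = arc-wrap 0 A C adm-0 eq
    ... | false = arc-wrap (t ∸ d) C A adm-last eq
    dY : ∀ {Vx i j j'} → i < s → j < t → YStep t j j' → Drawn Vx (ZChord (ι (colY i j))) (place-z i j) (place-z i j')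
    dY {i = i} _ _ (next lt) = zigzag-step (even i) lt
    dY {i = i} {suc j} _ _ (last eq) = wrapped {i = i} {b = even i} (wrap-colour i eq) eq
    dY {i = i} {zero} _ _ (last refl) = contradiction 2≤t (n≮n 1)

-- Only `k ≡ suc e` could tell the two comparisons apart, and `suc e` is odd.
even-between-< : ∀ {e k} → even e ≡ true → even k ≡ true → (e <ᵇ k) ≡ (suc e <ᵇ k)
even-between-< {e} {k} ee ek with <-cmp (suc e) k
... | tri< lt _ _ = trans (<ᵇ-true (<-trans (n<1+n e) lt)) (sym (<ᵇ-true lt))
... | tri≈ _ refl _ = contradiction (trans (sym ek) (cong not ee)) true≢false
... | tri> _ _ gt = trans (<ᵇ-false (s≤s⁻¹ gt)) (sym (<ᵇ-false (<⇒≤ gt)))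

module _ {t : ℕ} (t-even : even t ≡ true) where

  -- Both ends of an even fibre edge lie on the same side of an even `k`. The edge across the switch
  -- is odd and has the neutral colour 3F.
  arc₄ : ℕ → Fin 4 → Fin 4 → ℕ → Fin 4
  arc₄ k p q j = if even j then (if j <ᵇ k then p else q) else 3F

  arc₄-last : ∀ {j} → suc j ≡ t → even j ≡ false
  arc₄-last e = not-injective (trans (cong even e) t-even)

  arc₄-proper : ∀ p q → (∀ b → Distinct (if b then q else p) 1F (if b then p else q) 3F) →
                (∀ b → Distinct (if b then q else p) 1F 3F (if b then p else q)) →
                ∀ k {e j} → even k ≡ true → j < t → YStep t e j → Distinct (if j <ᵇ k then q else p) 1F (arc₄ k p q e) (arc₄ k p q j)
  arc₄-proper p q h h' k {e} ek _ (next _) with even e in ee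
  ... | true rewrite even-between-< {e} {k} ee ek = h (suc e <ᵇ k)
  ... | false = h' (suc e <ᵇ k)
  arc₄-proper p q h h' k {e} ek _ (last eq) rewrite arc₄-last eq = h' (0 <ᵇ k)

even-double : ∀ n → even (n + n) ≡ true
even-double n = trans (even-+ n n) (lemma (even n))
  where
  lemma : ∀ b → not (b xor b) ≡ true
  lemma true  = refl
  lemma false = refl

module _ (t : ℕ) where

  -- Before column `k` the colours `p` and 4F alternate; the edge from column `k - 1` to `k` crosses
  -- the switch and gets 3F; from there `q` and 3F alternate, the phase `j + k` making `q` come
  -- first. The closing edge gets 4F, unless it is itself the one at the switch.
  arc₅ : ℕ → Fin 5 → Fin 5 → ℕ → Fin 5
  arc₅ k p q j = if suc j <ᵇ k then (if even j then p else 4F) else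
                 if j <ᵇ k then 3F else
                 if suc j <ᵇ t then (if even (j + k) then q else 3F) else 4F

  data Pal : Fin 5 → Fin 5 → Set where
    pal-AC : Pal 0F 2F
    pal-CA : Pal 2F 0F

  arc₅-proper : ∀ {p q} → Pal p q → ∀ k {e j} → k ≤ t → 2 ≤ t → YStep t e j →
                Distinct (if j <ᵇ k then q else p) 1F (arc₅ k p q e) (arc₅ k p q j)
  arc₅-proper pal k {e} k≤t _ (next lt) with <-cmp k (suc e)
  arc₅-proper pal k {e} k≤t _ (next lt) | tri< k≤e _ _
    rewrite <ᵇ-false k≤e | <ᵇ-false (<⇒≤ k≤e)  | <ᵇ-false (m≤n⇒m≤1+n (<⇒≤ k≤e)) | <ᵇ-true lt
    with even (e + k) | suc (suc e) <ᵇ t | pal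
  ... | true  | true  | pal-AC = _
  ... | true  | true  | pal-CA = _
  ... | true  | false | pal-AC = _
  ... | true  | false | pal-CA = _
  ... | false | true  | pal-AC = _
  ... | false | true  | pal-CA = _
  ... | false | false | pal-AC = _
  ... | false | false | pal-CA = _
  arc₅-proper pal k {e} k≤t _ (next lt) | tri≈ _ refl _
    rewrite <ᵇ-false (≤-refl {suc e}) | <ᵇ-true (n<1+n e) | <ᵇ-false (n≤1+n (suc e)) | even-double (suc e)
    with suc (suc e) <ᵇ t | pal
  ... | true  | pal-AC = _
  ... | true  | pal-CA = _
  ... | false | pal-AC = _
  ... | false | pal-CA = _
  arc₅-proper pal k {e} k≤t _ (next lt) | tri> _ _ k>
    rewrite <ᵇ-true k>
    with even e | suc (suc e) <ᵇ k | pal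
  ... | true  | true  | pal-AC = _
  ... | true  | true  | pal-CA = _
  ... | true  | false | pal-AC = _
  ... | true  | false | pal-CA = _
  ... | false | true  | pal-AC = _
  ... | false | true  | pal-CA = _
  ... | false | false | pal-AC = _
  ... | false | false | pal-CA = _
  arc₅-proper pal zero {e} k≤t 2≤t (last eq) rewrite <ᵇ-false (≤-reflexive (sym eq)) | <ᵇ-true 2≤t with pal
  ... | pal-AC = _
  ... | pal-CA = _
  arc₅-proper pal (suc k) {e} k≤t 2≤t (last eq) with m≤n⇒m<n∨m≡n k≤t
  ... | inj₂ refl rewrite suc-injective eq | <ᵇ-false (≤-refl {k}) | <ᵇ-true (n<1+n k) | <ᵇ-true (s≤s⁻¹ 2≤t) with pal
  ...   | pal-AC = _
  ...   | pal-CA = _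
  arc₅-proper pal (suc k) {e} k≤t 2≤t (last eq) | inj₁ k<t
    rewrite <ᵇ-false (≤-trans (s≤s⁻¹ (subst (suc k <_) (sym eq) k<t)) (n≤1+n e)) | <ᵇ-false (s≤s⁻¹ (subst (suc k <_) (sym eq) k<t)) | <ᵇ-false (≤-reflexive (sym eq))
    with 0 <ᵇ k | pal
  ... | true  | pal-AC = _
  ... | true  | pal-CA = _
  ... | false | pal-AC = _
  ... | false | pal-CA = _

  arc₅-wrap : ∀ k p q {j} → k ≤ t → suc j ≡ t → arc₅ k p q j ≡ 3F ⊎ arc₅ k p q j ≡ 4F
  arc₅-wrap k p q {j} k≤t eq rewrite <ᵇ-false (≤-trans k≤t (≤-reflexive (sym eq))) | <ᵇ-false (≤-reflexive (sym eq)) with j <ᵇ k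
  ... | true  = inj₁ refl
  ... | false = inj₂ refl

zigzag-four : ∀ {s t d} → even s ≡ true → even t ≡ true → even d ≡ true → 2 ≤ t → d < t → Layout s t d 4
zigzag-four {s} {t} {d} es et ed 2≤t d<t = Z.zigzag-layout
  where
  adm : even (t ∸ d) ≡ true
  adm = trans (sym (lemma (even (t ∸ d)))) (trans (sym (trans (even-+ (t ∸ d) d) (cong (λ b → not (even (t ∸ d) xor b)) ed))) (trans (cong even (m∸n+n≡m (<⇒≤ d<t))) et))
    where
    lemma : ∀ b → not (b xor true) ≡ b
    lemma true  = refl
    lemma false = refl
  wrap : ∀ k p q {j} → even k ≡ true → suc j ≡ t → Fin.inject₁ (arc₄ {t} et k p q j) ≡ 3F ⊎ Fin.inject₁ (arc₄ {t} et k p q j) ≡ 4F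
  wrap k p q {j} _ eq = inj₁ (cong (λ b → Fin.inject₁ (if b then (if j <ᵇ k then p else q) else 3F)) (arc₄-last {t} et eq))
  AC : ∀ k {e j} → even k ≡ true → j < t → YStep t e j → Distinct (if j <ᵇ k then 2F else 0F) 1F (arc₄ {t} et k 0F 2F e) (arc₄ {t} et k 0F 2F j)
  AC = arc₄-proper {t} et 0F 2F (λ { true → _ ; false → _ }) (λ { true → _ ; false → _ })
  CA : ∀ k {e j} → even k ≡ true → j < t → YStep t e j → Distinct (if j <ᵇ k then 0F else 2F) 1F (arc₄ {t} et k 2F 0F e) (arc₄ {t} et k 2F 0F j)
  CA = arc₄-proper {t} et 2F 0F (λ { true → _ ; false → _ }) (λ { true → _ ; false → _ })
  module Z = EvenRows {s} es 2≤t d<t Fin.inject₁ 0F 1F 2F refl refl refl (λ k → even k ≡ true) refl ed adm (arc₄ {t} et) wrap AC CA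

zigzag-five : ∀ {s t d} → even s ≡ true → 2 ≤ t → d < t → Layout s t d 5
zigzag-five {s} {t} {d} es 2≤t d<t = Z.zigzag-layout
  where
  AC : ∀ k {e j} → k ≤ t → j < t → YStep t e j → Distinct (if j <ᵇ k then 2F else 0F) 1F (arc₅ t k 0F 2F e) (arc₅ t k 0F 2F j)
  AC k adm _ = arc₅-proper t pal-AC k adm 2≤t
  CA : ∀ k {e j} → k ≤ t → j < t → YStep t e j → Distinct (if j <ᵇ k then 0F else 2F) 1F (arc₅ t k 2F 0F e) (arc₅ t k 2F 0F j)
  CA k adm _ = arc₅-proper t pal-CA k adm 2≤t
  module Z = EvenRows {s} es 2≤t d<t (λ c → c) 0F 1F 2F refl refl refl (_≤ t) z≤n (<⇒≤ d<t) (m∸n≤m t d) (arc₅ t) (arc₅-wrap t) AC CA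

-- An odd number of rows: positions and chords of the ladder

-- An odd number of rows: boustrophedon order for rows 0, …, r with r even.  The remaining two rows b and c are
-- interleaved as b₀ c₀ c₁ b₁ b₂ c₂ … in block r + 1.  The spokes b_j c_j join
-- consecutive positions, and so does every second edge of each of the two rails.

double-cancel-< : ∀ {j k} → j + j < k + k → j < k
double-cancel-< lt = ≰⇒> λ k≤j → <⇒≱ lt (+-mono-≤ k≤j k≤j)

double-suc : ∀ j → suc j + suc j ≡ suc (suc (j + j))
double-suc j = cong suc (+-suc j j)

long-reach : ∀ {j k} → k + k < 3 + (j + j) → k ≤ suc j
long-reach {j} {k} lt = s≤s⁻¹ (≰⇒> λ le → <⇒≱ lt (≤-trans (subst (3 + (j + j) ≤_) (sym (quad j)) (n≤1+n _)) (+-mono-≤ le le)))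
  where
  quad : ∀ j → suc (suc j) + suc (suc j) ≡ 4 + (j + j)
  quad = solve-∀

long-reach′ : ∀ {j k} → suc (k + k) < 3 + (j + j) → k ≤ j
long-reach′ {j} {k} lt = s≤s⁻¹ (double-cancel-< (subst (k + k <_) (sym (double-suc j)) (s≤s⁻¹ lt)))

nested : ∀ {j k e e'} → j + j ≤ e → e < e' → e' ≤ suc (k + k) → j ≤ k
nested {j} {k} a b c = s≤s⁻¹ (double-cancel-< (subst (j + j <_) (sym (double-suc k)) (s≤s (≤-trans a (≤-trans (<⇒≤ b) c)))))

rungpos : Bool → ℕ → ℕ
rungpos true  j = j + j
rungpos false j = suc (j + j)

rungpos-≥ : ∀ u j → j + j ≤ rungpos u j
rungpos-≥ true  j = ≤-refl
rungpos-≥ false j = n≤1+n _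

rungpos-≤ : ∀ u j → rungpos u j ≤ suc (j + j)
rungpos-≤ true  j = n≤1+n _
rungpos-≤ false j = ≤-refl

in-block : ∀ {a b x y z} → (a , x) ≺ (b , y) → (b , y) ≺ (a , z) → a ≡ b
in-block (blk p) (blk q) = contradiction q (<-asym p)
in-block (blk p) (off _) = refl
in-block (off _) _ = refl

block-≤ : ∀ {a b x y} → (a , x) ≺ (b , y) → a ≤ b
block-≤ (blk p) = <⇒≤ p
block-≤ (off _) = ≤-refl

off⁻¹ : ∀ {a x y} → (a , x) ≺ (a , y) → x < y
off⁻¹ (blk p) = contradiction p (n≮n _)
off⁻¹ (off p) = p

module LadderChords (r t d : ℕ) (r-even : even r ≡ true) where

  -- The offsets `j + j` and `3 + (j + j)` are the ends of the long rail edge between columns `j`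
  -- and `j + 1`. It belongs to rail b for even `j` and to rail c for odd `j`.
  data Inner : Fin 5 → ℕ → ℕ → Set where
    first-A   : even t ≡ false → Inner 0F 0 3
    final-A   : ∀ {j} → even t ≡ false → 5 ≤ t → d < 2 → suc (suc j) ≡ t → Inner 0F (j + j) (3 + (j + j))
    final-C   : ∀ {j} → 2 ≤ d → suc (suc j) ≡ t → Inner 2F (j + j) (3 + (j + j))
    long-D    : ∀ {j} → even j ≡ true → suc j < t → Inner 3F (j + j) (3 + (j + j))
    long-E    : ∀ {j} → even j ≡ false → suc j < t → Inner 4F (j + j) (3 + (j + j))
    -- The ladder begins with b before c. For odd `t` it ends in the same order, so the closing rail
    -- edges cross and need two pages; for even `t` it ends with c before b, and they nest on one.
    wrap-D    : ∀ {e} → even t ≡ false → suc e ≡ t → Inner 3F 0 (e + e)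
    wrap-E    : ∀ {e} → even t ≡ false → suc e ≡ t → Inner 4F 1 (suc (e + e))
    wrap-out  : ∀ {e} → even t ≡ true → suc e ≡ t → Inner 4F 0 (suc (e + e))
    wrap-in   : ∀ {e} → even t ≡ true → suc e ≡ t → Inner 4F 1 (e + e)

  data LChord : Fin 5 → Pos → Pos → Set where
    bridge-B : ∀ {i o e} → even i ≡ true → i < r → suc (o + e) ≡ t → LChord 1F (i , o) (suc i , e)
    bridge-A : ∀ {i o e} → even i ≡ false → i < r → suc (o + e) ≡ t → LChord 0F (i , o) (suc i , e)
    shell    : ∀ {j o e} → o + suc j ≡ t → j + j ≤ e → e ≤ suc (j + j) → LChord 1F (r , o) (suc r , e)
    -- For odd `t` colour A also carries rail edges at the ends of the ladder. With `2 ≤ j` the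
    -- twisted edges stay to the right of `first-A`, and `2 ≤ d` rules out `final-A`.
    outer-A  : ∀ {j o e} → even t ≡ true ⊎ (2 ≤ d × 2 ≤ j) → o + suc (j + d) ≡ t + t → j + j ≤ e → e ≤ suc (j + j) → LChord 0F (0 , o) (suc r , e)
    outer-C  : ∀ {j o e} → j + d < t → o + suc (j + d) ≡ t → j + j ≤ e → e ≤ suc (j + j) → LChord 2F (0 , o) (suc r , e)
    -- This chord ends at the last position of the whole circle, so nothing can emerge from it on
    -- the right.
    outer-D  : ∀ {j o} → suc j ≡ t → even t ≡ false → LChord 3F (0 , o) (suc r , suc (j + j))
    plain-E  : ∀ {i e} → i ≤ r → LChord 4F (i , 0) (i , suc e)
    plain-A  : ∀ {e} → d ≡ 0 → even t ≡ false → LChord 0F (0 , 0) (0 , suc e)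
    plain-C  : ∀ {i e} → 0 < i → i ≤ r → LChord 2F (i , 0) (i , suc e)
    inner    : ∀ {c x y} → Inner c x y → x < y → LChord c (suc r , x) (suc r , y)

  lchord-≺ : ∀ {c p q} → LChord c p q → p ≺ q
  lchord-≺ (bridge-B _ _ _) = blk (n<1+n _)
  lchord-≺ (bridge-A _ _ _) = blk (n<1+n _)
  lchord-≺ (shell _ _ _) = blk (n<1+n _)
  lchord-≺ (outer-A _ _ _ _) = blk z<s
  lchord-≺ (outer-C _ _ _ _) = blk z<s
  lchord-≺ (outer-D _ _) = blk z<s
  lchord-≺ (plain-E _) = off z<s
  lchord-≺ (plain-A _ _) = off z<s
  lchord-≺ (plain-C _ _) = off z<s
  lchord-≺ (inner _ lt) = off lt

  clash : ∀ {a : Bool} → a ≡ true → a ≡ false → ⊥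
  clash refl ()

  -- Long rail edges overlap only if their columns are consecutive, and then the parities of the
  -- columns differ.
  longs : ∀ {j k} → even j ≡ even k → j + j < k + k → k + k < 3 + (j + j) → ⊥
  longs {j} {k} eq lt lt' with m≤n⇒m<n∨m≡n (long-reach {j} {k} lt')
  ... | inj₁ k<sj = <⇒≱ (double-cancel-< {j} {k} lt) (s≤s⁻¹ k<sj)
  ... | inj₂ refl = not-¬ refl eq

  odd≢0 : ∀ {j} → even j ≡ false → j + j < 1 → ⊥
  odd≢0 {zero} ()
  odd≢0 {suc j} _ (s≤s ())

  -- Only the long edge of column `t - 2` reaches far enough, and that column has the parity of `t`.
  last-long : ∀ {e j} → suc e ≡ t → even j ≡ not (even t) → suc j < t → e + e < 3 + (j + j) → ⊥
  last-long {e} {j} refl par lt lt' with ≤-antisym lt (s≤s (long-reach {j} {e} lt'))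
  ... | refl = not-¬ {x = even j} (sym (not-involutive _)) par

  inner-uncrossed : ∀ {c x y x' y'} → Inner c x y → Inner c x' y' → x < x' → x' < y → y < y' → ⊥
  inner-uncrossed (first-A _) (first-A _) () _ _
  inner-uncrossed (first-A _) (final-A {j} _ 5≤t _ refl) _ lt _ = <⇒≱ lt (≤-trans (s≤s⁻¹ (s≤s⁻¹ 5≤t)) (m≤m+n j j))
  inner-uncrossed (final-A _ _ _ _) (first-A _) () _ _
  inner-uncrossed (final-A {j} _ _ _ refl) (final-A _ _ _ refl) lt _ _ = n≮n _ lt
  inner-uncrossed (final-C _ refl) (final-C _ refl) lt _ _ = n≮n _ lt
  inner-uncrossed (long-D {j} e _) (long-D {k} e' _) a b _ = longs {j} {k} (trans e (sym e')) a b
  inner-uncrossed (long-D _ _) (wrap-D _ _) () _ _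
  inner-uncrossed (wrap-D ot e) (long-D {j} ej lt) _ _ c = last-long {j = j} e (trans ej (sym (cong not ot))) lt c
  inner-uncrossed (wrap-D _ _) (wrap-D _ _) () _ _
  inner-uncrossed (long-E {j} e _) (long-E {k} e' _) a b _ = longs {j} {k} (trans e (sym e')) a b
  inner-uncrossed (long-E {j} e _) (wrap-E _ _) a _ _ = odd≢0 {j} e a
  inner-uncrossed (long-E _ _) (wrap-out _ _) () _ _
  inner-uncrossed (long-E {j} e _) (wrap-in _ _) a _ _ = odd≢0 {j} e a
  inner-uncrossed (wrap-E _ refl) (long-E {j} _ lt) _ _ c = <⇒≱ lt (s≤s (long-reach′ {j} c))
  inner-uncrossed (wrap-E _ _) (wrap-E _ _) (s≤s ()) _ _
  inner-uncrossed (wrap-E _ _) (wrap-out _ _) () _ _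
  inner-uncrossed (wrap-E o _) (wrap-in e _) _ _ _ = clash e o
  inner-uncrossed (wrap-out _ refl) (long-E {j} _ lt) _ _ c = <⇒≱ lt (s≤s (long-reach′ {j} c))
  inner-uncrossed (wrap-out e _) (wrap-E o _) _ _ _ = clash e o
  inner-uncrossed (wrap-out _ _) (wrap-out _ _) () _ _
  inner-uncrossed (wrap-out _ refl) (wrap-in _ refl) _ _ c = <⇒≱ c (n≤1+n _)
  inner-uncrossed (wrap-in et e) (long-E {j} ej lt) _ _ c = last-long {j = j} e (trans ej (sym (cong not et))) lt c
  inner-uncrossed (wrap-in e _) (wrap-E o _) _ _ _ = clash e o
  inner-uncrossed (wrap-in _ _) (wrap-out _ _) () _ _
  inner-uncrossed (wrap-in _ _) (wrap-in _ _) (s≤s ()) _ _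

  bridges : ∀ {i i' o e o' e' b} → even i ≡ b → even i' ≡ b → suc (o + e) ≡ t → suc (o' + e') ≡ t →
            (i , o) ≺ (i' , o') → (i' , o') ≺ (suc i , e) → (suc i , e) ≺ (suc i' , e') → ⊥
  bridges ei ei' _ _ (blk p) (blk q) _ = <⇒≱ p (s≤s⁻¹ q)
  bridges ei ei' _ _ (blk p) (off q) _ = not-¬ refl (trans ei (sym ei'))
  bridges ei ei' S S' (off p) _ (blk q) = n≮n _ q
  bridges ei ei' S S' (off p) _ (off q) = sum-clash p q (suc-injective (trans S (sym S'))) refl

  -- Going right in the ladder means a larger or equal column. With `o + j` fixed, the offset in the
  -- reversed row cannot grow at the same time, so such chords nest.
  shells : ∀ {j j' o o' e e' n} k → o + suc (j + k) ≡ n → o' + suc (j' + k) ≡ n → j + j ≤ e → e' ≤ suc (j' + j') → o < o' → e < e' → ⊥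
  shells k S S' a b p q = <⇒≢ (+-mono-<-≤ p (s≤s (+-monoˡ-≤ k (nested a q b)))) (trans S (sym S'))

  luncrossed : ∀ {c p q r w} → LChord c p q → LChord c r w → p ≺ r → r ≺ q → q ≺ w → ⊥
  luncrossed (bridge-B e _ S) (bridge-B e' _ S') x y z = bridges e e' S S' x y z
  luncrossed (bridge-B e i<r _) (shell _ _ _) x (blk y) z = <⇒≱ i<r (s≤s⁻¹ y)
  luncrossed (bridge-B e i<r _) (shell _ _ _) x (off y) z = clash r-even (cong not e)
  luncrossed (shell _ _ _) (bridge-B _ i<r _) x _ _ = <⇒≱ i<r (block-≤ x)
  luncrossed (shell {j} S a _) (shell {j'} S' _ b) x _ z = shells 0 (trans (cong (λ k → _ + suc k) (+-identityʳ j)) S) (trans (cong (λ k → _ + suc k) (+-identityʳ j')) S') a b (off⁻¹ x) (off⁻¹ z)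
  luncrossed (bridge-A e _ S) (bridge-A e' _ S') x y z = bridges e e' S S' x y z
  luncrossed (bridge-A e _ _) (outer-A _ _ _ _) (off _) _ _ = true≢false e
  luncrossed (bridge-A e _ _) (plain-A _ _) (off ()) _ _
  luncrossed (bridge-A _ i<r _) (inner _ _) _ y _ = <⇒≱ i<r (s≤s⁻¹ (block-≤ y))
  luncrossed (outer-A _ _ _ _) (bridge-A _ i<r _) _ _ z = <⇒≱ i<r (s≤s⁻¹ (block-≤ z))
  luncrossed (outer-A _ S a _) (outer-A _ S' _ b) x _ z = shells d S S' a b (off⁻¹ x) (off⁻¹ z)
  luncrossed (outer-A _ _ _ _) (plain-A _ _) _ _ (blk ())
  luncrossed (outer-A (inj₁ e) _ _ _) (inner (first-A o) _) _ _ _ = clash e o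
  luncrossed (outer-A (inj₂ (_ , 2≤j)) _ a _) (inner (first-A _) _) _ _ z = <⇒≱ (off⁻¹ z) (≤-trans (n≤1+n 3) (≤-trans (+-mono-≤ 2≤j 2≤j) a))
  luncrossed (outer-A (inj₂ (2≤d , _)) _ _ _) (inner (final-A _ _ d<2 _) _) _ _ _ = <⇒≱ d<2 2≤d
  luncrossed (outer-A (inj₁ e) _ _ _) (inner (final-A o _ _ _) _) _ _ _ = clash e o
  luncrossed (plain-A _ _) (bridge-A _ _ _) _ (blk ()) _
  luncrossed (plain-A _ _) (bridge-A () _ _) _ (off _) _
  luncrossed (plain-A refl o) (outer-A (inj₁ e) _ _ _) _ _ _ = clash e o
  luncrossed (plain-A refl o) (outer-A (inj₂ (() , _)) _ _ _) _ _ _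
  luncrossed (plain-A _ _) (plain-A _ _) (off ()) _ _
  luncrossed (plain-A _ _) (inner _ _) _ (blk ()) _
  luncrossed (inner _ _) (bridge-A _ i<r _) x _ _ = <⇒≱ i<r (≤-trans (n≤1+n r) (block-≤ x))
  luncrossed (inner _ _) (outer-A _ _ _ _) (blk ()) _ _
  luncrossed (inner _ _) (plain-A _ _) (blk ()) _ _
  luncrossed (inner I _) (inner J _) x y z = inner-uncrossed I J (off⁻¹ x) (off⁻¹ y) (off⁻¹ z)
  luncrossed (outer-C _ S a _) (outer-C _ S' _ b) x _ z = shells d S S' a b (off⁻¹ x) (off⁻¹ z)
  luncrossed (outer-C _ _ _ _) (plain-C _ i≤r) _ _ z = <⇒≱ (s≤s i≤r) (block-≤ z)
  luncrossed (outer-C {j} lt _ _ b) (inner (final-C {k} 2≤d refl) _) _ y _ = <⇒≱ (off⁻¹ y) (≤-trans b (≤-trans (n≤1+n _) (subst (_≤ k + k) (double-suc j) (+-mono-≤ j<k j<k))))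
    where
    j<k : j < k
    j<k = +-cancelˡ-< 2 _ _ (≤-<-trans (subst (_≤ j + d) (+-comm j 2) (+-monoʳ-≤ j 2≤d)) lt)
  luncrossed (plain-C 0<i _) (outer-C _ _ _ _) (off _) _ _ = n≮n 0 0<i
  luncrossed (plain-C _ _) (plain-C _ _) x y _ with in-block x y
  luncrossed (plain-C _ _) (plain-C _ _) (off ()) y _ | refl
  luncrossed (plain-C _ _) (plain-C _ _) (blk p) y _ | refl = n≮n _ p
  luncrossed (plain-C _ i≤r) (inner _ _) x y _ = <⇒≱ (s≤s i≤r) (block-≤ y)
  luncrossed (inner _ _) (outer-C _ _ _ _) (blk ()) _ _
  luncrossed (inner _ _) (plain-C _ i≤r) x _ _ = <⇒≱ (s≤s i≤r) (block-≤ x)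
  luncrossed (outer-D refl _) (outer-D refl _) _ _ z = n≮n _ (off⁻¹ z)
  luncrossed (outer-D {k} refl _) (inner (long-D {j} _ lt) _) _ _ z = <⇒≱ lt (s≤s (long-reach′ {j} (off⁻¹ z)))
  luncrossed (outer-D refl _) (inner (wrap-D _ refl) _) _ _ z = <⇒≱ (off⁻¹ z) (n≤1+n _)
  luncrossed (inner _ _) (outer-D _ _) (blk ()) _ _
  luncrossed (plain-E _) (plain-E _) x y _ with in-block x y
  luncrossed (plain-E _) (plain-E _) (off ()) y _ | refl
  luncrossed (plain-E _) (plain-E _) (blk p) y _ | refl = n≮n _ p
  luncrossed (plain-E i≤r) (inner _ _) x y _ = <⇒≱ (s≤s i≤r) (block-≤ y)
  luncrossed (inner _ _) (plain-E i≤r) x _ _ = <⇒≱ (s≤s i≤r) (block-≤ x)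

module LadderRows (r t d : ℕ) (r-even : even r ≡ true) (2≤t : 2 ≤ t) where
  open LadderChords r t d r-even public

  s = suc (suc (suc r))

  place-l : ℕ → ℕ → Pos
  place-l i j = if i <ᵇ suc r then (i , zigzag t (even i) j) else
                if i <ᵇ suc (suc r) then (suc r , rungpos (even j) j) else (suc r , rungpos (not (even j)) j)

  -- spoke, rung and twst colour the edges that leave rows r, b and c; railb, railc and fibre those within a row.
  record Colouring : Set where
    field
      spoke rung twst railb railc : ℕ → Fin 5
      fibre : ℕ → ℕ → Fin 5

    out : ℕ → ℕ → Fin 5
    out i j = if i <ᵇ r then (if even i then 1F else 0F) else spoke j

    field
      proper-top   : ∀ {b j e} → b < t → XStep s t d (suc (suc r)) b 0 j → j < t → YStep t e j → Distinct (twst b) (out 0 j) (fibre 0 e) (fibre 0 j)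
      proper-plain : ∀ {i j e} → j < t → YStep t e j → Distinct 0F 1F (fibre (suc i) e) (fibre (suc i) j)
      proper-spoke  : ∀ {i j e} → suc i ≡ r → j < t → YStep t e j → Distinct 0F (spoke j) (fibre r e) (fibre r j)
      proper-b     : ∀ {j e} → j < t → YStep t e j → Distinct (spoke j) (rung j) (railb e) (railb j)
      proper-c     : ∀ {j e} → j < t → YStep t e j → Distinct (rung j) (twst j) (railc e) (railc j)
      spoke-B   : ∀ j → spoke (suc j) ≡ 1F
      plain-wrap : ∀ {i e} → i ≤ r → suc (suc e) ≡ t → LChord (fibre i (suc e)) (i , 0) (i , suc e)
      twst-low : ∀ {j o e} → j < t → e ≡ rungpos (not (even j)) j → j + d < t → o + suc (j + d) ≡ t → j + j ≤ e → e ≤ suc (j + j) → LChord (twst j) (0 , o) (suc r , e)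
      twst-high : ∀ {j o e} → j < t → e ≡ rungpos (not (even j)) j → t ≤ j + d → o + suc (j + d) ≡ t + t → j + j ≤ e → e ≤ suc (j + j) → LChord (twst j) (0 , o) (suc r , e)
      long-b : ∀ {j} → even j ≡ true → suc j < t → Inner (railb j) (j + j) (3 + (j + j))
      long-c : ∀ {j} → even j ≡ false → suc j < t → Inner (railc j) (j + j) (3 + (j + j))
      wrap-b : ∀ {e} → suc e ≡ t → Inner (railb e) 0 (rungpos (even e) e)
      wrap-c : ∀ {e} → suc e ≡ t → Inner (railc e) 1 (rungpos (not (even e)) e)

  data Row : ℕ → Set where
    row-plain : ∀ {i} → i ≤ r → Row i
    row-b     : Row (suc r)
    row-c     : Row (suc (suc r))

  row : ∀ {i} → i < s → Row i
  row {i} lt with <-cmp i (suc r)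
  ... | tri< p _ _ = row-plain (s≤s⁻¹ p)
  ... | tri≈ _ refl _ = row-b
  ... | tri> _ _ p = subst Row (≤-antisym p (s≤s⁻¹ lt)) row-c

  place-plain : ∀ {i} j → i ≤ r → place-l i j ≡ (i , zigzag t (even i) j)
  place-plain j le rewrite <ᵇ-true (s≤s le) = refl

  place-b : ∀ j → place-l (suc r) j ≡ (suc r , rungpos (even j) j)
  place-b j rewrite <ᵇ-false (≤-refl {suc r}) | <ᵇ-true (n<1+n (suc r)) = refl

  place-c : ∀ j → place-l (suc (suc r)) j ≡ (suc r , rungpos (not (even j)) j)
  place-c j rewrite <ᵇ-false (n≤1+n (suc r)) | <ᵇ-false (≤-refl {suc (suc r)}) = refl

  rungpos-bound : ∀ u {j} → j < t → rungpos u j < t + t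
  rungpos-bound u {j} lt = ≤-trans (s≤s (rungpos-≤ u j)) (subst (_≤ t + t) (double-suc j) (+-mono-≤ lt lt))

  bound-l : ∀ {i j} → i < s → j < t → proj₂ (place-l i j) < t + t
  bound-l {i} {j} i<s j<t with row i<s
  ... | row-plain le rewrite place-plain j le = ≤-trans (zigzag-bound (even i) j<t) (m≤m+n t t)
  ... | row-b rewrite place-b j = rungpos-bound (even j) j<t
  ... | row-c rewrite place-c j = rungpos-bound (not (even j)) j<t

  -- Halving the offset recovers the column, whichever of the two places of a rung is taken.
  half-injective : ∀ {j k} u v → rungpos u j ≡ rungpos v k → j ≡ k
  half-injective {j} {k} u v eq = ≤-antisym
    (nested′ (≤-trans (rungpos-≥ u j) (subst (_≤ suc (k + k)) (sym eq) (rungpos-≤ v k))))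
    (nested′ (≤-trans (rungpos-≥ v k) (subst (_≤ suc (j + j)) eq (rungpos-≤ u j))))
    where
    nested′ : ∀ {j k} → j + j ≤ suc (k + k) → j ≤ k
    nested′ {j} {k} le = s≤s⁻¹ (double-cancel-< (subst (j + j <_) (sym (double-suc k)) (s≤s le)))

  rungpos-flip : ∀ u j → rungpos u j ≢ rungpos (not u) j
  rungpos-flip true  j = <⇒≢ (n<1+n _)
  rungpos-flip false j = ≢-sym (<⇒≢ (n<1+n _))

  inj-l : ∀ {i j i' j'} → i < s → j < t → i' < s → j' < t → place-l i j ≡ place-l i' j' → i ≡ i' × j ≡ j'
  inj-l {i} {j} {i'} {j'} p q p' q' eq with row p | row p'
  ... | row-plain le | row-plain le' with pair-≡ (trans (sym (place-plain j le)) (trans eq (place-plain j' le')))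
  ...   | refl , e = refl , zigzag-injective (even i) q q' e
  inj-l {i} {j} {i'} {j'} p q p' q' eq | row-plain le | row-b with pair-≡ (trans (sym (place-plain j le)) (trans eq (place-b j')))
  ... | refl , _ = contradiction le (n≮n r)
  inj-l {i} {j} {i'} {j'} p q p' q' eq | row-plain le | row-c with pair-≡ (trans (sym (place-plain j le)) (trans eq (place-c j')))
  ... | refl , _ = contradiction le (n≮n r)
  inj-l {i} {j} {i'} {j'} p q p' q' eq | row-b | row-plain le with pair-≡ (trans (sym (place-b j)) (trans eq (place-plain j' le)))
  ... | refl , _ = contradiction le (n≮n r)
  inj-l {i} {j} {i'} {j'} p q p' q' eq | row-c | row-plain le with pair-≡ (trans (sym (place-c j)) (trans eq (place-plain j' le)))
  ... | refl , _ = contradiction le (n≮n r)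
  inj-l {i} {j} {i'} {j'} p q p' q' eq | row-b | row-b = refl , half-injective (even j) (even j') (proj₂ (pair-≡ (trans (sym (place-b j)) (trans eq (place-b j')))))
  inj-l {i} {j} {i'} {j'} p q p' q' eq | row-c | row-c = refl , half-injective (not (even j)) (not (even j')) (proj₂ (pair-≡ (trans (sym (place-c j)) (trans eq (place-c j')))))
  inj-l {i} {j} {i'} {j'} p q p' q' eq | row-b | row-c with proj₂ (pair-≡ (trans (sym (place-b j)) (trans eq (place-c j'))))
  ... | e with half-injective (even j) (not (even j')) e
  ...   | refl = contradiction e (rungpos-flip (even j) j)
  inj-l {i} {j} {i'} {j'} p q p' q' eq | row-c | row-b with proj₂ (pair-≡ (trans (sym (place-c j)) (trans eq (place-b j'))))
  ... | e with half-injective (not (even j)) (even j') e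
  ...   | refl = contradiction (sym e) (rungpos-flip (even j) j)

  module WithColouring (K : Colouring) where
    open Colouring K

    colX colY : ℕ → ℕ → Fin 5
    colX i j = if i <ᵇ suc r then out i j else if i <ᵇ suc (suc r) then rung j else twst j
    colY i j = if i <ᵇ suc r then fibre i j else if i <ᵇ suc (suc r) then railb j else railc j

    colX-plain : ∀ {i} j → i ≤ r → colX i j ≡ out i j
    colX-plain j le rewrite <ᵇ-true (s≤s le) = refl
    colX-b : ∀ j → colX (suc r) j ≡ rung j
    colX-b j rewrite <ᵇ-false (≤-refl {suc r}) | <ᵇ-true (n<1+n (suc r)) = refl
    colX-c : ∀ j → colX (suc (suc r)) j ≡ twst j
    colX-c j rewrite <ᵇ-false (n≤1+n (suc r)) | <ᵇ-false (≤-refl {suc (suc r)}) = refl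
    colY-plain : ∀ {i} j → i ≤ r → colY i j ≡ fibre i j
    colY-plain j le rewrite <ᵇ-true (s≤s le) = refl
    colY-b : ∀ j → colY (suc r) j ≡ railb j
    colY-b j rewrite <ᵇ-false (≤-refl {suc r}) | <ᵇ-true (n<1+n (suc r)) = refl
    colY-c : ∀ j → colY (suc (suc r)) j ≡ railc j
    colY-c j rewrite <ᵇ-false (n≤1+n (suc r)) | <ᵇ-false (≤-refl {suc (suc r)}) = refl

    out-< : ∀ {i} j → i < r → out i j ≡ (if even i then 1F else 0F)
    out-< j lt rewrite <ᵇ-true lt = refl
    out-r : ∀ j → out r j ≡ spoke j
    out-r j rewrite <ᵇ-false (≤-refl {r}) = refl

    distinct-cong : ∀ {a b c e a' b' c' e' : Fin 5} → a ≡ a' → b ≡ b' → c ≡ c' → e ≡ e' → Distinct a' b' c' e' → Distinct a b c e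
    distinct-cong refl refl refl refl h = h

    proper-l : ∀ {a b i j e} → a < s → b < t → i < s → j < t → e < t → XStep s t d a b i j → YStep t e j →
               Distinct (colX a b) (colX i j) (colY i e) (colY i j)
    proper-l {b = b} {j = j} {e} _ b<t _ j<t _ xs@(low refl _) ys =
      distinct-cong (colX-c b) (colX-plain j z≤n) (colY-plain e z≤n) (colY-plain j z≤n) (proper-top b<t xs j<t ys)
    proper-l {b = b} {j = j} {e} _ b<t _ j<t _ xs@(high refl _) ys =
      distinct-cong (colX-c b) (colX-plain j z≤n) (colY-plain e z≤n) (colY-plain j z≤n) (proper-top b<t xs j<t ys)
    proper-l {a} {j = j} {e} _ _ i<s j<t _ (up lt) ys with row i<s
    ... | row-b = distinct-cong (trans (colX-plain j ≤-refl) (out-r j)) (colX-b j) (colY-b e) (colY-b j) (proper-b j<t ys)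
    ... | row-c = distinct-cong (colX-b j) (colX-c j) (colY-c e) (colY-c j) (proper-c j<t ys)
    ... | row-plain le with m≤n⇒m<n∨m≡n le
    ...   | inj₂ refl = distinct-cong (trans (colX-plain j (n≤1+n a)) (trans (out-< j (n<1+n a)) (cong (λ b → if b then 1F else 0F) (not-injective r-even))))
                          (trans (colX-plain j ≤-refl) (out-r j)) (colY-plain e ≤-refl) (colY-plain j ≤-refl) (proper-spoke refl j<t ys)
    ...   | inj₁ lt' = distinct-cong (trans (colX-plain j (<⇒≤ le)) (out-< j le)) (trans (colX-plain j le) (out-< j lt')) (colY-plain e le) (colY-plain j le) (alternate (even a) (proper-plain {i = a} j<t ys))
      where
      alternate : ∀ b {x y} → Distinct 0F 1F x y → Distinct (if b then 1F else 0F) (if not b then 1F else 0F) x y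
      alternate true {x} {y} h = distinct-swap {a = 0F} {1F} {x} {y} h
      alternate false h = h
    Vertexˡ : Pos → Set
    Vertexˡ p = ∃₂ λ i j → i < s × j < t × p ≡ place-l i j

    DrawnX : Fin 5 → Pos → Pos → Set
    DrawnX c = Drawn Vertexˡ (LChord c)

    transport : ∀ {c c' p p' q q'} → c ≡ c' → p ≡ p' → q ≡ q' → DrawnX c' p' q' → DrawnX c p q
    transport refl refl refl x = x

    rung-drawn : ∀ {c b} u j → DrawnX c (b , rungpos u j) (b , rungpos (not u) j)
    rung-drawn true  j = adjacent
    rung-drawn false j = adjacentᵒ

    join : ∀ {c} → DrawnX c (r , t ∸ 1) (suc r , 0)
    join = gap nothing-between
      where
      between : ∀ {i j} → i < s → j < t → (r , t ∸ 1) ≺ place-l i j → place-l i j ≺ (suc r , 0) → ⊥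
      between {i} {j} i<s j<t x y with row i<s
      ... | row-b rewrite place-b j = n≮0 (off⁻¹ y)
      ... | row-c rewrite place-c j = n≮0 (off⁻¹ y)
      ... | row-plain le rewrite place-plain j le with ≤-antisym (block-≤ x) le
      ...   | refl = <⇒≱ (off⁻¹ x) (≤-trans (s≤s⁻¹ (zigzag-bound′ (even i) j<t)) ≤-refl)
        where
        zigzag-bound′ : ∀ b {j} → j < t → suc (zigzag t b j) ≤ suc (t ∸ 1)
        zigzag-bound′ b lt = ≤-trans (zigzag-bound b lt) (≤-reflexive (sym (m+[n∸m]≡n (≤-trans (n≤1+n 1) 2≤t))))
      nothing-between : ∀ p → Vertexˡ p → ¬ (((r , t ∸ 1) ≺ p × p ≺ (suc r , 0)) ⊎ ((suc r , 0) ≺ p × p ≺ (r , t ∸ 1)))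
      nothing-between p (i , j , i<s , j<t , refl) (inj₁ (x , y)) = between i<s j<t x y
      nothing-between p _ (inj₂ (x , y)) = n≮n r (≤-trans (block-≤ x) (block-≤ y))

    spoke-drawn : ∀ j → j < t → DrawnX (spoke j) (r , zigzag t true j) (suc r , rungpos (even j) j)
    spoke-drawn zero    lt = join
    spoke-drawn (suc j) lt rewrite spoke-B j = fwd (shell {suc j} (m∸n+n≡m lt) (rungpos-≥ (even (suc j)) (suc j)) (rungpos-≤ (even (suc j)) (suc j)))

    drawX-l : ∀ {i j i' j'} → i < s → j < t → j' < t → XStep s t d i j i' j' → DrawnX (colX i j) (place-l i j) (place-l i' j')
    drawX-l {i} {j} _ j<t _ (up lt) with row lt
    ... | row-b = transport (trans (colX-plain j ≤-refl) (out-r j))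
          (trans (place-plain j ≤-refl) (cong (λ b → r , zigzag t b j) r-even)) (place-b j) (spoke-drawn j j<t)
    ... | row-c = transport (colX-b j) (place-b j) (place-c j) (rung-drawn (even j) j)
    ... | row-plain le = transport (trans (colX-plain j (<⇒≤ le)) (out-< j le)) (place-plain j (<⇒≤ le)) (place-plain j le) (bridge (even i) refl)
      where
      bridge : ∀ b → even i ≡ b → DrawnX (if b then 1F else 0F) (i , zigzag t b j) (suc i , zigzag t (not b) j)
      bridge true  e = fwd (bridge-B e le (zigzag-sum true j<t))
      bridge false e = fwd (bridge-A e le (zigzag-sum false j<t))
    drawX-l {j = j} _ j<t _ (low refl lt) = transport (colX-c j) (place-c j) (place-plain (j + d) z≤n)
      (bwd (twst-low j<t refl lt (m∸n+n≡m lt) (rungpos-≥ (not (even j)) j) (rungpos-≤ (not (even j)) j)))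
    drawX-l {j = j} {j' = j'} _ j<t j'<t (high refl f) = transport (colX-c j) (place-c j) (place-plain j' z≤n)
      (bwd (twst-high j<t refl (subst (t ≤_) f (m≤n+m t j')) sum (rungpos-≥ (not (even j)) j) (rungpos-≤ (not (even j)) j)))
      where
      sum : t ∸ suc j' + suc (j + d) ≡ t + t
      sum = trans (cong (λ k → t ∸ suc j' + suc k) (sym f)) (trans (sym (+-assoc (t ∸ suc j') (suc j') t)) (cong (_+ t) (m∸n+n≡m j'<t)))

    -- The flag `u` says that the vertex in column `j` comes first on its rung. Only then is the
    -- edge long; otherwise it runs from offset `2j + 1` to `2j + 2`.
    rail-step : ∀ (rail : ℕ → Fin 5) u j → (u ≡ true → Inner (rail j) (j + j) (3 + (j + j))) →
                DrawnX (rail j) (suc r , rungpos u j) (suc r , rungpos (not u) (suc j))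
    rail-step rail true j long = subst (λ k → DrawnX (rail j) (suc r , j + j) (suc r , k)) (cong suc (sym (double-suc j)))
      (fwd (inner (long refl) (m<n+m (j + j) {3} z<s)))
    rail-step rail false j _ = subst (λ k → DrawnX (rail j) (suc r , suc (j + j)) (suc r , k)) (sym (double-suc j)) adjacent

    drawY-l : ∀ {i j j'} → i < s → j < t → YStep t j j' → DrawnX (colY i j) (place-l i j) (place-l i j')
    drawY-l {i} {j} i<s j<t ys with row i<s
    drawY-l {i} {j} i<s j<t (next lt) | row-plain le = transport refl (place-plain j le) (place-plain (suc j) le) (zigzag-step (even i) lt)
    drawY-l {i} {suc j} i<s j<t (last e) | row-plain le = transport (colY-plain (suc j) le) (place-plain (suc j) le) (place-plain 0 le) (wrapped (even i) e (plain-wrap le e))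
      where
      wrapped : ∀ {t c i e} b → suc (suc e) ≡ t → LChord c (i , 0) (i , suc e) → DrawnX c (i , zigzag t b (suc e)) (i , zigzag t b 0)
      wrapped false refl x = bwd x
      wrapped {e = e} true refl x rewrite n∸n≡0 e = fwd x
    drawY-l {i} {zero} i<s j<t (last e) | row-plain le = contradiction (subst (2 ≤_) (sym e) 2≤t) (n≮n 1)
    drawY-l {i} {j} i<s j<t (next lt) | row-b = transport (colY-b j) (place-b j) (place-b (suc j)) (rail-step railb (even j) j λ e → long-b e lt)
    drawY-l {i} {j} i<s j<t (next lt) | row-c = transport (colY-c j) (place-c j) (place-c (suc j)) (rail-step railc (not (even j)) j λ e → long-c (not-injective e) lt)
    drawY-l {i} {zero} i<s j<t (last e) | _ = contradiction (subst (2 ≤_) (sym e) 2≤t) (n≮n 1)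
    drawY-l {i} {suc j} i<s j<t (last e) | row-b = transport (colY-b (suc j)) (place-b (suc j)) (place-b 0) (bwd (inner (wrap-b e) (<-≤-trans z<s (rungpos-≥ (even (suc j)) (suc j)))))
    drawY-l {i} {suc j} i<s j<t (last e) | row-c = transport (colY-c (suc j)) (place-c (suc j)) (place-c 0)
      (bwd (inner (wrap-c e) (<-≤-trans (subst (1 <_) (sym (double-suc j)) (s≤s (s≤s z≤n))) (rungpos-≥ (not (even (suc j))) (suc j)))))

    ladder-layout : Layout s t d 5
    ladder-layout = record
      { width = t + t ; P = place-l ; P-bound = bound-l ; P-inj = inj-l ; cX = colX ; cY = colY ; proper = proper-l
      ; Chord = LChord ; chord-≺ = lchord-≺ ; uncrossed = luncrossed ; drawX = drawX-l ; drawY = drawY-l }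

-- The ladder over fibres of even length

y-parity : ∀ {t e j} → even t ≡ true → YStep t e j → even j ≡ not (even e)
y-parity _ (next _) = refl
y-parity et (last e) = trans (sym et) (cong even (sym e))

module _ {r t d : ℕ} (r-even : even r ≡ true) (t-even : even t ≡ true) (2≤t : 2 ≤ t) where
  open LadderRows r t d r-even 2≤t

  private
    rails : ℕ → Fin 5
    rails j = if even j then 3F else 4F

    alternating : ∀ {a b : Fin 5} → (∀ x → Distinct a b (if x then 3F else 4F) (if not x then 3F else 4F)) →
                  ∀ {e j} → YStep t e j → Distinct a b (rails e) (rails j)
    alternating h {e} ys rewrite y-parity t-even ys = h (even e)

    rails-last : ∀ {e} → suc e ≡ t → even e ≡ false
    rails-last eq = not-injective (trans (cong even eq) t-even)

  even-colouring : Colouring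
  even-colouring = record
    { spoke = λ _ → 1F
    -- Rungs join neighbours, so each may take whichever of A and C the twisted edge in its column
    -- leaves over.
    ; rung = λ j → if j + d <ᵇ t then 0F else 2F
    ; twst = λ j → if j + d <ᵇ t then 2F else 0F
    ; railb = rails ; railc = rails ; fibre = λ _ → rails
    ; proper-top = λ {b} _ _ _ ys → alternating (top (b + d <ᵇ t) (0 <ᵇ r)) ys
    ; proper-plain = λ _ ys → alternating (λ { true → _ ; false → _ }) ys
    ; proper-spoke = λ _ _ ys → alternating (λ { true → _ ; false → _ }) ys
    ; proper-b = λ {j} _ ys → alternating (b-row (j + d <ᵇ t)) ys
    ; proper-c = λ {j} _ ys → alternating (c-row (j + d <ᵇ t)) ys
    ; spoke-B = λ _ → refl
    ; plain-wrap = λ {i} {e} i≤r eq → subst (λ c → LChord c (i , 0) (i , suc e)) (cong (λ b → if b then 3F else 4F) (sym (rails-last eq))) (plain-E i≤r)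
    ; twst-low = λ {j} {o} {e} _ _ lt S a b → subst (λ c → LChord c (0 , o) (suc r , e)) (cong (λ b → if b then 2F else 0F) (sym (<ᵇ-true lt))) (outer-C lt S a b)
    ; twst-high = λ {j} {o} {e} _ _ le S a b → subst (λ c → LChord c (0 , o) (suc r , e)) (cong (λ b → if b then 2F else 0F) (sym (<ᵇ-false le))) (outer-A (inj₁ t-even) S a b)
    ; long-b = λ {j} ej lt → subst (λ c → Inner c (j + j) (3 + (j + j))) (cong (λ b → if b then 3F else 4F) (sym ej)) (long-D ej lt)
    ; long-c = λ {j} ej lt → subst (λ c → Inner c (j + j) (3 + (j + j))) (cong (λ b → if b then 3F else 4F) (sym ej)) (long-E ej lt)
    ; wrap-b = wrapb
    ; wrap-c = wrapc
    }
    where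
    top : ∀ a z x → Distinct {5} (if a then 2F else 0F) (if z then 1F else 1F) (if x then 3F else 4F) (if not x then 3F else 4F)
    top true  true  true  = _
    top true  true  false = _
    top true  false true  = _
    top true  false false = _
    top false true  true  = _
    top false true  false = _
    top false false true  = _
    top false false false = _
    b-row : ∀ a x → Distinct {5} 1F (if a then 0F else 2F) (if x then 3F else 4F) (if not x then 3F else 4F)
    b-row true  true  = _
    b-row true  false = _
    b-row false true  = _
    b-row false false = _
    c-row : ∀ a x → Distinct {5} (if a then 0F else 2F) (if a then 2F else 0F) (if x then 3F else 4F) (if not x then 3F else 4F)
    c-row true  true  = _
    c-row true  false = _
    c-row false true  = _
    c-row false false = _
    wrapb : ∀ {e} → suc e ≡ t → Inner (rails e) 0 (rungpos (even e) e)
    wrapb {e} eq rewrite rails-last eq = wrap-out t-even eq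
    wrapc : ∀ {e} → suc e ≡ t → Inner (rails e) 1 (rungpos (not (even e)) e)
    wrapc {e} eq rewrite rails-last eq = wrap-in t-even eq

  ladder-even : Layout (3 + r) t d 5
  ladder-even = WithColouring.ladder-layout even-colouring

-- The ladder over fibres of odd length at least five

-- For odd t no rail can alternate between two colours, so the ladder needs exceptional colours in its first two and
-- its last two columns.
data Column : Set where
  first second inner-even inner-odd penultimate final : Column

data Spec (t : ℕ) : ℕ → Column → Set where
  first : Spec t 0 first
  second : Spec t 1 second
  inner-even : ∀ {j} → even j ≡ true → 2 ≤ j → 3 + j ≤ t → Spec t j inner-even
  inner-odd : ∀ {j} → even j ≡ false → 2 ≤ j → 4 + j ≤ t → Spec t j inner-odd
  penultimate : ∀ {j} → 2 ≤ j → 2 + j ≡ t → Spec t j penultimate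
  final : ∀ {j} → 1 + j ≡ t → Spec t j final

-- The flag announces that the next column is the penultimate one. As kinds of columns follow each
-- other by a local rule, checking a rail reduces to finitely many transitions.
next-column : Bool → Column → Column
next-column _ first = second
next-column _ second = inner-even
next-column b inner-even = if b then penultimate else inner-odd
next-column _ inner-odd = inner-even
next-column _ penultimate = final
next-column _ final = final

column : ℕ → ℕ → Column
column t zero    = first
column t (suc j) = next-column (3 + j ≡ᵇ t) (column t j)

≡ᵇ-false : ∀ {m n} → (m ≡ᵇ n) ≡ false → m ≢ n
≡ᵇ-false {m} {n} eq refl with subst T eq (≡⇒≡ᵇ m m refl)
... | ()

≡ᵇ-true : ∀ {m n} → (m ≡ᵇ n) ≡ true → m ≡ n
≡ᵇ-true {m} {n} eq = ≡ᵇ⇒≡ m n (subst T (sym eq) _)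

module _ {t : ℕ} (5≤t : 5 ≤ t) (t-odd : even t ≡ false) where

  column-spec : ∀ j → j < t → Spec t j (column t j)
  column-spec zero    _  = first
  column-spec (suc j) lt with column t j | column-spec j (<-trans (n<1+n j) lt) | 3 + j ≡ᵇ t in eq
  ... | .first | first | _ = second
  ... | .second | second | _ = inner-even refl ≤-refl 5≤t
  ... | .inner-even | inner-even ej 2≤j _ | true = penultimate (m≤n⇒m≤1+n 2≤j) (≡ᵇ-true eq)
  ... | .inner-even | inner-even ej 2≤j le | false = inner-odd (cong not ej) (m≤n⇒m≤1+n 2≤j)
      -- The bound rises by two: the flag excludes `3 + j ≡ t`, and parity excludes `4 + j ≡ t`.
      (≤∧≢⇒< (≤∧≢⇒< le (≡ᵇ-false eq)) λ e → true≢false (trans (sym (trans (not-involutive _) (trans (not-involutive (even j)) ej))) (trans (cong even e) t-odd)))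
  ... | .inner-odd | inner-odd ej 2≤j le | _ = inner-even (cong not ej) (m≤n⇒m≤1+n 2≤j) le
  ... | .penultimate | penultimate _ e | _ = final e
  ... | .final | final e | _ = contradiction lt (≤⇒≯ (≤-reflexive (sym e)))

  column-final : ∀ {e} → suc e ≡ t → column t e ≡ final
  column-final {e} eq with column t e | column-spec e (≤-reflexive eq)
  ... | .first | first = contradiction (subst (5 ≤_) (sym eq) 5≤t) λ { (s≤s ()) }
  ... | .second | second = contradiction (subst (5 ≤_) (sym eq) 5≤t) λ { (s≤s (s≤s ())) }
  ... | .inner-even | inner-even _ _ le = contradiction (subst (3 + e ≤_) (sym eq) le) (<⇒≱ (s≤s (n<1+n (suc e))) ∘ m≤n⇒m≤1+n)
  ... | .inner-odd | inner-odd _ _ le = contradiction (subst (4 + e ≤_) (sym eq) le) (<⇒≱ (s≤s (n<1+n (suc e))) ∘ m≤n⇒m≤1+n ∘ ≤-trans (n≤1+n _))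
  ... | .penultimate | penultimate _ e' = contradiction (trans e' (sym eq)) (≢-sym (<⇒≢ (n<1+n (suc e))))
  ... | .final | final _ = refl

module OddLadder {r t d : ℕ} (r-even : even r ≡ true) (t-odd : even t ≡ false) (5≤t : 5 ≤ t) (d+2≤t : 2 + d ≤ t) (spoke₀ : Bool) where

  2≤t : 2 ≤ t
  2≤t = ≤-trans (s≤s (s≤s z≤n)) 5≤t

  open LadderRows r t d r-even 2≤t public

  -- This decides whether the twisted edge of column `t - 2` stays inside the fibre, since
  -- `t - 2 + d < t` means `d < 2`.
  small : Bool
  small = d <ᵇ 2

  -- The vertex b in column 0 already has B on its rung and A and D on its rail. Its spoke joins
  -- neighbours and takes C or E, whichever suits the fibre of row `r`.
  spokes : ℕ → Fin 5
  spokes zero    = if spoke₀ then 2F else 4F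
  spokes (suc _) = 1F

  -- `lo` tells that the twisted edge of the column does not wrap, and `h` stands for `small`.
  -- Columns 0 and 1 never wrap because `2 + d ≤ t`; the last column uses D, where its chord
  -- encloses the ladder.
  rung-col twst-col : Bool → Bool → Column → Fin 5
  rung-col lo h first       = 1F
  rung-col lo h second      = 3F
  rung-col lo h inner-even  = if lo then 0F else 2F
  rung-col lo h inner-odd   = if lo then 0F else 2F
  rung-col lo h penultimate = 4F
  rung-col lo h final       = if h then 2F else 0F
  twst-col lo h first       = 2F
  twst-col lo h second      = 2F
  twst-col lo h inner-even  = if lo then 2F else 0F
  twst-col lo h inner-odd   = if lo then 2F else 0F
  twst-col lo h penultimate = if h then 2F else 0F
  twst-col lo h final       = 3F

  -- Crossings constrain only the long edges, in even columns of b and odd columns of c, and the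
  -- closing ones, which must be D and E. All other rail edges join neighbours; that is how B can
  -- appear on rail c. In the penultimate column the rails take the one of A and C that its twisted
  -- edge does not use.
  railb-col railc-col : Bool → Column → Fin 5
  railb-col h first       = 0F
  railb-col h second      = 4F
  railb-col h inner-even  = 3F
  railb-col h inner-odd   = 4F
  railb-col h penultimate = if h then 0F else 2F
  railb-col h final       = 3F
  railc-col h first       = 0F
  railc-col h second      = 4F
  railc-col h inner-even  = 1F
  railc-col h inner-odd   = 4F
  railc-col h penultimate = if h then 0F else 2F
  railc-col h final       = 4F

  rungs twsts railsb railsc : ℕ → Fin 5
  rungs j  = rung-col (j + d <ᵇ t) small (column t j)
  twsts j  = twst-col (j + d <ᵇ t) small (column t j)
  railsb j = railb-col small (column t j)
  railsc j = railc-col small (column t j)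

  -- The colours depend on nothing but the kind of column, so evaluation settles each transition.
  b-next : ∀ {j k} → Spec t j k → suc j < t → ∀ x lo h →
           Distinct 1F (rung-col lo h (next-column x k)) (railb-col h k) (railb-col h (next-column x k))
  b-next first _ x lo h = _
  b-next second _ x true  h = _
  b-next second _ x false h = _
  b-next (inner-even _ _ _) _ true lo true = _
  b-next (inner-even _ _ _) _ true lo false = _
  b-next (inner-even _ _ _) _ false true  h = _
  b-next (inner-even _ _ _) _ false false h = _
  b-next (inner-odd _ _ _) _ x true  h = _
  b-next (inner-odd _ _ _) _ x false h = _
  b-next (penultimate _ _) _ x lo true = _
  b-next (penultimate _ _) _ x lo false = _
  b-next (final e) lt x lo h = contradiction e (<⇒≢ lt)

  c-next : ∀ {j k} → Spec t j k → suc j < t → ∀ x lo h →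
           Distinct (rung-col lo h (next-column x k)) (twst-col lo h (next-column x k)) (railc-col h k) (railc-col h (next-column x k))
  c-next first _ x lo h = _
  c-next second _ x true  h = _
  c-next second _ x false h = _
  c-next (inner-even _ _ _) _ true lo true = _
  c-next (inner-even _ _ _) _ true lo false = _
  c-next (inner-even _ _ _) _ false true  h = _
  c-next (inner-even _ _ _) _ false false h = _
  c-next (inner-odd _ _ _) _ x true  h = _
  c-next (inner-odd _ _ _) _ x false h = _
  c-next (penultimate _ _) _ x lo true = _
  c-next (penultimate _ _) _ x lo false = _
  c-next (final e) lt x lo h = contradiction e (<⇒≢ lt)

  proper-rail-b : ∀ {j e} → j < t → YStep t e j → Distinct (spokes j) (rungs j) (railsb e) (railsb j)
  proper-rail-b {e = e} j<t (next lt) = b-next (column-spec 5≤t t-odd e (<-trans (n<1+n e) lt)) lt (3 + e ≡ᵇ t) (suc e + d <ᵇ t) small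
  proper-rail-b {e = e} j<t (last eq) rewrite column-final 5≤t t-odd eq = lemma spoke₀
    where
    lemma : ∀ b → Distinct {5} (if b then 2F else 4F) 1F 3F 0F
    lemma true  = _
    lemma false = _

  proper-rail-c : ∀ {j e} → j < t → YStep t e j → Distinct (rungs j) (twsts j) (railsc e) (railsc j)
  proper-rail-c {e = e} j<t (next lt) = c-next (column-spec 5≤t t-odd e (<-trans (n<1+n e) lt)) lt (3 + e ≡ᵇ t) (suc e + d <ᵇ t) small
  proper-rail-c {e = e} j<t (last eq) rewrite column-final 5≤t t-odd eq = _

  data Twist (j : ℕ) : Fin 5 → Set where
    twist-D : suc j ≡ t → Twist j 3F
    twist-C : suc j < t → j + d < t → Twist j 2F
    twist-A : suc j < t → t ≤ j + d → 2 ≤ d → 2 ≤ j → Twist j 0F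

  inner-twist : ∀ {j} → 2 ≤ j → suc j < t → Twist j (if j + d <ᵇ t then 2F else 0F)
  inner-twist {j} 2≤j lt with j + d <? t
  ... | yes lo< rewrite <ᵇ-true lo< = twist-C lt lo<
  ... | no ¬lo< rewrite <ᵇ-false (≮⇒≥ ¬lo<) = twist-A lt (≮⇒≥ ¬lo<) (+-cancelˡ-≤ j 2 d (≤-trans (subst (_≤ t) (+-comm 2 j) lt) (≮⇒≥ ¬lo<))) 2≤j

  twist-view : ∀ j → j < t → Twist j (twsts j)
  twist-view j lt with column t j | column-spec 5≤t t-odd j lt
  ... | .first | first = twist-C 2≤t (≤-trans (n≤1+n _) d+2≤t)
  ... | .second | second = twist-C (≤-trans (s≤s (s≤s (s≤s z≤n))) 5≤t) d+2≤t
  ... | .final | final e = twist-D e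
  ... | .penultimate | penultimate 2≤j e with d <? 2
  ...   | yes d<2 rewrite <ᵇ-true d<2 = twist-C (≤-reflexive e) (subst (j + d <_) (trans (+-comm j 2) e) (+-monoʳ-< j d<2))
  ...   | no ¬d<2 rewrite <ᵇ-false (≮⇒≥ ¬d<2) = twist-A (≤-reflexive e) (subst (_≤ j + d) (trans (+-comm j 2) e) (+-monoʳ-≤ j (≮⇒≥ ¬d<2))) (≮⇒≥ ¬d<2) 2≤j
  twist-view j lt | .inner-even | inner-even _ 2≤j le = inner-twist 2≤j (≤-trans (n≤1+n _) le)
  twist-view j lt | .inner-odd | inner-odd _ 2≤j le = inner-twist 2≤j (≤-trans (n≤1+n _) (≤-trans (n≤1+n _) le))

  final-even : ∀ {j} → suc j ≡ t → even j ≡ true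
  final-even eq = not-injective (trans (cong even eq) t-odd)

  twist-drawn-D : ∀ {j o e} → suc j ≡ t → e ≡ rungpos (not (even j)) j → LChord 3F (0 , o) (suc r , e)
  twist-drawn-D {j} eq refl rewrite final-even eq = outer-D eq t-odd

  twst-low′ : ∀ {j o e} → j < t → e ≡ rungpos (not (even j)) j → j + d < t → o + suc (j + d) ≡ t → j + j ≤ e → e ≤ suc (j + j) → LChord (twsts j) (0 , o) (suc r , e)
  twst-low′ {j} lt p lo< S a b with twsts j | twist-view j lt
  ... | .3F | twist-D eq = twist-drawn-D eq p
  ... | .2F | twist-C _ _ = outer-C lo< S a b
  ... | .0F | twist-A _ hi≤ _ _ = contradiction lo< (≤⇒≯ hi≤)

  twst-high′ : ∀ {j o e} → j < t → e ≡ rungpos (not (even j)) j → t ≤ j + d → o + suc (j + d) ≡ t + t → j + j ≤ e → e ≤ suc (j + j) → LChord (twsts j) (0 , o) (suc r , e)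
  twst-high′ {j} lt p hi≤ S a b with twsts j | twist-view j lt
  ... | .3F | twist-D eq = twist-drawn-D eq p
  ... | .2F | twist-C _ lo< = contradiction lo< (≤⇒≯ hi≤)
  ... | .0F | twist-A _ _ 2≤d 2≤j = outer-A (inj₂ (2≤d , 2≤j)) S a b

  final-inner : ∀ {j} h → (d <ᵇ 2) ≡ h → 2 + j ≡ t → Inner (if h then 0F else 2F) (j + j) (3 + (j + j))
  final-inner true  eq e = final-A t-odd 5≤t (<ᵇ⇒< d 2 (subst T (sym eq) _)) e
  final-inner false eq e = final-C (≮⇒≥ λ lt → true≢false (trans (sym (<ᵇ-true lt)) eq)) e

  pen-odd : ∀ {j} → 2 + j ≡ t → even j ≡ false
  pen-odd {j} eq = trans (sym (not-involutive (even j))) (trans (cong even eq) t-odd)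

  long-b′ : ∀ {j} → even j ≡ true → suc j < t → Inner (railsb j) (j + j) (3 + (j + j))
  long-b′ {j} ej lt with column t j | column-spec 5≤t t-odd j (<-trans (n<1+n j) lt)
  ... | .first | first = first-A t-odd
  ... | .second | second = contradiction (sym ej) true≢false
  ... | .inner-even | inner-even _ _ _ = long-D ej lt
  ... | .inner-odd | inner-odd oj _ _ = contradiction (trans (sym ej) oj) true≢false
  ... | .penultimate | penultimate _ e = contradiction (trans (sym ej) (pen-odd e)) true≢false
  ... | .final | final e = contradiction e (<⇒≢ lt)

  long-c′ : ∀ {j} → even j ≡ false → suc j < t → Inner (railsc j) (j + j) (3 + (j + j))
  long-c′ {j} ej lt with column t j | column-spec 5≤t t-odd j (<-trans (n<1+n j) lt)
  ... | .first | first = contradiction ej true≢false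
  ... | .second | second = long-E ej lt
  ... | .inner-even | inner-even oj _ _ = contradiction (trans (sym oj) ej) true≢false
  ... | .inner-odd | inner-odd _ _ _ = long-E ej lt
  ... | .penultimate | penultimate _ e = final-inner small refl e
  ... | .final | final e = contradiction e (<⇒≢ lt)

  wrap-b′ : ∀ {e} → suc e ≡ t → Inner (railsb e) 0 (rungpos (even e) e)
  wrap-b′ {e} eq rewrite column-final 5≤t t-odd eq | final-even eq = wrap-D t-odd eq

  wrap-c′ : ∀ {e} → suc e ≡ t → Inner (railsc e) 1 (rungpos (not (even e)) e)
  wrap-c′ {e} eq rewrite column-final 5≤t t-odd eq | final-even eq = wrap-E t-odd eq

module _ {r t d : ℕ} (r-even : even r ≡ true) (t-odd : even t ≡ false) (5≤t : 5 ≤ t) (d+2≤t : 2 + d ≤ t) (d-odd : even d ≡ false) where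
  open OddLadder {r} {t} {d} r-even t-odd 5≤t d+2≤t true

  private
    1≤d : 1 ≤ d
    1≤d = n≢0⇒n>0 λ { refl → true≢false d-odd }

    -- Row 0 receives A before column `d - 1`, D in that column from the end of the ladder, and C
    -- afterwards. The fibre answers with D and C alternating before the switch, A and D after it,
    -- and E on the closing edge. Because `d` is odd, column `d - 1` lies between an edge of colour
    -- C and one of colour A, which leaves D free.
    row₀ rowᵢ : ℕ → Fin 5
    row₀ j = if suc j <ᵇ t then (if even j then (if suc j <ᵇ d then 3F else 0F) else (if j <ᵇ d then 2F else 3F)) else 4F
    rowᵢ j = if suc j <ᵇ t then (if even j then 3F else 2F) else 4F

    fibres : ℕ → ℕ → Fin 5
    fibres zero    = row₀
    fibres (suc _) = rowᵢ

    -- The colour of the twisted edge that arrives in column j.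
    arriving : ℕ → Fin 5
    arriving j = if suc j <ᵇ d then 0F else if j <ᵇ d then 3F else 2F

    column≡ : ∀ b j → j + suc b ≡ b + d → suc j ≡ d
    column≡ b j f = +-cancelˡ-≡ b (suc j) d (trans (trans (+-suc b j) (trans (cong suc (+-comm b j)) (sym (+-suc j b)))) f)

    column< : ∀ b j → suc b < t → j + t ≡ b + d → suc j < d
    column< b j lt f = +-cancelˡ-< b (suc j) d (subst (b + suc j <_) f (subst (_< j + t) (trans (+-comm j (suc b)) (sym (+-suc b j))) (+-monoʳ-< j lt)))

    arrival : ∀ {b j} → b < t → XStep (3 + r) t d (suc (suc r)) b 0 j → twsts b ≡ arriving j
    arrival {b} b<t (low _ lt) with twsts b | twist-view b b<t
    ... | .3F | twist-D eq = contradiction (subst (_≤ b + d) (trans (+-comm b 1) eq) (+-monoʳ-≤ b 1≤d)) (<⇒≱ lt)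
    ... | .2F | twist-C _ _ rewrite <ᵇ-false (m≤n⇒m≤1+n (m≤n+m d b)) | <ᵇ-false (m≤n+m d b) = refl
    ... | .0F | twist-A _ hi≤ _ _ = contradiction hi≤ (<⇒≱ lt)
    arrival {b} {j} b<t (high _ f) with twsts b | twist-view b b<t
    ... | .2F | twist-C _ lt = contradiction (subst (_< t) (sym f) lt) (m+n≮n j t)
    ... | .3F | twist-D refl rewrite <ᵇ-false (≤-reflexive (sym (column≡ b j f))) | <ᵇ-true (≤-reflexive (column≡ b j f)) = refl
    ... | .0F | twist-A lt _ _ _ rewrite <ᵇ-true (column< b j lt f) = refl

    first-next : ∀ {e} → suc e < t → Distinct (arriving (suc e)) 1F (row₀ e) (row₀ (suc e))
    first-next {e} lt with <-cmp (suc e) d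
    ... | tri> _ _ gt rewrite <ᵇ-true lt | <ᵇ-false (<⇒≤ gt) | <ᵇ-false (s≤s⁻¹ gt) | <ᵇ-false (m≤n⇒m≤1+n (<⇒≤ gt)) = lemma (even e) (suc (suc e) <ᵇ t)
      where
      lemma : ∀ x y → Distinct {5} 2F 1F (if x then 0F else 3F) (if y then (if not x then 0F else 3F) else 4F)
      lemma true  true  = _
      lemma true  false = _
      lemma false true  = _
      lemma false false = _
    ... | tri≈ _ refl _ rewrite <ᵇ-true lt | <ᵇ-true d+2≤t | <ᵇ-false (n≤1+n (suc e)) | <ᵇ-false (≤-refl {suc e}) | not-injective {even e} {true} d-odd = _
    first-next {e} lt | tri< lt' _ _ with m≤n⇒m<n∨m≡n lt'
    ... | inj₂ refl rewrite <ᵇ-true lt | <ᵇ-true (≤-trans (n≤1+n _) d+2≤t) | <ᵇ-true lt' | <ᵇ-true (<-trans (n<1+n e) lt') | <ᵇ-false (≤-refl {suc (suc e)}) | trans (sym (not-involutive (even e))) d-odd = _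
    ... | inj₁ lt″ rewrite <ᵇ-true lt | <ᵇ-true (<-≤-trans lt″ (≤-trans (m≤n+m d 2) d+2≤t)) | <ᵇ-true lt″ | <ᵇ-true lt' | <ᵇ-true (<-trans (n<1+n e) lt') = lemma (even e)
      where
      lemma : ∀ x → Distinct {5} 0F 1F (if x then 3F else 2F) (if not x then 3F else 2F)
      lemma true  = _
      lemma false = _

    first-last : ∀ {e} o → o ≡ 1F ⊎ o ≡ 2F → suc e ≡ t → Distinct (arriving 0) o (row₀ e) (row₀ 0)
    first-last {e} o oo eq rewrite <ᵇ-false (≤-reflexive (sym eq)) | <ᵇ-true 2≤t | <ᵇ-true 1≤d with 1 <ᵇ d | oo
    ... | true  | inj₁ refl = _
    ... | true  | inj₂ refl = _
    ... | false | inj₁ refl = _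
    ... | false | inj₂ refl = _

    inner-next : ∀ {e} → suc e < t → Distinct 0F 1F (rowᵢ e) (rowᵢ (suc e))
    inner-next {e = e} lt rewrite <ᵇ-true lt with even e | suc (suc e) <ᵇ t
    ... | true  | true  = _
    ... | true  | false = _
    ... | false | true  = _
    ... | false | false = _

    inner-last : ∀ {o e} → o ≡ 1F ⊎ o ≡ 2F → suc e ≡ t → Distinct 0F o (rowᵢ e) (rowᵢ 0)
    inner-last oo eq rewrite <ᵇ-false (≤-reflexive (sym eq)) | <ᵇ-true 2≤t with oo
    ... | inj₁ refl = _
    ... | inj₂ refl = _

  odd-colouring : Colouring
  odd-colouring = record
    { spoke = spokes ; rung = rungs ; twst = twsts ; railb = railsb ; railc = railsc ; fibre = fibres
    ; proper-top = top
    ; proper-plain = λ { _ (next lt) → inner-next lt ; _ (last eq) → inner-last (inj₁ refl) eq }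
    ; proper-spoke = λ { refl _ (next lt) → inner-next lt ; refl _ (last eq) → inner-last (inj₂ refl) eq }
    ; proper-b = proper-rail-b ; proper-c = proper-rail-c ; spoke-B = λ _ → refl
    ; plain-wrap = λ {i} {e} i≤r eq → subst (λ c → LChord c (i , 0) (i , suc e)) (sym (fibre-last i eq)) (plain-E i≤r)
    ; twst-low = twst-low′ ; twst-high = twst-high′ ; long-b = long-b′ ; long-c = long-c′ ; wrap-b = wrap-b′ ; wrap-c = wrap-c′
    }
    where
    fibre-last : ∀ i {e} → suc (suc e) ≡ t → fibres i (suc e) ≡ 4F
    fibre-last zero    eq rewrite <ᵇ-false (≤-reflexive (sym eq)) = refl
    fibre-last (suc i) eq rewrite <ᵇ-false (≤-reflexive (sym eq)) = refl
    top : ∀ {b j e} → b < t → XStep (3 + r) t d (suc (suc r)) b 0 j → j < t → YStep t e j →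
          Distinct (twsts b) (if 0 <ᵇ r then 1F else spokes j) (row₀ e) (row₀ j)
    top b<t xs _ (next lt) rewrite arrival b<t xs with 0 <ᵇ r
    ... | true  = first-next lt
    ... | false = first-next lt
    top b<t xs _ (last eq) rewrite arrival b<t xs with 0 <ᵇ r
    ... | true  = first-last 1F (inj₁ refl) eq
    ... | false = first-last 2F (inj₂ refl) eq

  ladder-odd : Layout (3 + r) t d 5
  ladder-odd = WithColouring.ladder-layout odd-colouring

module _ {r t : ℕ} (r-even : even r ≡ true) (t-odd : even t ≡ false) (5≤t : 5 ≤ t) where
  open OddLadder {r} {t} {0} r-even t-odd 5≤t (≤-trans (s≤s (s≤s z≤n)) 5≤t) false

  private
    -- With `d ≡ 0` no twisted edge wraps, so colour A has no outer chords and is available for the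
    -- closing edge of row 0. The other rows need A for bridges and close with C instead.
    fibres : ℕ → ℕ → Fin 5
    fibres i j = if suc j <ᵇ t then (if even j then 3F else 4F) else (if i ≡ᵇ 0 then 0F else 2F)

    arrival : ∀ {b j} → b < t → XStep (3 + r) t 0 (suc (suc r)) b 0 j → twsts b ≡ (if suc j <ᵇ t then 2F else 3F)
    arrival {b} b<t (low _ lt) with twsts b | twist-view b b<t
    ... | .3F | twist-D eq rewrite <ᵇ-false (≤-reflexive (trans (sym eq) (cong suc (sym (+-identityʳ b))))) = refl
    ... | .2F | twist-C lt' _ rewrite <ᵇ-true (subst (λ k → suc k < t) (sym (+-identityʳ b)) lt') = refl
    ... | .0F | twist-A _ _ () _
    arrival {b} {j} b<t (high _ f) = contradiction (subst (_< t) (trans (sym (+-identityʳ b)) (sym f)) b<t) (m+n≮n j t)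

    first-next : ∀ {e} → suc e < t → Distinct (if suc (suc e) <ᵇ t then 2F else 3F) 1F (fibres 0 e) (fibres 0 (suc e))
    first-next {e} lt rewrite <ᵇ-true lt with suc (suc e) <? t
    ... | yes lt' rewrite <ᵇ-true lt' with even e
    ...   | true  = _
    ...   | false = _
    first-next {e} lt | no ¬lt' rewrite <ᵇ-false (≮⇒≥ ¬lt') | pen-odd (≤-antisym lt (≮⇒≥ ¬lt')) = _

    first-last : ∀ {e} o → o ≡ 1F ⊎ o ≡ 4F → suc e ≡ t → Distinct (if 1 <ᵇ t then 2F else 3F) o (fibres 0 e) (fibres 0 0)
    first-last o oo eq rewrite <ᵇ-false (≤-reflexive (sym eq)) | <ᵇ-true 2≤t with oo
    ... | inj₁ refl = _
    ... | inj₂ refl = _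

    inner-next : ∀ {i e} → suc e < t → Distinct 0F 1F (fibres (suc i) e) (fibres (suc i) (suc e))
    inner-next {e = e} lt rewrite <ᵇ-true lt with even e | suc (suc e) <ᵇ t
    ... | true  | true  = _
    ... | true  | false = _
    ... | false | true  = _
    ... | false | false = _

    inner-last : ∀ {i o e} → o ≡ 1F ⊎ o ≡ 4F → suc e ≡ t → Distinct 0F o (fibres (suc i) e) (fibres (suc i) 0)
    inner-last oo eq rewrite <ᵇ-false (≤-reflexive (sym eq)) | <ᵇ-true 2≤t with oo
    ... | inj₁ refl = _
    ... | inj₂ refl = _

  untwisted-colouring : Colouring
  untwisted-colouring = record
    { spoke = spokes ; rung = rungs ; twst = twsts ; railb = railsb ; railc = railsc ; fibre = fibres
    ; proper-top = top
    ; proper-plain = λ { {i} _ (next lt) → inner-next {i} lt ; {i} _ (last eq) → inner-last {i} (inj₁ refl) eq }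
    ; proper-spoke = λ { {i} refl _ (next lt) → inner-next {i} lt ; {i} refl _ (last eq) → inner-last {i} (inj₂ refl) eq }
    ; proper-b = proper-rail-b ; proper-c = proper-rail-c ; spoke-B = λ _ → refl
    ; plain-wrap = wrapped
    ; twst-low = twst-low′ ; twst-high = twst-high′ ; long-b = long-b′ ; long-c = long-c′ ; wrap-b = wrap-b′ ; wrap-c = wrap-c′
    }
    where
    wrapped : ∀ {i e} → i ≤ r → suc (suc e) ≡ t → LChord (fibres i (suc e)) (i , 0) (i , suc e)
    wrapped {zero}  i≤r eq rewrite <ᵇ-false (≤-reflexive (sym eq)) = plain-A refl t-odd
    wrapped {suc i} i≤r eq rewrite <ᵇ-false (≤-reflexive (sym eq)) = plain-C z<s i≤r
    top : ∀ {b j e} → b < t → XStep (3 + r) t 0 (suc (suc r)) b 0 j → j < t → YStep t e j →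
          Distinct (twsts b) (if 0 <ᵇ r then 1F else spokes j) (fibres 0 e) (fibres 0 j)
    top b<t xs _ (next lt) rewrite arrival b<t xs with 0 <ᵇ r
    ... | true  = first-next lt
    ... | false = first-next lt
    top b<t xs _ (last eq) rewrite arrival b<t xs with 0 <ᵇ r
    ... | true  = first-last 1F (inj₁ refl) eq
    ... | false = first-last 4F (inj₂ refl) eq

  ladder-untwisted : Layout (3 + r) t 0 5
  ladder-untwisted = WithColouring.ladder-layout untwisted-colouring

-- Fibres of length three

-- For t = 3 and an odd number of rows the last row runs in the same direction as the one before it.  The colours of
-- the first row and of the last two, the latter indexed by d, were found by a computer search.
rung₃ twist₃ pen₃ last₃ : ℕ → ℕ → Fin 5
rung₃ 0 0 = 4F
rung₃ 0 1 = 0F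
rung₃ 0 _ = 3F
rung₃ 1 0 = 3F
rung₃ 1 1 = 2F
rung₃ 1 _ = 0F
rung₃ _ 0 = 4F
rung₃ _ 1 = 3F
rung₃ _ _ = 2F
twist₃ 0 0 = 2F
twist₃ 0 1 = 4F
twist₃ 0 _ = 0F
twist₃ 1 0 = 4F
twist₃ 1 1 = 4F
twist₃ 1 _ = 2F
twist₃ _ 0 = 0F
twist₃ _ 1 = 4F
twist₃ _ _ = 4F
pen₃ 0 0 = 3F
pen₃ 0 1 = 4F
pen₃ 0 _ = 2F
pen₃ 1 0 = 0F
pen₃ 1 1 = 3F
pen₃ 1 _ = 4F
pen₃ _ 0 = 2F
pen₃ _ 1 = 4F
pen₃ _ _ = 0F
last₃ 0 0 = 3F
last₃ 0 1 = 2F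
last₃ 1 0 = 0F
last₃ 1 1 = 3F
last₃ _ 0 = 2F
last₃ _ 1 = 0F
last₃ _ _ = 1F

first₃ inner₃ : ℕ → Fin 5
first₃ 0 = 0F
first₃ 1 = 2F
first₃ _ = 3F
inner₃ 0 = 3F
inner₃ 1 = 4F
inner₃ _ = 2F

prev₃ : ℕ → ℕ
prev₃ zero    = 2
prev₃ (suc j) = j

∀<3 : ∀ {P : ℕ → Set} (P? : Decidable P) → Dec (∀ {k} → k < 3 → P k)
∀<3 P? = allUpTo? P? 3

private
  distinct? : ∀ (a b c e : Fin 5) → Dec (T (distinct₄ a b c e))
  distinct? a b c e = T? (distinct₄ a b c e)

  top₃ : ∀ {d} → d < 3 → ∀ {b} → b < 3 → T (distinct₄ (twist₃ d b) 1F (first₃ (prev₃ ((b + d) % 3))) (first₃ ((b + d) % 3)))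
  top₃ = toWitness {a? = ∀<3 λ d → ∀<3 λ b → distinct? (twist₃ d b) 1F (first₃ (prev₃ ((b + d) % 3))) (first₃ ((b + d) % 3))} _

  middle₃ : ∀ {j} → j < 3 → T (distinct₄ 0F 1F (inner₃ (prev₃ j)) (inner₃ j))
  middle₃ = toWitness {a? = ∀<3 λ j → distinct? 0F 1F (inner₃ (prev₃ j)) (inner₃ j)} _

  penultimate₃ : ∀ {d} → d < 3 → ∀ {j} → j < 3 → T (distinct₄ 1F (rung₃ d j) (pen₃ d (prev₃ j)) (pen₃ d j))
  penultimate₃ = toWitness {a? = ∀<3 λ d → ∀<3 λ j → distinct? 1F (rung₃ d j) (pen₃ d (prev₃ j)) (pen₃ d j)} _

  bottom₃ : ∀ {d} → d < 3 → ∀ {j} → j < 3 → T (distinct₄ (rung₃ d j) (twist₃ d j) (last₃ d (prev₃ j)) (last₃ d j))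
  bottom₃ = toWitness {a? = ∀<3 λ d → ∀<3 λ j → distinct? (rung₃ d j) (twist₃ d j) (last₃ d (prev₃ j)) (last₃ d j)} _

  -- Parallel rows make the three rungs cross pairwise, so they must have three colours.
  rungs-distinct₃ : ∀ {d} → d < 3 → ∀ {j} → j < 3 → ∀ {k} → k < 3 → rung₃ d j ≡ rung₃ d k → j ≡ k
  rungs-distinct₃ = toWitness {a? = ∀<3 λ d → ∀<3 λ j → ∀<3 λ k → (rung₃ d j Fin.≟ rung₃ d k) →-dec (j ≟ k)} _

  -- A twisted edge starts far to the left of every rung and ends in the same row. It crosses a rung
  -- exactly when the rung ends further right.
  twist-rung₃ : ∀ {d} → d < 3 → ∀ {j} → j < 3 → ∀ {k} → k < 3 → twist₃ d j ≡ rung₃ d k → k ≤ j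
  twist-rung₃ = toWitness {a? = ∀<3 λ d → ∀<3 λ j → ∀<3 λ k → (twist₃ d j Fin.≟ rung₃ d k) →-dec (k ≤? j)} _

  -- The offset in the reversed row 0 is 2 minus the column of arrival, so this is nesting within
  -- each colour.
  twists-nested₃ : ∀ {d} → d < 3 → ∀ {j} → j < 3 → ∀ {k} → k < 3 → twist₃ d j ≡ twist₃ d k → j < k → 2 ∸ (k + d) % 3 ≤ 2 ∸ (j + d) % 3
  twists-nested₃ = toWitness {a? = ∀<3 λ d → ∀<3 λ j → ∀<3 λ k → (twist₃ d j Fin.≟ twist₃ d k) →-dec ((j <? k) →-dec (2 ∸ (k + d) % 3 ≤? 2 ∸ (j + d) % 3))} _

  rung≢B : ∀ {d} → d < 3 → ∀ {j} → j < 3 → 1F ≢ rung₃ d j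
  rung≢B = toWitness {a? = ∀<3 λ d → ∀<3 λ j → ¬? (1F Fin.≟ rung₃ d j)} _

  twist≢B : ∀ {d} → d < 3 → ∀ {j} → j < 3 → 1F ≢ twist₃ d j
  twist≢B = toWitness {a? = ∀<3 λ d → ∀<3 λ j → ¬? (1F Fin.≟ twist₃ d j)} _

  twist≢D : ∀ {d} → d < 3 → ∀ {j} → j < 3 → 3F ≢ twist₃ d j
  twist≢D = toWitness {a? = ∀<3 λ d → ∀<3 λ j → ¬? (3F Fin.≟ twist₃ d j)} _

  pen≢B : ∀ {d} → d < 3 → 1F ≢ pen₃ d 2
  pen≢B = toWitness {a? = ∀<3 λ d → ¬? (1F Fin.≟ pen₃ d 2)} _

  pen≢rung : ∀ {d} → d < 3 → ∀ {j} → j < 3 → pen₃ d 2 ≢ rung₃ d j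
  pen≢rung = toWitness {a? = ∀<3 λ d → ∀<3 λ j → ¬? (pen₃ d 2 Fin.≟ rung₃ d j)} _

  last-B : ∀ {d} → d < 3 → last₃ d 2 ≡ 1F
  last-B = toWitness {a? = ∀<3 λ d → last₃ d 2 Fin.≟ 1F} _

module Triangle (r d : ℕ) (r-even : even r ≡ true) (d<3 : d < 3) where
  open LadderRows r 3 d r-even (s≤s (s≤s z≤n)) using (s; Row; row-plain; row-b; row-c; row)

  data TChord : Fin 5 → Pos → Pos → Set where
    bridge-B : ∀ {i o e} → i ≤ r → even i ≡ true → suc (o + e) ≡ 3 → TChord 1F (i , o) (suc i , e)
    bridge-A : ∀ {i o e} → i < r → even i ≡ false → suc (o + e) ≡ 3 → TChord 0F (i , o) (suc i , e)
    rung     : ∀ {c k} → k < 3 → c ≡ rung₃ d k → TChord c (suc r , k) (suc (suc r) , k)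
    twist    : ∀ {c k} → k < 3 → c ≡ twist₃ d k → TChord c (0 , 2 ∸ (k + d) % 3) (suc (suc r) , k)
    wrap-first : TChord 3F (0 , 0) (0 , 2)
    wrap-inner : ∀ {i} → 0 < i → i ≤ r → TChord 2F (i , 0) (i , 2)
    wrap-pen   : ∀ {c} → c ≡ pen₃ d 2 → TChord c (suc r , 0) (suc r , 2)
    wrap-last  : TChord 1F (suc (suc r) , 0) (suc (suc r) , 2)

  tchord-≺ : ∀ {c p q} → TChord c p q → p ≺ q
  tchord-≺ (bridge-B _ _ _) = blk (n<1+n _)
  tchord-≺ (bridge-A _ _ _) = blk (n<1+n _)
  tchord-≺ (rung _ _) = blk (n<1+n _)
  tchord-≺ (twist _ _) = blk z<s
  tchord-≺ wrap-first = off z<s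
  tchord-≺ (wrap-inner _ _) = off z<s
  tchord-≺ (wrap-pen _) = off z<s
  tchord-≺ wrap-last = off z<s

  bridges₃ : ∀ {i i' o e o' e' b} → even i ≡ b → even i' ≡ b → suc (o + e) ≡ 3 → suc (o' + e') ≡ 3 →
            (i , o) ≺ (i' , o') → (i' , o') ≺ (suc i , e) → (suc i , e) ≺ (suc i' , e') → ⊥
  bridges₃ ei ei' _ _ (blk p) (blk q) _ = <⇒≱ p (s≤s⁻¹ q)
  bridges₃ ei ei' _ _ (blk p) (off q) _ = not-¬ refl (trans ei (sym ei'))
  bridges₃ ei ei' S S' (off p) _ (blk q) = n≮n _ q
  bridges₃ ei ei' S S' (off p) _ (off q) = sum-clash p q (suc-injective (trans S (sym S'))) refl

  up≥ : ∀ {a b x y} → a < b → ¬ ((b , x) ≺ (a , y))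
  up≥ lt p = <⇒≱ lt (block-≤ p)

  wraps : ∀ {a b x y z} → (a , 0) ≺ (b , 0) → (b , 0) ≺ (a , y) → (a , z) ≺ (b , x) → ⊥
  wraps p q _ with in-block p q
  wraps (blk p) q _ | refl = n≮n _ p
  wraps (off ()) q _ | refl

  tuncrossed : ∀ {c p q u w} → TChord c p q → TChord c u w → p ≺ u → u ≺ q → q ≺ w → ⊥
  tuncrossed (bridge-B _ e S) (bridge-B _ e' S') x y z = bridges₃ e e' S S' x y z
  tuncrossed (bridge-B _ _ _) (rung k< c) _ _ _ = rung≢B d<3 k< c
  tuncrossed (bridge-B _ _ _) (twist k< c) _ _ _ = twist≢B d<3 k< c
  tuncrossed (bridge-B _ _ _) (wrap-pen c) _ _ _ = pen≢B d<3 c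
  tuncrossed (bridge-B i≤r _ _) wrap-last _ y _ = up≥ (s≤s (s≤s i≤r)) y
  tuncrossed (bridge-A _ e S) (bridge-A _ e' S') x y z = bridges₃ e e' S S' x y z
  tuncrossed (bridge-A i<r _ _) (rung _ _) _ y _ = up≥ (s≤s i<r) y
  tuncrossed (bridge-A _ e _) (twist _ _) (off _) _ _ = true≢false e
  tuncrossed (bridge-A i<r _ _) (wrap-pen _) _ y _ = up≥ (s≤s i<r) y
  tuncrossed (rung k< c) (bridge-B _ _ _) _ _ _ = rung≢B d<3 k< c
  tuncrossed (rung _ _) (bridge-A i<r _ _) x _ _ = up≥ (m≤n⇒m≤1+n i<r) x
  tuncrossed (rung k< c) (rung k<' c') x _ z with rungs-distinct₃ d<3 k< k<' (trans (sym c) c')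
  ... | refl = ≺-irrefl x
  tuncrossed (rung _ _) (twist _ _) (blk ()) _ _
  tuncrossed (rung _ _) wrap-first (blk ()) _ _
  tuncrossed (rung _ _) (wrap-inner _ i≤r) x _ _ = up≥ (s≤s i≤r) x
  tuncrossed (rung _ _) (wrap-pen _) x _ z = up≥ (n<1+n _) z
  tuncrossed (rung k< c) wrap-last _ _ _ = rung≢B d<3 k< c
  tuncrossed (twist k< c) (bridge-B _ _ _) _ _ _ = twist≢B d<3 k< c
  tuncrossed (twist _ _) (bridge-A i<r _ _) _ _ z = up≥ (m≤n⇒m≤1+n (s≤s i<r)) z
  tuncrossed (twist k< c) (rung k<' c') _ _ z = <⇒≱ (off⁻¹ z) (twist-rung₃ d<3 k< k<' (trans (sym c) c'))
  tuncrossed (twist k< c) (twist k<' c') x _ z = <⇒≱ (off⁻¹ x) (twists-nested₃ d<3 k< k<' (trans (sym c) c') (off⁻¹ z))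
  tuncrossed (twist k< c) wrap-first _ _ (blk ())
  tuncrossed (twist _ _) (wrap-inner _ i≤r) _ _ z = up≥ (s≤s (m≤n⇒m≤1+n i≤r)) z
  tuncrossed (twist _ _) (wrap-pen _) _ _ z = up≥ (n<1+n _) z
  tuncrossed (twist k< c) wrap-last _ _ _ = twist≢B d<3 k< c
  tuncrossed wrap-first (rung _ _) _ (blk ()) _
  tuncrossed wrap-first (twist k< c) _ _ _ = twist≢D d<3 k< c
  tuncrossed wrap-first wrap-first (off ()) _ _
  tuncrossed wrap-first (wrap-pen _) _ (blk ()) _
  tuncrossed (wrap-inner _ i≤r) (rung _ _) _ y _ = up≥ (s≤s i≤r) y
  tuncrossed (wrap-inner 0<i _) (twist _ _) x _ _ = up≥ 0<i x
  tuncrossed (wrap-inner _ _) (wrap-inner _ _) x y z = wraps x y z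
  tuncrossed (wrap-inner _ i≤r) (wrap-pen _) _ y _ = up≥ (s≤s i≤r) y
  tuncrossed (wrap-pen c) (bridge-B _ _ _) _ _ _ = pen≢B d<3 c
  tuncrossed (wrap-pen _) (bridge-A i<r _ _) x _ _ = up≥ (m≤n⇒m≤1+n i<r) x
  tuncrossed (wrap-pen c) (rung k< c') _ _ _ = pen≢rung d<3 k< (trans (sym c) c')
  tuncrossed (wrap-pen _) (twist _ _) (blk ()) _ _
  tuncrossed (wrap-pen _) wrap-first (blk ()) _ _
  tuncrossed (wrap-pen _) (wrap-inner _ i≤r) x _ _ = up≥ (s≤s i≤r) x
  tuncrossed (wrap-pen _) (wrap-pen _) x y z = wraps x y z
  tuncrossed (wrap-pen c) wrap-last _ _ _ = pen≢B d<3 c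
  tuncrossed wrap-last (bridge-B i≤r _ _) x _ _ = up≥ (s≤s (m≤n⇒m≤1+n i≤r)) x
  tuncrossed wrap-last (rung k< c) _ _ _ = rung≢B d<3 k< c
  tuncrossed wrap-last (twist k< c) _ _ _ = twist≢B d<3 k< c
  tuncrossed wrap-last (wrap-pen c) _ _ _ = pen≢B d<3 c
  tuncrossed wrap-last wrap-last x y z = wraps x y z

  reversed : ℕ → Bool
  reversed i = even i ∧ (i <ᵇ suc (suc r))

  place-t : ℕ → ℕ → Pos
  place-t i j = i , zigzag 3 (reversed i) j

  colX colY : ℕ → ℕ → Fin 5
  colX i j = if i <ᵇ suc r then (if even i then 1F else 0F) else if i <ᵇ suc (suc r) then rung₃ d j else twist₃ d j
  colY zero    j = first₃ j
  colY (suc i) j = if i <ᵇ r then inner₃ j else if i <ᵇ suc r then pen₃ d j else last₃ d j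

  y-prev : ∀ {e j} → YStep 3 e j → e ≡ prev₃ j
  y-prev (next _) = refl
  y-prev (last refl) = refl

  x-target : ∀ {a b j} → j < 3 → XStep s 3 d a b 0 j → a ≡ suc (suc r) × j ≡ (b + d) % 3
  x-target _ (low eq lt) = suc-injective eq , sym (m<n⇒m%n≡m lt)
  x-target {j = j} j<3 (high eq f) = suc-injective eq , trans (sym (trans ([m+n]%n≡m%n j 3) (m<n⇒m%n≡m j<3))) (cong (_% 3) f)

  private
    below : ∀ i → i ≤ r → (i <ᵇ suc (suc r)) ≡ true
    below i le = <ᵇ-true (s≤s (m≤n⇒m≤1+n le))

    last-even : even (suc (suc r)) ≡ true
    last-even = trans (not-involutive _) r-even

    suc-r-odd : even (suc r) ≡ false
    suc-r-odd = cong not r-even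

  colX-b : ∀ j → colX (suc r) j ≡ rung₃ d j
  colX-b j rewrite <ᵇ-false (≤-refl {suc r}) | <ᵇ-true (n<1+n (suc r)) = refl
  colX-c : ∀ j → colX (suc (suc r)) j ≡ twist₃ d j
  colX-c j rewrite <ᵇ-false (n≤1+n (suc r)) | <ᵇ-false (≤-refl {suc (suc r)}) = refl
  colX-plain : ∀ {i} j → i ≤ r → colX i j ≡ (if even i then 1F else 0F)
  colX-plain j le rewrite <ᵇ-true (s≤s le) = refl
  colY-plain : ∀ {i} j → suc i ≤ r → colY (suc i) j ≡ inner₃ j
  colY-plain j le rewrite <ᵇ-true le = refl
  colY-b : ∀ j → colY (suc r) j ≡ pen₃ d j
  colY-b j rewrite <ᵇ-false (≤-refl {r}) | <ᵇ-true (n<1+n r) = refl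
  colY-c : ∀ j → colY (suc (suc r)) j ≡ last₃ d j
  colY-c j rewrite <ᵇ-false (n≤1+n r) | <ᵇ-false (≤-refl {suc r}) = refl

  recolour₄ : ∀ {a b c e a' b' c' e' : Fin 5} → a ≡ a' → b ≡ b' → c ≡ c' → e ≡ e' → T (distinct₄ a' b' c' e') → Distinct a b c e
  recolour₄ refl refl refl refl h .isDistinct = h

  proper-t : ∀ {a b i j e} → a < s → b < 3 → i < s → j < 3 → e < 3 → XStep s 3 d a b i j → YStep 3 e j →
             Distinct (colX a b) (colX i j) (colY i e) (colY i j)
  proper-t {b = b} {zero} {j} _ b<3 _ j<3 _ xs ys with x-target j<3 xs | y-prev ys
  ... | refl , refl | refl = recolour₄ (colX-c b) (colX-plain ((b + d) % 3) z≤n) refl refl (top₃ d<3 b<3)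
  proper-t {a} {i = suc _} {j} _ _ i<s j<3 _ (up lt) ys with row i<s | y-prev ys
  ... | row-b | refl = recolour₄ (trans (colX-plain j ≤-refl) (cong (λ b → if b then 1F else 0F) r-even)) (colX-b j) (colY-b _) (colY-b j) (penultimate₃ d<3 j<3)
  ... | row-c | refl = recolour₄ (colX-b j) (colX-c j) (colY-c _) (colY-c j) (bottom₃ d<3 j<3)
  ... | row-plain le | refl = alternate (even a) (colX-plain j (<⇒≤ le)) (colX-plain j le)
    where
    mid : Distinct 0F 1F (colY (suc a) (prev₃ j)) (colY (suc a) j)
    mid = recolour₄ refl refl (colY-plain _ le) (colY-plain j le) (middle₃ j<3)
    alternate : ∀ b {u v} → u ≡ (if b then 1F else 0F) → v ≡ (if not b then 1F else 0F) → Distinct u v (colY (suc a) (prev₃ j)) (colY (suc a) j)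
    alternate true refl refl = distinct-swap mid
    alternate false refl refl = mid

  place-plain : ∀ {i} j → i ≤ r → place-t i j ≡ (i , zigzag 3 (even i) j)
  place-plain {i} j le rewrite below i le with even i
  ... | true  = refl
  ... | false = refl

  place-b : ∀ j → place-t (suc r) j ≡ (suc r , j)
  place-b j rewrite suc-r-odd = refl

  place-c : ∀ j → place-t (suc (suc r)) j ≡ (suc (suc r) , j)
  place-c j rewrite <ᵇ-false (≤-refl {suc (suc r)}) | last-even = refl

  DrawnT : (Pos → Set) → Fin 5 → Pos → Pos → Set
  DrawnT Vx c = Drawn Vx (TChord c)

  transport₃ : ∀ {Vx c c' p p' q q'} → c ≡ c' → p ≡ p' → q ≡ q' → DrawnT Vx c' p' q' → DrawnT Vx c p q
  transport₃ refl refl refl x = x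

  drawX-t : ∀ {Vx i j i' j'} → i < s → j < 3 → j' < 3 → XStep s 3 d i j i' j' → DrawnT Vx (colX i j) (place-t i j) (place-t i' j')
  drawX-t {Vx} {i} {j} _ j<3 _ (up lt) with row lt
  ... | row-b = transport₃ (trans (colX-plain j ≤-refl) (cong (λ b → if b then 1F else 0F) r-even))
        (trans (place-plain j ≤-refl) (cong (λ b → r , zigzag 3 b j) r-even)) (place-b j) (fwd (bridge-B ≤-refl r-even (zigzag-sum true j<3)))
  ... | row-c = transport₃ (colX-b j) (place-b j) (place-c j) (fwd (rung j<3 refl))
  ... | row-plain le = transport₃ (colX-plain j (<⇒≤ le)) (place-plain j (<⇒≤ le)) (place-plain j le) (bridge (even i) refl)
    where
    bridge : ∀ b → even i ≡ b → DrawnT Vx (if b then 1F else 0F) (i , zigzag 3 b j) (suc i , zigzag 3 (not b) j)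
    bridge true  e = fwd (bridge-B (<⇒≤ le) e (zigzag-sum true j<3))
    bridge false e = fwd (bridge-A le e (zigzag-sum false j<3))
  drawX-t {Vx} {j = j} {j' = j'} _ j<3 j'<3 xs@(low _ _) = from-last (x-target j'<3 xs)
    where
    from-last : ∀ {i} → i ≡ suc (suc r) × j' ≡ (j + d) % 3 → DrawnT Vx (colX i j) (place-t i j) (place-t 0 j')
    from-last (refl , e) = transport₃ (colX-c j) (place-c j) (trans (place-plain j' z≤n) (cong (λ k → 0 , 2 ∸ k) e)) (bwd (twist j<3 refl))
  drawX-t {Vx} {j = j} {j' = j'} _ j<3 j'<3 xs@(high _ _) = from-last (x-target j'<3 xs)
    where
    from-last : ∀ {i} → i ≡ suc (suc r) × j' ≡ (j + d) % 3 → DrawnT Vx (colX i j) (place-t i j) (place-t 0 j')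
    from-last (refl , e) = transport₃ (colX-c j) (place-c j) (trans (place-plain j' z≤n) (cong (λ k → 0 , 2 ∸ k) e)) (bwd (twist j<3 refl))

  wrap₃ : ∀ {Vx c i} b → TChord c (i , 0) (i , 2) → DrawnT Vx c (i , zigzag 3 b 2) (i , zigzag 3 b 0)
  wrap₃ true  x = fwd x
  wrap₃ false x = bwd x

  drawY-t : ∀ {Vx i j j'} → i < s → j < 3 → YStep 3 j j' → DrawnT Vx (colY i j) (place-t i j) (place-t i j')
  drawY-t {i = i} _ _ (next lt) = zigzag-step (reversed i) lt
  drawY-t {i = zero} _ _ (last refl) = wrap₃ true wrap-first
  drawY-t {i = suc i} i<s _ (last refl) with row i<s
  ... | row-plain le = transport₃ (colY-plain 2 le) refl refl (wrap₃ (reversed (suc i)) (wrap-inner z<s le))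
  ... | row-b = transport₃ (colY-b 2) refl refl (wrap₃ (reversed (suc r)) (wrap-pen refl))
  ... | row-c = transport₃ (trans (colY-c 2) (last-B d<3)) refl refl (wrap₃ (reversed (suc (suc r))) wrap-last)

  triangle-layout : Layout s 3 d 5
  triangle-layout = record
    { width = 3 ; P = place-t ; P-bound = λ {i} _ → zigzag-bound (reversed i)
    ; P-inj = λ {i} _ p _ q eq → inj {i} p q eq
    ; cX = colX ; cY = colY ; proper = proper-t
    ; Chord = TChord ; chord-≺ = tchord-≺ ; uncrossed = tuncrossed ; drawX = drawX-t ; drawY = drawY-t }
    where
    inj : ∀ {i j i' j'} → j < 3 → j' < 3 → place-t i j ≡ place-t i' j' → i ≡ i' × j ≡ j'
    inj {i} p q eq with pair-≡ eq
    ... | refl , eq' = refl , zigzag-injective (reversed i) p q eq'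

-- Transversal cycles and their folding

even-* : ∀ m n → even (m * n) ≡ (even m ∨ even n)
even-* zero    n = refl
even-* (suc m) n = trans (even-+ n (m * n)) (trans (cong (λ b → not (even n xor b)) (even-* m n)) (lemma (even m) (even n)))
  where
  lemma : ∀ a b → not (b xor (a ∨ b)) ≡ (not a ∨ b)
  lemma true  true  = refl
  lemma true  false = refl
  lemma false true  = refl
  lemma false false = refl

-- The multiples `u * n` and `v * n` may be put on either side, which states a congruence without
-- subtraction.
mod-shift : ∀ n .{{_ : NonZero n}} a' a c u v → a' + v * n ≡ a + c + u * n → a' % n ≡ (a % n + c) % n
mod-shift n a' a c u v eq = trans (sym ([m+kn]%n≡m%n a' v n)) (trans (cong (_% n) eq) (trans ([m+kn]%n≡m%n (a + c) u n)
  (trans (%-distribˡ-+ a c n) (trans (cong (λ k → (k + c % n) % n) (sym (m%n%n≡m%n a n))) (sym (%-distribˡ-+ (a % n) c n))))))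

-- Both kinds of chords are nested among themselves, and the near ones occupy only blocks up to S.
data Nest (S S′ σ : ℕ) : Pos → Pos → Set where
  near : ∀ {a b x y} → a + b ≡ S → x + y ≡ σ → Nest S S′ σ (a , x) (b , y)
  far  : ∀ {a b x y} → S < a → S < b → a + b ≡ S′ → x + y ≡ σ → Nest S S′ σ (a , x) (b , y)

-- With both coordinate sums fixed, advancing one end in the lexicographic order moves the other one
-- back.
antitone : ∀ {a b c e x y z w S σ} → a + b ≡ S → c + e ≡ S → x + y ≡ σ → z + w ≡ σ → (a , x) ≺ (c , z) → (b , y) ≺ (e , w) → ⊥
antitone p p' q q' (blk l) m = <⇒≢ (+-mono-<-≤ l (block-≤ m)) (trans p (sym p'))
antitone p p' q q' (off l) (blk m) = <⇒≢ (+-monoʳ-< _ m) (trans p (sym p'))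
antitone p p' q q' (off l) (off m) = sum-clash l m q q'

nest-uncrossed : ∀ {S S′ σ p q r w} → Nest S S′ σ p q → Nest S S′ σ r w → p ≺ r → r ≺ q → q ≺ w → ⊥
nest-uncrossed (near p q) (near p' q') x _ z = antitone p p' q q' x z
nest-uncrossed (far _ _ p q) (far _ _ p' q') x _ z = antitone p p' q q' x z
nest-uncrossed (near p _) (far S<a _ _ _) _ y _ = <⇒≱ S<a (≤-trans (block-≤ y) (subst (_ ≤_) p (m≤n+m _ _)))
nest-uncrossed (far S<a _ _ _) (near p _) x _ _ = <⇒≱ S<a (≤-trans (block-≤ x) (subst (_ ≤_) p (m≤m+n _ _)))

nest-sym : ∀ {S S′ σ p q} → Nest S S′ σ p q → Nest S S′ σ q p
nest-sym (near {a} {b} {x} {y} p q) = near (trans (+-comm b a) p) (trans (+-comm y x) q)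
nest-sym (far {a} {b} {x} {y} l m p q) = far m l (trans (+-comm b a) p) (trans (+-comm y x) q)

-- The edges between the fibres form g = gcd t d cycles of length n = s t′.  Blocks are the cosets of the group they
-- generate; the fibre edges that leave a block advance by e along these cycles.  The cycles are folded by placing the
-- even blocks in increasing and the odd ones in decreasing order.
module Spiral {s t d g t′ d′ k u : ℕ} .{{_ : NonZero s}} .{{_ : NonZero g}} .{{_ : NonZero t′}} (t≡ : t ≡ t′ * g) (d≡ : d ≡ d′ * g)
  (inverse : k * d′ ≡ 1 + u * t′) (k<t′ : k < t′)
  (s-odd : even s ≡ false) (g-odd : even g ≡ false) (k-odd : even k ≡ false) (t′-even : even t′ ≡ true) where

  n e : ℕ
  n = s * t′
  e = s * k

  instance
    n≢0 : NonZero n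
    n≢0 = m*n≢0 s t′

  n-even : even n ≡ true
  n-even = trans (even-* s t′) (cong₂ _∨_ s-odd t′-even)

  e-odd : even e ≡ false
  e-odd = trans (even-* s k) (cong₂ _∨_ s-odd k-odd)

  e<n : e < n
  e<n = *-monoʳ-< s k<t′

  coset : ℕ → ℕ → ℕ
  coset i q = (i + e * q) % n

  coset-< : ∀ i q → coset i q < n
  coset-< i q = m%n<n (i + e * q) n

  coset-up : ∀ i q → coset (suc i) q ≡ (coset i q + 1) % n
  coset-up i q = mod-shift n (suc i + e * q) (i + e * q) 1 0 0 (lemma i (e * q) n)
    where
    lemma : ∀ i x n → suc i + x + 0 * n ≡ i + x + 1 + 0 * n
    lemma = solve-∀

  -- Since `k` inverts `d′` modulo `t′`, the shift adds `s` to `e * q` modulo `n`. This makes up for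
  -- the drop from row `s - 1` to row 0 and leaves an advance by one.
  coset-twist : ∀ i q q' w → suc i ≡ s → q' + w * t′ ≡ q + d′ → coset 0 q' ≡ (coset i q + 1) % n
  coset-twist i q q' w si eq = mod-shift n (0 + e * q') (i + e * q) 1 u (w * k) (begin
    s * k * q' + w * k * (s * t′)   ≡⟨ l₁ s k q' w t′ ⟩
    s * k * (q' + w * t′)           ≡⟨ cong (s * k *_) eq ⟩
    s * k * (q + d′)                ≡⟨ l₂ s k q d′ ⟩
    s * k * q + s * (k * d′)        ≡⟨ cong (λ z → s * k * q + s * z) inverse ⟩
    s * k * q + s * (1 + u * t′)    ≡⟨ l₃ (s * k * q) s u t′ ⟩
    s + s * k * q + u * (s * t′)    ≡⟨ cong (λ z → z + s * k * q + u * (s * t′)) (sym si) ⟩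
    suc i + s * k * q + u * (s * t′) ≡⟨ l₄ i (s * k * q) (u * (s * t′)) ⟩
    i + s * k * q + 1 + u * (s * t′) ∎)
    where
    open ≡-Reasoning
    l₁ : ∀ s k q w t → s * k * q + w * k * (s * t) ≡ s * k * (q + w * t)
    l₁ = solve-∀
    l₂ : ∀ s k q d → s * k * (q + d) ≡ s * k * q + s * (k * d)
    l₂ = solve-∀
    l₃ : ∀ x s u t → x + s * (1 + u * t) ≡ s + x + u * (s * t)
    l₃ = solve-∀
    l₄ : ∀ i x y → suc i + x + y ≡ i + x + 1 + y
    l₄ = solve-∀

  coset-right : ∀ i q → coset i (suc q) ≡ (coset i q + e) % n
  coset-right i q = mod-shift n (i + e * suc q) (i + e * q) e 0 0 (lemma i e q n)
    where
    lemma : ∀ i e q n → i + e * suc q + 0 * n ≡ i + e * q + e + 0 * n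
    lemma = solve-∀

  -- A full turn along the fibre adds `e * t′`, which is `k * n`.
  coset-around : ∀ i q → suc q ≡ t′ → coset i 0 ≡ (coset i q + e) % n
  coset-around i q eq = mod-shift n (i + e * 0) (i + e * q) e 0 k (trans (cong (λ z → i + e * 0 + k * (s * z)) (sym eq)) (lemma i s k q n))
    where
    lemma : ∀ i s k q n → i + s * k * 0 + k * (s * suc q) ≡ i + s * k * q + s * k + 0 * n
    lemma = solve-∀

  -- Both `e` and `n` are multiples of `s`, so the row survives as a residue modulo `s`.
  coset-row : ∀ i q → i < s → coset i q % s ≡ i
  coset-row i q i<s = trans (trans (sym ([m+kn]%n≡m%n (coset i q) ((i + e * q) / n * t′) s)) (cong (_% s) whole))
    (trans ([m+kn]%n≡m%n i (k * q) s) (m<n⇒m%n≡m i<s))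
    where
    whole : coset i q + (i + e * q) / n * t′ * s ≡ i + k * q * s
    whole = trans (lemma₁ (coset i q) ((i + e * q) / n) t′ s) (trans (sym (m≡m%n+[m/n]*n (i + e * q) n)) (lemma₂ i s k q))
      where
      lemma₁ : ∀ c a t s → c + a * t * s ≡ c + a * (s * t)
      lemma₁ = solve-∀
      lemma₂ : ∀ i s k q → i + s * k * q ≡ i + k * q * s
      lemma₂ = solve-∀

  -- Cancelling `i` and `s` leaves `k * q` and `k * q'` congruent modulo `t′`; multiplication by
  -- `d′` then undoes `k`.
  coset-column : ∀ i q q' → q < t′ → q' < t′ → coset i q ≡ coset i q' → q ≡ q'
  coset-column i q q' q< q'< eq = trans (sym (m<n⇒m%n≡m q<)) (trans (trans (sym ([m+kn]%n≡m%n q (u * q + B * d′) t′))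
      (trans (cong (_% t′) expanded) ([m+kn]%n≡m%n q' (u * q' + A * d′) t′))) (m<n⇒m%n≡m q'<))
    where
    open ≡-Reasoning
    A = (i + e * q) / n
    B = (i + e * q') / n
    l₀ : ∀ s k q B t → s * (k * q + B * t) ≡ s * k * q + B * (s * t)
    l₀ = solve-∀
    l₁ : ∀ i x y → i + (x + y) ≡ i + x + y
    l₁ = solve-∀
    l₂ : ∀ c x y → c + x + y ≡ c + y + x
    l₂ = solve-∀
    whole : i + e * q + B * n ≡ i + e * q' + A * n
    whole = begin
      i + e * q + B * n               ≡⟨ cong (_+ B * n) (m≡m%n+[m/n]*n (i + e * q) n) ⟩
      coset i q + A * n + B * n       ≡⟨ l₂ (coset i q) (A * n) (B * n) ⟩
      coset i q + B * n + A * n       ≡⟨ cong (λ z → z + B * n + A * n) eq ⟩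
      coset i q' + B * n + A * n      ≡⟨ cong (_+ A * n) (sym (m≡m%n+[m/n]*n (i + e * q') n)) ⟩
      i + e * q' + A * n ∎
    reduced : k * q + B * t′ ≡ k * q' + A * t′
    reduced = *-cancelˡ-≡ _ _ s (+-cancelˡ-≡ i _ _ (begin
      i + s * (k * q + B * t′)        ≡⟨ cong (i +_) (l₀ s k q B t′) ⟩
      i + (e * q + B * n)             ≡⟨ l₁ i (e * q) (B * n) ⟩
      i + e * q + B * n               ≡⟨ whole ⟩
      i + e * q' + A * n              ≡⟨ sym (l₁ i (e * q') (A * n)) ⟩
      i + (e * q' + A * n)            ≡⟨ cong (i +_) (sym (l₀ s k q' A t′)) ⟩
      i + s * (k * q' + A * t′)       ∎))
    expand : ∀ q B → q + (u * q + B * d′) * t′ ≡ (k * q + B * t′) * d′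
    expand q B = begin
      q + (u * q + B * d′) * t′       ≡⟨ l₃ q u B d′ t′ ⟩
      (1 + u * t′) * q + B * t′ * d′  ≡⟨ cong (λ z → z * q + B * t′ * d′) (sym inverse) ⟩
      k * d′ * q + B * t′ * d′        ≡⟨ l₄ k d′ q B t′ ⟩
      (k * q + B * t′) * d′           ∎
      where
      l₃ : ∀ q u B d t → q + (u * q + B * d) * t ≡ (1 + u * t) * q + B * t * d
      l₃ = solve-∀
      l₄ : ∀ k d q B t → k * d * q + B * t * d ≡ (k * q + B * t) * d
      l₄ = solve-∀
    expanded : q + (u * q + B * d′) * t′ ≡ q' + (u * q' + A * d′) * t′
    expanded = trans (expand q B) (trans (cong (_* d′) reduced) (sym (expand q' A)))

  -- As `n` is even, `n ∸ x` keeps the parity of `x`, so even and odd cosets occupy disjoint blocks.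
  -- Reversing the offsets of the odd ones gives the edges along the cycles a constant sum of
  -- offsets.
  fold : ℕ → ℕ → Pos
  fold x r = if even x then (x , r) else (n ∸ x , g ∸ suc r)

  place-s : ℕ → ℕ → Pos
  place-s i j = fold (coset i (j / g)) (j % g)

  colX colY : ℕ → ℕ → Fin 4
  colX i j = if even (coset i (j / g)) then 0F else 1F
  colY i j = if even (coset i (j / g) + j % g) then 2F else 3F

  -- The block sums are read off from `fold`. Steps by one give `n - 1` from even cosets and `n + 1`
  -- from odd ones, or 1 for the step that closes the cycle. Steps by `e` give `n - e` and `n + e`,
  -- or `2n - e` and `e` once they pass `n`. The second sum 0 of colour 0F is out of reach, so that
  -- colour has near chords only.
  family : Fin 4 → Pos → Pos → Set
  family 0F = Nest (n ∸ 1) 0 (g ∸ 1)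
  family 1F = Nest 1 (suc n) (g ∸ 1)
  family 2F = Nest (n ∸ e) (n + n ∸ e) (g ∸ 1 + (g ∸ 1))
  family 3F = Nest e (n + e) 0

  Chordˢ : Fin 4 → Pos → Pos → Set
  Chordˢ c p q = p ≺ q × family c p q

  family-uncrossed : ∀ c {p q r w} → family c p q → family c r w → p ≺ r → r ≺ q → q ≺ w → ⊥
  family-uncrossed 0F = nest-uncrossed
  family-uncrossed 1F = nest-uncrossed
  family-uncrossed 2F = nest-uncrossed
  family-uncrossed 3F = nest-uncrossed

  family-sym : ∀ c {p q} → family c p q → family c q p
  family-sym 0F = nest-sym
  family-sym 1F = nest-sym
  family-sym 2F = nest-sym
  family-sym 3F = nest-sym

  drawn : ∀ {Vx} c {p q} → family c p q → p ≢ q → Drawn Vx (Chordˢ c) p q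
  drawn c {p} {q} f ne with ≺-cmp p q
  ... | inj₁ lt = fwd (lt , f)
  ... | inj₂ (inj₁ eq) = contradiction eq ne
  ... | inj₂ (inj₂ gt) = bwd (gt , family-sym c f)

  even-mod : ∀ x → even (x % n) ≡ even x
  even-mod x = sym (trans (cong even (m≡m%n+[m/n]*n x n)) (trans (even-+ (x % n) (x / n * n))
    (trans (cong (λ b → not (even (x % n) xor b)) (trans (even-* (x / n) n) (trans (cong (even (x / n) ∨_) n-even) (absorb (even (x / n)))))) (lemma (even (x % n))))))
    where
    absorb : ∀ b → b ∨ true ≡ true
    absorb true  = refl
    absorb false = refl
    lemma : ∀ b → not (b xor true) ≡ b
    lemma true  = refl
    lemma false = refl

  even-+-odd : ∀ x {y} → even y ≡ false → even (x + y) ≡ not (even x)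
  even-+-odd x {y} oy = trans (even-+ x y) (trans (cong (λ b → not (even x xor b)) oy) (lemma (even x)))
    where
    lemma : ∀ b → not (b xor false) ≡ not b
    lemma true  = refl
    lemma false = refl

  even-+-even : ∀ x {y} → even y ≡ true → even (x + y) ≡ even x
  even-+-even x {y} ey = trans (even-+ x y) (trans (cong (λ b → not (even x xor b)) ey) (lemma (even x)))
    where
    lemma : ∀ b → not (b xor true) ≡ b
    lemma true  = refl
    lemma false = refl

  even-∸ : ∀ {x} → x ≤ n → even (n ∸ x) ≡ even x
  even-∸ {x} x≤n = lemma (even (n ∸ x)) (even x) (trans (sym (even-+ (n ∸ x) x)) (trans (cong even (m∸n+n≡m x≤n)) n-even))
    where
    lemma : ∀ a b → not (a xor b) ≡ true → a ≡ b
    lemma true  true  _ = refl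
    lemma false false _ = refl

  fold-injective : ∀ {x x' r r'} → x < n → x' < n → r < g → r' < g → fold x r ≡ fold x' r' → x ≡ x' × r ≡ r'
  fold-injective {x} {x'} x< x'< r< r'< eq with even x in ex | even x' in ex'
  ... | true  | true  = pair-≡ eq
  ... | false | false = ∸-cancelˡ-≡ (<⇒≤ x<) (<⇒≤ x'<) (proj₁ (pair-≡ eq)) , suc-injective (∸-cancelˡ-≡ r< r'< (proj₂ (pair-≡ eq)))
  ... | true  | false = contradiction (trans (sym ex) (trans (cong even (proj₁ (pair-≡ eq))) (trans (even-∸ (<⇒≤ x'<)) ex'))) true≢false
  ... | false | true  = contradiction (trans (sym ex') (trans (cong even (sym (proj₁ (pair-≡ eq)))) (trans (even-∸ (<⇒≤ x<)) ex))) true≢false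

  fold-≢ : ∀ {x x' r r'} → x < n → x' < n → r < g → r' < g → even x' ≡ not (even x) → fold x r ≢ fold x' r'
  fold-≢ x< x'< r< r'< par eq with fold-injective x< x'< r< r'< eq
  ... | refl , _ = not-¬ refl par

  fold-even : ∀ {x} r → even x ≡ true → fold x r ≡ (x , r)
  fold-even r e rewrite e = refl

  fold-odd : ∀ {x} r → even x ≡ false → fold x r ≡ (n ∸ x , g ∸ suc r)
  fold-odd r e rewrite e = refl

  offsets : ∀ {r} → r < g → r + (g ∸ suc r) ≡ g ∸ 1
  offsets {r} lt = cong (_∸ 1) (m+[n∸m]≡n lt)

  wrap-mod : ∀ {x c} → x < n → c ≤ n → n ≤ x + c → (x + c) % n + n ≡ x + c
  wrap-mod {x} {c} x< c≤ ge = trans (cong (_+ n) (trans (sym (m≤n⇒[n∸m]%m≡n%m ge)) (m<n⇒m%n≡m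
    (+-cancelʳ-< n _ _ (subst (_< n + n) (sym (m∸n+n≡m ge)) (+-mono-<-≤ x< c≤)))))) (m∸n+n≡m ge)

  odd-pos : ∀ {x} → even x ≡ false → 0 < x
  odd-pos {suc x} _ = z<s

  family-x : ∀ {x r} → x < n → r < g → family (if even x then 0F else 1F) (fold x r) (fold ((x + 1) % n) r)
  family-x {x} {r} x< r< = cases (even x) refl
    where
    parity′ : even ((x + 1) % n) ≡ not (even x)
    parity′ = trans (even-mod (x + 1)) (even-+-odd x {1} refl)
    small-step : suc x < n → (x + 1) % n ≡ suc x
    small-step lt = trans (cong (_% n) (+-comm x 1)) (m<n⇒m%n≡m lt)
    cases : ∀ b → even x ≡ b → family (if b then 0F else 1F) (fold x r) (fold ((x + 1) % n) r)
    cases true ex = subst₂ (family 0F) (sym (fold-even r ex)) (sym (trans (fold-odd r (trans parity′ (cong not ex))) (cong (λ z → n ∸ z , g ∸ suc r) (small-step lt))))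
        (near (cong (_∸ 1) (m+[n∸m]≡n x<)) (offsets r<))
      where
      -- An even `x` is not the last coset, because `n` is even.
      lt : suc x < n
      lt = ≤∧≢⇒< x< λ { eq → true≢false (trans (sym n-even) (trans (cong even (sym eq)) (cong not ex))) }
    cases false ex with m≤n⇒m<n∨m≡n x<
    ... | inj₁ lt = subst₂ (family 1F) (sym (fold-odd r ex)) (sym (trans (fold-even r (trans parity′ (cong not ex))) (cong (_, r) (small-step lt))))
        (far (m+n≤o⇒m≤o∸n 2 lt) (s≤s (odd-pos ex)) (trans (+-suc (n ∸ x) x) (cong suc (m∸n+n≡m (<⇒≤ x<)))) (trans (+-comm _ r) (offsets r<)))
    ... | inj₂ eq = subst₂ (family 1F) (sym (fold-odd r ex)) (sym (trans (fold-even r (trans parity′ (cong not ex))) (cong (_, r) around)))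
        (near (trans (+-identityʳ _) (trans (cong (_∸ x) (sym eq)) (m+n∸n≡m 1 x))) (trans (+-comm _ r) (offsets r<)))
      where
      around : (x + 1) % n ≡ 0
      around = trans (cong (_% n) (trans (+-comm x 1) eq)) (n%n≡0 n)

  family-y : ∀ {x r} → x < n → suc r ≡ g → family (if even x then 2F else 3F) (fold x r) (fold ((x + e) % n) 0)
  family-y {x} {r} x< rg = cases (even x) refl
    where
    x' = (x + e) % n
    parity′ : even x' ≡ not (even x)
    parity′ = trans (even-mod (x + e)) (even-+-odd x e-odd)
    r≡ : r ≡ g ∸ 1
    r≡ = cong (_∸ 1) rg
    1≤x : even x ≡ false → 1 ≤ x
    1≤x = odd-pos
    wrapped : n ≤ x + e → x' + n ≡ x + e
    wrapped = wrap-mod x< (<⇒≤ e<n)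
    x'<e : n ≤ x + e → x' < e
    x'<e ge = +-cancelʳ-< n x' e (subst (_< e + n) (sym (wrapped ge)) (subst (x + e <_) (+-comm n e) (+-monoˡ-< e x<)))
    cases : ∀ b → even x ≡ b → family (if b then 2F else 3F) (fold x r) (fold x' 0)
    cases true ex = subst₂ (family 2F) (sym (fold-even r ex)) (sym (fold-odd 0 (trans parity′ (cong not ex)))) (split (x + e <? n))
      where
      split : Dec (x + e < n) → family 2F (x , r) (n ∸ x' , g ∸ 1)
      split (yes lt) = near (+-cancelʳ-≡ e _ _ (trans (cong (λ z → x + (n ∸ z) + e) (m<n⇒m%n≡m lt)) (trans (swap₁ x (n ∸ (x + e)) e) (trans (m∸n+n≡m (<⇒≤ lt)) (sym (m∸n+n≡m (<⇒≤ e<n))))))) (cong (_+ (g ∸ 1)) r≡)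
        where
        swap₁ : ∀ x m e → x + m + e ≡ m + (x + e)
        swap₁ = solve-∀
      -- The inequality is strict by parity: equality would make the even `x` equal to the odd
      -- number `n - e`.
      split (no ¬lt) = far (≤∧≢⇒< (m≤n+o⇒m∸n≤o n e (subst (n ≤_) (+-comm x e) (≮⇒≥ ¬lt))) λ eq → true≢false (trans (sym ex) (trans (cong even (sym eq)) (trans (even-∸ (<⇒≤ e<n)) e-odd))))
          (∸-monoʳ-< (x'<e (≮⇒≥ ¬lt)) (<⇒≤ e<n))
          (trans (sym (m+n∸n≡m (x + (n ∸ x')) e)) (cong (_∸ e) (trans (swap₂ x (n ∸ x') e) (trans (cong (_+ (n ∸ x')) (sym (wrapped (≮⇒≥ ¬lt)))) (trans (swap₃ x' n (n ∸ x')) (cong (_+ n) (m∸n+n≡m (<⇒≤ (m%n<n (x + e) n)))))))))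
          (cong (_+ (g ∸ 1)) r≡)
        where
        swap₂ : ∀ x m e → x + m + e ≡ x + e + m
        swap₂ = solve-∀
        swap₃ : ∀ a b c → a + b + c ≡ c + a + b
        swap₃ = solve-∀
    cases false ex = subst₂ (family 3F) (sym (trans (fold-odd r ex) (cong (λ z → n ∸ x , z) (trans (cong (g ∸_) rg) (n∸n≡0 g))))) (sym (fold-even 0 (trans parity′ (cong not ex)))) (split (x + e <? n))
      where
      split : Dec (x + e < n) → family 3F (n ∸ x , 0) (x' , 0)
      split (yes lt) rewrite m<n⇒m%n≡m lt = far (m+n≤o⇒m≤o∸n (suc e) (subst (_< n) (+-comm x e) lt)) (m<n+m e (1≤x ex))
        (trans (sym (+-assoc (n ∸ x) x e)) (cong (_+ e) (m∸n+n≡m (<⇒≤ x<)))) refl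
      split (no ¬lt) = near (+-cancelʳ-≡ n _ _ (trans (+-assoc (n ∸ x) x' n) (trans (cong (n ∸ x +_) (wrapped (≮⇒≥ ¬lt))) (trans (sym (+-assoc (n ∸ x) x e)) (trans (cong (_+ e) (m∸n+n≡m (<⇒≤ x<))) (+-comm n e)))))) refl

  column-div : ∀ r q → r < g → (r + q * g) % g ≡ r × (r + q * g) / g ≡ q
  column-div r q r<g = trans ([m+kn]%n≡m%n r q g) (m<n⇒m%n≡m r<g) ,
    trans (+-distrib-/-∣ʳ r (divides q refl)) (cong₂ _+_ (m<n⇒m/n≡0 r<g) (m*n/n≡m q g))

  column-split : ∀ j → j ≡ j % g + j / g * g
  column-split j = m≡m%n+[m/n]*n j g

  j/g<t′ : ∀ {j} → j < t → j / g < t′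
  j/g<t′ {j} lt = m<n*o⇒m/o<n (subst (j <_) t≡ lt)

  data Rightwards (i j j' : ℕ) : Set where
    inside : j' / g ≡ j / g → j' % g ≡ suc (j % g) → Rightwards i j j'
    across : suc (j % g) ≡ g → j' % g ≡ 0 → coset i (j' / g) ≡ (coset i (j / g) + e) % n → Rightwards i j j'

  rightwards : ∀ i {j j'} → j < t → YStep t j j' → Rightwards i j j'
  rightwards i {j} lt step with suc (j % g) <? g
  rightwards i {j} lt (next _) | yes lt' = inside (proj₂ c) (proj₁ c)
    where
    c : (suc j) % g ≡ suc (j % g) × suc j / g ≡ j / g
    c = subst (λ z → z % g ≡ suc (j % g) × z / g ≡ j / g) (cong suc (sym (column-split j))) (column-div (suc (j % g)) (j / g) lt')
  rightwards i {j} lt (last eq) | yes lt' = contradiction (trans (sym (proj₁ (column-div (suc (j % g)) (j / g) lt')))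
      (trans (cong (_% g) (trans (cong suc (sym (column-split j))) (trans eq t≡))) (m*n%n≡0 t′ g))) 1+n≢0
  rightwards i {j} lt step | no ¬lt' = turn step
    where
    rg : suc (j % g) ≡ g
    rg = ≤-antisym (m%n<n j g) (≮⇒≥ ¬lt')
    sj : suc j ≡ suc (j / g) * g
    sj = trans (cong suc (column-split j)) (cong (_+ j / g * g) rg)
    turn : ∀ {j'} → YStep t j j' → Rightwards i j j'
    turn (next _) = across rg (proj₁ c) (trans (cong (coset i) (proj₂ c)) (coset-right i (j / g)))
      where
      c : suc j % g ≡ 0 × suc j / g ≡ suc (j / g)
      c = subst (λ z → z % g ≡ 0 × z / g ≡ suc (j / g)) (sym sj) (column-div 0 (suc (j / g)) (>-nonZero⁻¹ g))
    turn (last eq) = across rg (proj₁ c) (trans (cong (coset i) (proj₂ c)) (coset-around i (j / g) (*-cancelʳ-≡ _ _ g (trans (sym sj) (trans eq t≡)))))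
      where
      c : 0 % g ≡ 0 × 0 / g ≡ 0
      c = column-div 0 0 (>-nonZero⁻¹ g)

  same-column : ∀ {a b q q'} → a < g → b < g → a + q * g ≡ b + q' * g → a ≡ b × q ≡ q'
  same-column {a} {b} {q} {q'} a< b< eq =
    trans (sym (proj₁ (column-div a q a<))) (trans (cong (_% g) eq) (proj₁ (column-div b q' b<))) ,
    trans (sym (proj₂ (column-div a q a<))) (trans (cong (_/ g) eq) (proj₂ (column-div b q' b<)))

  shifted : ∀ j → j + d ≡ j % g + (j / g + d′) * g
  shifted j = trans (cong₂ _+_ (column-split j) d≡) (lemma (j % g) (j / g) d′ g)
    where
    lemma : ∀ r q d g → r + q * g + d * g ≡ r + (q + d) * g
    lemma = solve-∀

  upwards : ∀ {i j i' j'} → XStep s t d i j i' j' → j' % g ≡ j % g × coset i' (j' / g) ≡ (coset i (j / g) + 1) % n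
  upwards {i} {j} (up _) = refl , coset-up i (j / g)
  upwards {i} {j} (low si _) = proj₁ c , coset-twist i (j / g) ((j + d) / g) 0 si (trans (+-identityʳ _) (proj₂ c))
    where
    c : (j + d) % g ≡ j % g × (j + d) / g ≡ j / g + d′
    c = subst (λ z → z % g ≡ j % g × z / g ≡ j / g + d′) (sym (shifted j)) (column-div (j % g) (j / g + d′) (m%n<n j g))
  upwards {i} {j} {j' = j'} (high si eq) = proj₁ c , coset-twist i (j / g) (j' / g) 1 si (trans (cong (j' / g +_) (*-identityˡ t′)) (proj₂ c))
    where
    c : j' % g ≡ j % g × j' / g + t′ ≡ j / g + d′
    c = same-column {q = j' / g + t′} {j / g + d′} (m%n<n j' g) (m%n<n j g) (trans (sym (trans (cong₂ _+_ (column-split j') t≡) (lemma (j' % g) (j' / g) t′ g))) (trans eq (shifted j)))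
      where
      lemma : ∀ r q d g → r + q * g + d * g ≡ r + (q + d) * g
      lemma = solve-∀

  block : ℕ → ℕ → ℕ
  block i j = coset i (j / g)

  x-parity : ∀ {i j i' j'} → XStep s t d i j i' j' → even (block i' j') ≡ not (even (block i j))
  x-parity {i} {j} xs = trans (cong even (proj₂ (upwards xs))) (trans (even-mod _) (even-+-odd (block i j) {1} refl))

  -- Fibre edges leave a block at offset `g - 1`. Its evenness makes their colour depend on the
  -- coset alone.
  g-1-even : ∀ {r} → suc r ≡ g → even r ≡ true
  g-1-even eq = not-injective (trans (cong even eq) g-odd)

  y-parity′ : ∀ i {j j'} → j < t → YStep t j j' → even (block i j' + j' % g) ≡ not (even (block i j + j % g))
  y-parity′ i {j} {j'} lt ys with rightwards i lt ys
  ... | inside q r = trans (cong₂ (λ a b → even (coset i a + b)) q r) (cong even (+-suc (block i j) (j % g)))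
  ... | across rg z c = trans (cong₂ (λ a b → even (a + b)) c z) (trans (cong even (+-identityʳ ((block i j + e) % n)))
        (trans (even-mod (block i j + e)) (trans (even-+-odd (block i j) e-odd) (cong not (sym (even-+-even (block i j) (g-1-even rg)))))))

  proper-s : ∀ {a b i j f} → a < s → b < t → i < s → j < t → f < t → XStep s t d a b i j → YStep t f j →
             Distinct (colX a b) (colX i j) (colY i f) (colY i j)
  proper-s {a} {b} {i} {j} {f} _ _ _ _ f<t xs ys rewrite x-parity xs | y-parity′ i f<t ys = lemma (even (block a b)) (even (block i f + f % g))
    where
    lemma : ∀ x y → Distinct {4} (if x then 0F else 1F) (if not x then 0F else 1F) (if y then 2F else 3F) (if not y then 2F else 3F)
    lemma true  true  = _
    lemma true  false = _
    lemma false true  = _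
    lemma false false = _

  fold-bound : ∀ x {r} → r < g → proj₂ (fold x r) < g
  fold-bound x {r} lt with even x
  ... | true  = lt
  ... | false = zigzag-bound {g} {r} true lt

  inj-s : ∀ {i j i' j'} → i < s → j < t → i' < s → j' < t → place-s i j ≡ place-s i' j' → i ≡ i' × j ≡ j'
  inj-s {i} {j} {i'} {j'} i< j< i'< j'< eq with fold-injective (coset-< i (j / g)) (coset-< i' (j' / g)) (m%n<n j g) (m%n<n j' g) eq
  ... | c , r with trans (sym (coset-row i (j / g) i<)) (trans (cong (_% s) c) (coset-row i' (j' / g) i'<))
  ...   | refl = refl , trans (column-split j) (trans (cong₂ (λ a b → a + b * g) r (coset-column i (j / g) (j' / g) (j/g<t′ j<) (j/g<t′ j'<) c)) (sym (column-split j')))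

  drawX-s : ∀ {Vx i j i' j'} → i < s → j < t → j' < t → XStep s t d i j i' j' → Drawn Vx (Chordˢ (colX i j)) (place-s i j) (place-s i' j')
  drawX-s {Vx} {i} {j} {i'} {j'} _ _ _ xs = subst (λ p → Drawn Vx (Chordˢ (colX i j)) (place-s i j) p) (sym (cong₂ fold (proj₂ (upwards xs)) (proj₁ (upwards xs))))
    (drawn (colX i j) (family-x (coset-< i (j / g)) (m%n<n j g))
      (fold-≢ (coset-< i (j / g)) (m%n<n _ n) (m%n<n j g) (m%n<n j g) (trans (cong even (sym (proj₂ (upwards xs)))) (x-parity xs))))

  drawY-s : ∀ {Vx i j j'} → i < s → j < t → YStep t j j' → Drawn Vx (Chordˢ (colY i j)) (place-s i j) (place-s i j')
  drawY-s {Vx} {i} {j} {j'} _ j<t ys with rightwards i j<t ys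
  ... | inside q r = subst (λ p → Drawn Vx (Chordˢ (colY i j)) (place-s i j) p) (sym (cong₂ (λ a b → fold (coset i a) b) q r)) (neighbours (even (block i j)) refl)
    where
    lt : suc (j % g) < g
    lt = subst (_< g) r (m%n<n j' g)
    neighbours : ∀ b → even (block i j) ≡ b → Drawn Vx (Chordˢ (colY i j)) (fold (block i j) (j % g)) (fold (block i j) (suc (j % g)))
    neighbours true  eq rewrite eq = adjacent
    neighbours false eq rewrite eq | ∸-suc lt = adjacentᵒ
  ... | across rg z c = subst₂ (λ k p → Drawn Vx (Chordˢ k) (place-s i j) p) (sym (cong (λ b → if b then 2F else 3F) (even-+-even (block i j) (g-1-even rg)))) (sym (cong₂ fold c z))
    (drawn (if even (block i j) then 2F else 3F) (family-y (coset-< i (j / g)) rg)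
      (fold-≢ (coset-< i (j / g)) (m%n<n _ n) (m%n<n j g) (>-nonZero⁻¹ g) (trans (even-mod _) (even-+-odd (block i j) e-odd))))

  spiral-layout : Layout s t d 4
  spiral-layout = record
    { width = g ; P = place-s ; P-bound = λ {i} {j} _ _ → fold-bound (coset i (j / g)) (m%n<n j g) ; P-inj = inj-s
    ; cX = colX ; cY = colY ; proper = proper-s ; Chord = Chordˢ ; chord-≺ = proj₁
    ; uncrossed = λ {c} (_ , C) (_ , D) → family-uncrossed c C D
    ; drawX = drawX-s ; drawY = drawY-s }

-- Modular inverses and the parameters of the spiral

∨-falseʳ : ∀ {a b} → (a ∨ b) ≡ false → a ≡ false × b ≡ false
∨-falseʳ {false} {false} _ = refl , refl

-- Dividing the Bézout identity by `g` leaves `x * d′ ≡ 1 + y * t′`; then `x` is reduced modulo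
-- `t′`.
modular-inverse : ∀ {d′ t′ g x y} .{{_ : NonZero g}} .{{_ : NonZero t′}} → even t′ ≡ true → g + y * (t′ * g) ≡ x * (d′ * g) →
                  ∃₂ λ k u → k < t′ × k * d′ ≡ 1 + u * t′
modular-inverse {d′} {t′} {g} {x} {y} et eq = x % t′ , (x % t′ * d′) / t′ , m%n<n x t′ ,
  trans (m≡m%n+[m/n]*n (x % t′ * d′) t′) (cong (_+ (x % t′ * d′) / t′ * t′) unit)
  where
  open ≡-Reasoning
  -- A positive even modulus exceeds 1, so that `1 % t′` is 1.
  2≤t′ : ∀ {m} → .{{_ : NonZero m}} → even m ≡ true → 1 < m
  2≤t′ {suc (suc m)} _ = s≤s (s≤s z≤n)
  l₁ : ∀ y t g → (1 + y * t) * g ≡ g + y * (t * g)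
  l₁ = solve-∀
  base′ : 1 + y * t′ ≡ x * d′
  base′ = *-cancelʳ-≡ _ _ g (trans (l₁ y t′ g) (trans eq (sym (*-assoc x d′ g))))
  unit : x % t′ * d′ % t′ ≡ 1
  unit = begin
    x % t′ * d′ % t′               ≡⟨ %-distribˡ-* (x % t′) d′ t′ ⟩
    (x % t′ % t′) * (d′ % t′) % t′ ≡⟨ cong (λ z → z * (d′ % t′) % t′) (m%n%n≡m%n x t′) ⟩
    (x % t′) * (d′ % t′) % t′      ≡⟨ sym (%-distribˡ-* x d′ t′) ⟩
    x * d′ % t′                    ≡⟨ cong (_% t′) (sym base′) ⟩
    (1 + y * t′) % t′              ≡⟨ [m+kn]%n≡m%n 1 y t′ ⟩
    1 % t′                         ≡⟨ m<n⇒m%n≡m (2≤t′ et) ⟩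
    1                              ∎

-- Here `x` is the negative of an inverse. Multiplying by `t′ - 1`, which is `suc τ` and acts as
-- minus one, brings the identity into the previous form.
modular-inverseᵒ : ∀ {d′ t′ g x y} .{{_ : NonZero g}} .{{_ : NonZero t′}} → even t′ ≡ true → g + x * (d′ * g) ≡ y * (t′ * g) →
                   ∃₂ λ k u → k < t′ × k * d′ ≡ 1 + u * t′
modular-inverseᵒ {t′ = suc zero} () eq
modular-inverseᵒ {t′ = suc (suc τ)} {g} {x} {zero} et eq = contradiction (m+n≡0⇒m≡0 g eq) (≢-nonZero⁻¹ g)
modular-inverseᵒ {d′} {suc (suc τ)} {g} {x} {suc y} et eq = modular-inverse {d′} {suc (suc τ)} {g} {x * suc τ} {τ + y * suc τ} et
  (+-cancelʳ-≡ (suc τ * g) _ _ (begin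
    g + (τ + y * suc τ) * ((2 + τ) * g) + suc τ * g  ≡⟨ l₁ g τ y ⟩
    suc y * ((2 + τ) * g) * suc τ                    ≡⟨ cong (_* suc τ) (sym eq) ⟩
    (g + x * (d′ * g)) * suc τ                       ≡⟨ l₂ g x d′ τ ⟩
    x * suc τ * (d′ * g) + suc τ * g                 ∎))
  where
  open ≡-Reasoning
  l₁ : ∀ g τ y → g + (τ + y * suc τ) * ((2 + τ) * g) + suc τ * g ≡ suc y * ((2 + τ) * g) * suc τ
  l₁ = solve-∀
  l₂ : ∀ g x d τ → (g + x * (d * g)) * suc τ ≡ x * suc τ * (d * g) + suc τ * g
  l₂ = solve-∀

spiral : ∀ {s t d} → even s ≡ false → even t ≡ true → even d ≡ false → 0 < t → Layout s t d 4
spiral {s} {t} {d} s-odd t-even d-odd 0<t with gcd d t | gcd-GCD d t | gcd[m,n]∣m d t | gcd[m,n]∣n d t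
... | g | G | divides d′ d≡ | divides t′ t≡ = build (inverse (Bézout.identity G))
  where
  g-odd : even g ≡ false
  g-odd = proj₂ (∨-falseʳ {even d′} (trans (sym (even-* d′ g)) (trans (cong even (sym d≡)) d-odd)))
  t′-even : even t′ ≡ true
  t′-even = lemma (trans (sym (even-* t′ g)) (trans (cong even (sym t≡)) t-even)) g-odd
    where
    lemma : ∀ {a b} → (a ∨ b) ≡ true → b ≡ false → a ≡ true
    lemma {true} _ _ = refl
    lemma {false} refl ()
  odd-nonZero : ∀ {m} → even m ≡ false → NonZero m
  odd-nonZero {suc m} _ = _
  instance
    g≢0 : NonZero g
    g≢0 = odd-nonZero g-odd
    s≢0 : NonZero s
    s≢0 = odd-nonZero s-odd
    t′≢0 : NonZero t′
    t′≢0 = ≢-nonZero λ { refl → n≮n 0 (subst (0 <_) t≡ 0<t) }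
  inverse : Bézout.Identity g d t → ∃₂ λ k u → k < t′ × k * d′ ≡ 1 + u * t′
  inverse (Bézout.+- x y eq) = modular-inverse {d′} {t′} {g} {x} {y} t′-even (subst₂ (λ a b → g + y * a ≡ x * b) t≡ d≡ eq)
  inverse (Bézout.-+ x y eq) = modular-inverseᵒ {d′} {t′} {g} {x} {y} t′-even (subst₂ (λ a b → g + x * b ≡ y * a) t≡ d≡ eq)
  build : (∃₂ λ k u → k < t′ × k * d′ ≡ 1 + u * t′) → Layout s t d 4
  build (k , u , k<t′ , inv) = Spiral.spiral-layout {s} {t} {d} {g} {t′} {d′} {k} {u} t≡ d≡ inv k<t′ s-odd g-odd k-odd t′-even
    where
    -- The product `k * d′` exceeds a multiple of the even `t′` by one, so both factors are odd.
    k-odd : even k ≡ false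
    k-odd = proj₁ (∨-falseʳ (trans (sym (even-* k d′)) (trans (cong even inv) (cong not (trans (even-* u t′) (lemma (even u)))))))
      where
      lemma : ∀ a → (a ∨ even t′) ≡ true
      lemma true  = refl
      lemma false = t′-even

-- Case distinction and the theorem

module _ {s t d : ℕ} (3≤s : 3 ≤ s) (3≤t : 3 ≤ t) (d<t : d < t) where

  private
    2≤t : 2 ≤ t
    2≤t = ≤-trans (n≤1+n 2) 3≤t

  four-pages : even t ≡ true → even s ≡ even d → MatchingBookEmbedding (BundleAdj s t d) 4
  four-pages et sd with even s in es
  ... | true  = embedding 3≤s 3≤t d<t (zigzag-four es et (sym sd) 2≤t d<t)
  ... | false = embedding 3≤s 3≤t d<t (spiral es et (sym sd) (≤-trans (s≤s z≤n) 3≤t))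

-- `suc d` is even, hence different from `t`.
odd-gap : ∀ {t d} → even t ≡ false → even d ≡ false → d < t → 2 + d ≤ t
odd-gap ot od lt = ≤∧≢⇒< lt λ { refl → true≢false (trans (sym (cong not od)) ot) }

five-pages : ∀ {s t d} → 3 ≤ s → 3 ≤ t → d < t → MatchingBookEmbedding (BundleAdj s t d) 5
five-pages {suc zero} (s≤s ()) _ _
five-pages {suc (suc zero)} (s≤s (s≤s ())) _ _
five-pages {suc (suc (suc r))} {t} {d} 3≤s 3≤t d<t with even (suc (suc (suc r))) in es
... | true = embedding 3≤s 3≤t d<t (zigzag-five es (≤-trans (n≤1+n 2) 3≤t) d<t)
... | false with even t in et
...   | true = embedding 3≤s 3≤t d<t (ladder-even r-even et (≤-trans (n≤1+n 2) 3≤t))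
  where
  r-even : even r ≡ true
  r-even = not-injective (trans (sym (not-involutive _)) es)
...   | false with m≤n⇒m<n∨m≡n 3≤t
...     | inj₂ refl = embedding 3≤s 3≤t d<t (Triangle.triangle-layout r d (not-injective (trans (sym (not-involutive _)) es)) d<t)
...     | inj₁ 4≤t = odd-odd d d<t
  where
  r-even : even r ≡ true
  r-even = not-injective (trans (sym (not-involutive _)) es)
  5≤t : 5 ≤ t
  5≤t = ≤∧≢⇒< 4≤t λ { refl → true≢false et }
  odd-odd : ∀ d → d < t → MatchingBookEmbedding (BundleAdj (3 + r) t d) 5
  odd-odd zero d<t = embedding 3≤s 3≤t d<t (ladder-untwisted r-even et 5≤t)
  odd-odd (suc d) d<t with even (suc d) in ed
  ... | false = embedding 3≤s 3≤t d<t (ladder-odd r-even et 5≤t (odd-gap et ed d<t) ed)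
  -- Subtracting an even twist from the odd `t` gives an odd one.
  ... | true = pullback mirror mirror-injective (mirror-hom d<t) (embedding 3≤s 3≤t t-d<t (ladder-odd r-even et 5≤t (odd-gap et t-d-odd t-d<t) t-d-odd))
    where
    open Reflect {3 + r} {t} {suc d} (<⇒≤ d<t)
    t-d<t : t ∸ suc d < t
    t-d<t = ∸-monoʳ-< z<s (<⇒≤ d<t)
    t-d-odd : even (t ∸ suc d) ≡ false
    t-d-odd = lemma (even (t ∸ suc d)) (trans (cong (λ b → not (even (t ∸ suc d) xor b)) (sym ed)) (trans (sym (even-+ (t ∸ suc d) (suc d))) (trans (cong even (m∸n+n≡m (<⇒≤ d<t))) et)))
      where
      lemma : ∀ b → not (b xor true) ≡ false → b ≡ false
      lemma false _ = refl

theorem3p1 : (s t d : ℕ) → 3 ≤ s → 3 ≤ t → 1 ≤ d → d ≤ t →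
    (Bipartite (BundleAdj s t d) → MBT≡ (BundleAdj s t d) 4) ×
    (¬ Bipartite (BundleAdj s t d) → MBT≡ (BundleAdj s t d) 5)
theorem3p1 s t@(suc t-1) d 3≤s 3≤t _ _ = four , five
  where
  d′ = d % t
  d′<t : d′ < t
  d′<t = m%n<n d t
  open Bundle {s} {t} {d′} 3≤s 3≤t d′<t

  reduce : ∀ {u v} → BundleAdj s t d u v → BundleAdj s t d′ u v
  reduce = retwist (%-reduce t-1 d)
  restore : ∀ {u v} → BundleAdj s t d′ u v → BundleAdj s t d u v
  restore = retwist (sym ∘ %-reduce t-1 d)

  lower : ∀ {m k} → (∀ k → MatchingBookEmbedding (BundleAdj s t d′) k → m ≤ k) → MatchingBookEmbedding (BundleAdj s t d) k → m ≤ k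
  lower bound M = bound _ (pullback (λ u → u) (λ e → e) restore M)

  four : Bipartite (BundleAdj s t d) → MBT≡ (BundleAdj s t d) 4
  four (f , proper) = pullback (λ u → u) (λ e → e) reduce (four-pages 3≤s 3≤t d′<t (t-even bip) (s-d-parity bip)) , λ k → lower pages≥4
    where
    bip : Bipartite (BundleAdj s t d′)
    bip = f , λ u v p → proper u v (restore p)

  five : ¬ Bipartite (BundleAdj s t d) → MBT≡ (BundleAdj s t d) 5
  five ¬bip = pullback (λ u → u) (λ e → e) reduce (five-pages 3≤s 3≤t d′<t) ,
    λ k → lower (pages≥5 λ (f , proper) → ¬bip (f , λ u v p → proper u v (reduce p)))
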